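{- Let $K$ be a field with $\operatorname{char}K\neq 2$, let $D\in K^\times$, and let $M$ be the cyclic Galois module of order $4$ corresponding to the quadratic extension $K[\sqrt{D}]$, i.e. $M=\mathbb{Z}/4\mathbb{Z}$ with $g\in G_K$ acting by multiplication by $\chi_D(g)=g(\sqrt{D})/\sqrt{D}\in\{\pm1\}$. Then there is a group isomorphism $$H^1(K,M)\cong\{(\alpha,c)\in K[\sqrt{ -D}]^\times\times K^\times : N(\alpha)=c^4\}\big/\{(\beta^4,N(\beta)) : \beta\in K[\sqrt{ -D}]^\times\}$$ in which the coclass corresponding to a pair $(a+b\sqrt{ -D},c)$ ($a,b,c\in K$) has corresponding quartic algebra $$L=K\Big[\sqrt{2a+2c^2},\ \sqrt{2c+\sqrt{2a+2c^2}}\Big].$$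
   Context: $N$ denotes the norm from $K[\sqrt{ -D}]=K[X]/(X^2+D)$ to $K$. $K^{\mathrm{sep}}$ is a separable closure and $G_K$ its absolute Galois group. The quartic algebra $L$ is the iterated adjunction $K[u,v]/(u^2-(2a+2c^2),\,v^2-(2c+u))$. The correspondence between $H^1(K,M)$ and quartic étale algebras is: a coclass represented by a crossed homomorphism $\sigma:G_K\to M$ (i.e. $\sigma(gh)=\sigma(g)+g\sigma(h)$) corresponds to the étale algebra $L$ of degree $4$ whose coordinates ($K$-algebra maps $L\to K^{\mathrm{sep}}$) admit a labeling $\{\iota_x\}_{x\in M}$ with $g\circ\iota_x=\iota_{gx+\sigma(g)}$ for all $g\in G_K$; i.e. $L$ is the $\operatorname{Hol}(\mathbb{Z}/4)\cong D_4$-extension associated to $g\mapsto(x\mapsto gx+\sigma(g))$.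
   Formalization: The description of the quartic algebra L is stated only for pairs (a+b√-D, c) with b ≠ 0: if b = 0, e.g. for the pair (1,1), the algebra L has nilpotents and is not étale, so the claim fails there; the group isomorphism itself is unrestricted. -}

module Defs where

open import Algebra.Bundles using (AbelianGroup; CommutativeRing; Group)
import Algebra.Construct.DirectProduct as DirectProduct
open import Algebra.Definitions using (Invertible)
open import Algebra.Definitions.RawMonoid using (sum)
open import Algebra.Morphism.Bundles using (RingHomomorphism)
import Algebra.Morphism.Construct.Composition as Composition
import Algebra.Morphism.Construct.Identity as Identity
open import Algebra.Morphism.Structures
  using (IsRingHomomorphism; IsRingIsomorphism)
import Algebra.Properties.AbelianGroup as AbelianGroupProperties
import Algebra.Properties.CommutativeSemigroup as CommutativeSemigroupProperties
import Algebra.Properties.CommutativeSemiring.Exp as Exp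
import Algebra.Properties.Group as GroupProperties
import Algebra.Properties.Ring as RingProperties
import Algebra.Solver.Ring.NaturalCoefficients.Default as Solver
open import Axiom.ExcludedMiddle using (ExcludedMiddle)
open import Data.Empty using (⊥-elim)
open import Data.Fin using (Fin; toℕ)
open import Data.Fin.Patterns using (0F)
open import Data.Fin.Properties using (all?) renaming (_≟_ to _≟ᶠ_)
open import Data.List using (List; []; _∷_; _++_; map)
open import Data.List.Relation.Unary.All using (All; []; _∷_)
open import Data.List.Relation.Unary.All.Properties using (++⁻ˡ; ++⁻ʳ)
open import Data.Nat as ℕ using (ℕ; zero; suc)
open import Data.Nat.DivMod using (_mod_)
open import Data.Product using (∃; ∃-syntax; _×_; _,_; proj₁; proj₂)
open import Data.Sign using (Sign) renaming (_*_ to _*ₛ_)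
open import Data.Sum using (_⊎_)
open import Function using (_∘_; Bijective)
open import Level using (Setω; _⊔_) renaming (suc to lsuc)
open import Relation.Binary using (Poset)
open import Relation.Binary.PropositionalEquality as ≡ using (_≡_)
import Relation.Binary.Reasoning.Setoid as SetoidReasoning
open import Relation.Nullary using (yes; no)
open import Relation.Nullary.Decidable using (from-yes)
open import Relation.Unary using (Pred; _∈_)

Zorn : ∀ c ℓ₁ ℓ₂ p → Set _
Zorn c ℓ₁ ℓ₂ p = (P : Poset c ℓ₁ ℓ₂) → let open Poset P in
  (∀ (C : Pred Carrier p) →
     (∀ {x y} → x ∈ C → y ∈ C → x ≤ y ⊎ y ≤ x) →
     ∃[ u ] (∀ {x} → x ∈ C → x ≤ u)) →
  ∃[ m ] (∀ x → m ≤ x → x ≤ m)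

-- Galois theory over an arbitrary field needs excluded middle and choice (an
-- automorphism of a subextension extends to the separable closure by Zorn's lemma).
-- Neither is available in Agda, so they are carried as data.

record Classical : Setω where
  field
    em   : ∀ {ℓ} → ExcludedMiddle ℓ
    zorn : ∀ {c ℓ₁ ℓ₂ p} → Zorn c ℓ₁ ℓ₂ p

IsUnit : ∀ {c ℓ} (R : CommutativeRing c ℓ) → CommutativeRing.Carrier R → Set _
IsUnit R = Invertible _≈_ 1# _*_
  where open CommutativeRing R

record Field c ℓ : Set (lsuc (c ⊔ ℓ)) where
  field
    commutativeRing : CommutativeRing c ℓ

  open CommutativeRing commutativeRing public

  field
    1≉0     : 1# ≉ 0#
    inverse : ∀ x → x ≉ 0# → IsUnit commutativeRing x

CharacteristicNot2 : ∀ {c ℓ} → Field c ℓ → Set ℓ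
CharacteristicNot2 K = 1# + 1# ≉ 0#
  where open Field K

record Algebra {k kℓ} (K : CommutativeRing k kℓ) c ℓ : Set (k ⊔ kℓ ⊔ lsuc (c ⊔ ℓ)) where
  field
    commutativeRing : CommutativeRing c ℓ

  open CommutativeRing commutativeRing public

  field
    structure : RingHomomorphism (CommutativeRing.rawRing K) rawRing

  open RingHomomorphism structure public
    using () renaming (⟦_⟧ to embed; isRingHomomorphism to embed-isRingHomomorphism)

record AlgebraHom {k kℓ a aℓ b bℓ} {K : CommutativeRing k kℓ}
                  (A : Algebra K a aℓ) (B : Algebra K b bℓ)
                  : Set (k ⊔ a ⊔ aℓ ⊔ b ⊔ bℓ) where
  private
    module A = Algebra A
    module B = Algebra B
  field
    homomorphism : RingHomomorphism A.rawRing B.rawRing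

  open RingHomomorphism homomorphism public

  field
    commutes : ∀ x → ⟦ A.embed x ⟧ B.≈ B.embed x

HasDegree : ∀ {k kℓ c ℓ} {K : CommutativeRing k kℓ} → ℕ → Algebra K c ℓ → Set _
HasDegree {K = K} n A =
  ∃[ e ] (∀ x → ∃[ t ] x ≈ combination e t) ×
         (∀ t → combination e t ≈ 0# → ∀ i → t i K.≈ K.0#)
  where
  module K = CommutativeRing K
  open Algebra A
  combination : (Fin n → Carrier) → (Fin n → K.Carrier) → Carrier
  combination e t = sum +-rawMonoid (λ i → embed (t i) * e i)

-- R[√r] = R[X]/(X² - r), with (a , b) standing for a + b√r.

module Adjoin {c ℓ} (R : CommutativeRing c ℓ) (r : CommutativeRing.Carrier R) where

  open CommutativeRing R
  private
    module ⊕ = AbelianGroup (DirectProduct.abelianGroup +-abelianGroup +-abelianGroup)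
    open RingProperties ring using (-‿distribˡ-*; -‿distribʳ-*; -0#≈0#)
    open AbelianGroupProperties +-abelianGroup using (⁻¹-∙-comm; ⁻¹-involutive)
    open CommutativeSemigroupProperties +-commutativeSemigroup using (interchange)
    open Solver commutativeSemiring using (solve; _:+_; _:*_; _:=_)

  Carrier√ : Set c
  Carrier√ = Carrier × Carrier

  infixl 7 _*√_

  _*√_ : Carrier√ → Carrier√ → Carrier√
  (a , b) *√ (a′ , b′) = a * a′ + r * (b * b′) , a * b′ + b * a′

  -- The determinant of multiplication by a + b√r on the basis 1, √r.

  norm : Carrier√ → Carrier
  norm (a , b) = a * a - r * (b * b)

  norm-cong : ∀ {x y} → x ⊕.≈ y → norm x ≈ norm y
  norm-cong (p , q) = +-cong (*-cong p p) (-‿cong (*-congˡ (*-cong q q)))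

  private
    *√-comm : ∀ x y → (x *√ y) ⊕.≈ (y *√ x)
    *√-comm (a , b) (a′ , b′) =
        +-cong (*-comm a a′) (*-congˡ (*-comm b b′))
      , trans (+-comm _ _) (+-cong (*-comm b a′) (*-comm a b′))

    *√-cong : ∀ {x y u v} → x ⊕.≈ y → u ⊕.≈ v → (x *√ u) ⊕.≈ (y *√ v)
    *√-cong (p , q) (p′ , q′) =
        +-cong (*-cong p p′) (*-congˡ (*-cong q q′))
      , +-cong (*-cong p q′) (*-cong q p′)

    *√-assoc : ∀ x y z → ((x *√ y) *√ z) ⊕.≈ (x *√ (y *√ z))
    *√-assoc (a , b) (a′ , b′) (a″ , b″) =
        solve 7 (λ r a b a′ b′ a″ b″ →
          ((a :* a′ :+ r :* (b :* b′)) :* a″ :+ r :* ((a :* b′ :+ b :* a′) :* b″))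
          := (a :* (a′ :* a″ :+ r :* (b′ :* b″)) :+ r :* (b :* (a′ :* b″ :+ b′ :* a″))))
          refl r a b a′ b′ a″ b″
      , solve 7 (λ r a b a′ b′ a″ b″ →
          ((a :* a′ :+ r :* (b :* b′)) :* b″ :+ (a :* b′ :+ b :* a′) :* a″)
          := (a :* (a′ :* b″ :+ b′ :* a″) :+ b :* (a′ :* a″ :+ r :* (b′ :* b″))))
          refl r a b a′ b′ a″ b″

    *√-identityˡ : ∀ x → ((1# , 0#) *√ x) ⊕.≈ x
    *√-identityˡ (a , b) =
        trans (+-cong (*-identityˡ a) (trans (*-congˡ (zeroˡ b)) (zeroʳ r))) (+-identityʳ a)
      , trans (+-cong (*-identityˡ b) (zeroˡ a)) (+-identityʳ b)

    *√-distribˡ : ∀ x y z → (x *√ (y ⊕.∙ z)) ⊕.≈ ((x *√ y) ⊕.∙ (x *√ z))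
    *√-distribˡ (a , b) (a′ , b′) (a″ , b″) =
        trans (+-cong (distribˡ a a′ a″) (trans (*-congˡ (distribˡ b b′ b″)) (distribˡ r _ _)))
              (interchange _ _ _ _)
      , trans (+-cong (distribˡ a b′ b″) (distribˡ b a′ a″)) (interchange _ _ _ _)

  commutativeRing√ : CommutativeRing c ℓ
  commutativeRing√ = record
    { Carrier = Carrier√
    ; _≈_     = ⊕._≈_
    ; _+_     = ⊕._∙_
    ; _*_     = _*√_
    ; -_      = ⊕._⁻¹
    ; 0#      = ⊕.ε
    ; 1#      = 1# , 0#
    ; isCommutativeRing = record
      { isRing = record
        { +-isAbelianGroup = ⊕.isAbelianGroup
        ; *-cong     = λ {x} {y} {u} {v} → *√-cong {x} {y} {u} {v}
        ; *-assoc    = *√-assoc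
        ; *-identity = *√-identityˡ
                     , λ x → ⊕.trans (*√-comm x _) (*√-identityˡ x)
        ; distrib    = *√-distribˡ
                     , λ x y z → ⊕.trans (*√-comm (y ⊕.∙ z) x)
                                 (⊕.trans (*√-distribˡ x y z)
                                          (⊕.∙-cong (*√-comm x y) (*√-comm x z)))
        }
      ; *-comm = *√-comm
      }
    }

  constant : Carrier → Carrier√
  constant a = a , 0#

  root : Carrier√
  root = 0# , 1#

  constant-isRingHomomorphism :
    IsRingHomomorphism rawRing (CommutativeRing.rawRing commutativeRing√) constant
  constant-isRingHomomorphism = record
    { isSemiringHomomorphism = record
      { isNearSemiringHomomorphism = record
        { +-isMonoidHomomorphism = record
          { isMagmaHomomorphism = record
            { isRelHomomorphism = record { cong = λ p → p , refl }
            ; homo = λ _ _ → refl , sym (+-identityʳ 0#)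
            }
          ; ε-homo = refl , refl
          }
        ; *-homo = λ a b →
            sym (trans (+-congˡ (trans (*-congˡ (zeroˡ 0#)) (zeroʳ r))) (+-identityʳ _))
          , sym (trans (+-cong (zeroʳ a) (zeroˡ b)) (+-identityʳ 0#))
        }
      ; 1#-homo = refl , refl
      }
    ; -‿homo = λ _ → refl , sym -0#≈0#
    }

  private
    cancel : ∀ p q t → (p + t) - (q + t) ≈ p - q
    cancel p q t = begin
      (p + t) + - (q + t)      ≈⟨ +-congˡ (⁻¹-∙-comm q t) ⟨
      (p + t) + (- q + - t)    ≈⟨ interchange p t (- q) (- t) ⟩
      (p - q) + (t - t)        ≈⟨ +-congˡ (-‿inverseʳ t) ⟩
      (p - q) + 0#             ≈⟨ +-identityʳ _ ⟩
      p - q                    ∎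
      where open SetoidReasoning setoid

    difference-* : ∀ p q p′ q′ → (p - q) * (p′ - q′) ≈ (p * p′ + q * q′) - (p * q′ + q * p′)
    difference-* p q p′ q′ = begin
      (p - q) * (p′ - q′)
        ≈⟨ trans (distribʳ _ _ _) (+-cong (distribˡ _ _ _) (distribˡ _ _ _)) ⟩
      (p * p′ + p * - q′) + (- q * p′ + - q * - q′)
        ≈⟨ +-cong (+-congˡ (sym (-‿distribʳ-* p q′)))
                  (trans (+-comm _ _) (+-cong q*q (sym (-‿distribˡ-* q p′)))) ⟩
      (p * p′ + - (p * q′)) + (q * q′ + - (q * p′))
        ≈⟨ interchange _ _ _ _ ⟩
      (p * p′ + q * q′) + (- (p * q′) + - (q * p′))
        ≈⟨ +-congˡ (⁻¹-∙-comm _ _) ⟩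
      (p * p′ + q * q′) - (p * q′ + q * p′) ∎
      where
      open SetoidReasoning setoid
      q*q : - q * - q′ ≈ q * q′
      q*q = trans (sym (-‿distribˡ-* q (- q′)))
                  (trans (-‿cong (sym (-‿distribʳ-* q q′))) (⁻¹-involutive _))

  norm-* : ∀ x y → norm (x *√ y) ≈ norm x * norm y
  norm-* (a , b) (a′ , b′) = begin
    norm ((a , b) *√ (a′ , b′))
      ≈⟨ +-cong
           (solve 5 (λ r a b a′ b′ →
              ((a :* a′ :+ r :* (b :* b′)) :* (a :* a′ :+ r :* (b :* b′)))
              := ((a :* a :* (a′ :* a′) :+ r :* (b :* b) :* (r :* (b′ :* b′)))
                 :+ (r :* (a :* a′ :* (b :* b′)) :+ r :* (a :* a′ :* (b :* b′)))))
              refl r a b a′ b′)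
           (-‿cong (solve 5 (λ r a b a′ b′ →
              (r :* ((a :* b′ :+ b :* a′) :* (a :* b′ :+ b :* a′)))
              := ((a :* a :* (r :* (b′ :* b′)) :+ r :* (b :* b) :* (a′ :* a′))
                 :+ (r :* (a :* a′ :* (b :* b′)) :+ r :* (a :* a′ :* (b :* b′)))))
              refl r a b a′ b′)) ⟩
    _ ≈⟨ cancel _ _ _ ⟩
    (a * a * (a′ * a′) + r * (b * b) * (r * (b′ * b′)))
      - (a * a * (r * (b′ * b′)) + r * (b * b) * (a′ * a′))
      ≈⟨ difference-* _ _ _ _ ⟨
    norm (a , b) * norm (a′ , b′) ∎
    where open SetoidReasoning setoid

  norm-1 : norm (1# , 0#) ≈ 1#
  norm-1 = begin
    1# * 1# - r * (0# * 0#) ≈⟨ +-cong (*-identityˡ 1#) (-‿cong (trans (*-congˡ (zeroˡ 0#)) (zeroʳ r))) ⟩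
    1# - 0#                 ≈⟨ +-congˡ -0#≈0# ⟩
    1# + 0#                 ≈⟨ +-identityʳ 1# ⟩
    1#                      ∎
    where open SetoidReasoning setoid

Adjoin√ : ∀ {k kℓ c ℓ} {K : CommutativeRing k kℓ}
          (A : Algebra K c ℓ) → Algebra.Carrier A → Algebra K c ℓ
Adjoin√ A r = record
  { commutativeRing = commutativeRing√
  ; structure = record
    { ⟦_⟧ = constant ∘ embed
    ; isRingHomomorphism =
        Composition.isRingHomomorphism (CommutativeRing.trans commutativeRing√)
          embed-isRingHomomorphism constant-isRingHomomorphism
    }
  }
  where
  open Algebra A
  open Adjoin commutativeRing r

baseAlgebra : ∀ {k kℓ} (K : CommutativeRing k kℓ) → Algebra K k kℓ
baseAlgebra K = record
  { commutativeRing = K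
  ; structure       = Identity.ringHomomorphism (CommutativeRing.ring K)
  }

-- K[u,v]/(u² - d, v² - (2c+u)) with d = 2a+2c².  As 2 is invertible, this is étale
-- exactly when d and the norm 4c² - d = 2c² - 2a of 2c+u are both nonzero.  Their
-- product is 4(c⁴ - a²), which is 4Db² when a² + Db² = c⁴; so for D ≠ 0 the algebra is
-- étale if and only if b ≠ 0, and otherwise it contains nilpotents.

quarticAlgebra : ∀ {k kℓ} (K : CommutativeRing k kℓ) (a c : CommutativeRing.Carrier K) →
                 Algebra K k kℓ
quarticAlgebra K a c = Adjoin√ (Adjoin√ (baseAlgebra K) d) (constant (2# * c) K[u].+ u)
  where
  open CommutativeRing K
  2# = 1# + 1#
  d  = 2# * a + 2# * (c * c)
  open Adjoin K d renaming (root to u)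
  module K[u] = CommutativeRing commutativeRing√

-- Polynomials are lists of coefficients starting with the constant term; trailing
-- zeros are allowed.

module Polynomial {c ℓ} (R : CommutativeRing c ℓ) where

  open CommutativeRing R

  Poly : Set c
  Poly = List Carrier

  coefficient : Poly → ℕ → Carrier
  coefficient []      _       = 0#
  coefficient (a ∷ p) zero    = a
  coefficient (a ∷ p) (suc n) = coefficient p n

  infix 4 _≈ₚ_

  _≈ₚ_ : Poly → Poly → Set ℓ
  p ≈ₚ q = ∀ n → coefficient p n ≈ coefficient q n

  evaluate : Poly → Carrier → Carrier
  evaluate []      x = 0#
  evaluate (a ∷ p) x = a + x * evaluate p x

  infixl 6 _+ₚ_
  infixl 7 _*ₚ_

  _+ₚ_ : Poly → Poly → Poly
  []      +ₚ q       = q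
  (a ∷ p) +ₚ []      = a ∷ p
  (a ∷ p) +ₚ (b ∷ q) = a + b ∷ p +ₚ q

  _*ₚ_ : Poly → Poly → Poly
  []      *ₚ q = []
  (a ∷ p) *ₚ q = map (a *_) q +ₚ (0# ∷ p *ₚ q)

  -- (a + X p)′ = p + X p′

  derivative : Poly → Poly
  derivative []      = []
  derivative (a ∷ p) = p +ₚ (0# ∷ derivative p)

  -- p and its derivative generate the unit ideal.

  Separable : Poly → Set (c ⊔ ℓ)
  Separable p = ∃[ u ] ∃[ v ] (u *ₚ p +ₚ v *ₚ derivative p) ≈ₚ (1# ∷ [])

  NonConstant : Poly → Set ℓ
  NonConstant p = ∃[ n ] coefficient p (suc n) ≉ 0#

record SeparableClosure {k kℓ} (K : Field k kℓ) s sℓ : Set (k ⊔ kℓ ⊔ lsuc (s ⊔ sℓ)) where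
  private
    module K = Field K
    module K[X] = Polynomial K.commutativeRing
  field
    closure : Field s sℓ

  open Field closure public
  private module Ω[X] = Polynomial commutativeRing

  field
    structure : RingHomomorphism K.rawRing rawRing

  open RingHomomorphism structure public
    using () renaming (⟦_⟧ to embed; isRingHomomorphism to embed-isRingHomomorphism)

  field
    separable : ∀ x → ∃[ p ] K[X].Separable p × Ω[X].evaluate (map embed p) x ≈ 0#
    closed    : ∀ p → Ω[X].Separable p → Ω[X].NonConstant p → ∃[ x ] Ω[X].evaluate p x ≈ 0#

  algebra : Algebra K.commutativeRing s sℓ
  algebra = record { commutativeRing = commutativeRing ; structure = structure }

module Galois {k kℓ s sℓ} {K : Field k kℓ} (Ω : SeparableClosure K s sℓ) where

  private module K = Field K
  open SeparableClosure Ω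

  record Automorphism : Set (k ⊔ s ⊔ sℓ) where
    field
      ⟦_⟧                : Carrier → Carrier
      isRingIsomorphism : IsRingIsomorphism rawRing rawRing ⟦_⟧
      fixes             : ∀ x → ⟦ embed x ⟧ ≈ embed x

    open IsRingIsomorphism isRingIsomorphism public

  open Automorphism using (⟦_⟧)

  private
    identity : Automorphism
    identity = record
      { ⟦_⟧               = λ x → x
      ; isRingIsomorphism = Identity.isRingIsomorphism rawRing refl
      ; fixes             = λ _ → refl
      }

    compose : Automorphism → Automorphism → Automorphism
    compose g h = record
      { ⟦_⟧               = ⟦ g ⟧ ∘ ⟦ h ⟧
      ; isRingIsomorphism =
          Composition.isRingIsomorphism trans h.isRingIsomorphism g.isRingIsomorphism
      ; fixes             = λ x → trans (g.⟦⟧-cong (h.fixes x)) (g.fixes x)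
      }
      where
      module g = Automorphism g
      module h = Automorphism h

    module Inverse (g : Automorphism) where
      open Automorphism g using (⟦⟧-cong; injective; surjective; fixes;
                                 +-homo; *-homo; -‿homo; 0#-homo; 1#-homo)

      preimage : Carrier → Carrier
      preimage y = proj₁ (surjective y)

      right : ∀ y → ⟦ g ⟧ (preimage y) ≈ y
      right y = proj₂ (surjective y) refl

      unique : ∀ {x y} → ⟦ g ⟧ x ≈ y → preimage y ≈ x
      unique p = injective (trans (right _) (sym p))

      inverse-g : Automorphism
      inverse-g = record
        { ⟦_⟧ = preimage
        ; isRingIsomorphism = record
          { isRingMonomorphism = record
            { isRingHomomorphism = record
              { isSemiringHomomorphism = record
                { isNearSemiringHomomorphism = record
                  { +-isMonoidHomomorphism = record
                    { isMagmaHomomorphism = record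
                      { isRelHomomorphism = record
                        { cong = λ {x} {y} p → unique (trans (right y) (sym p)) }
                      ; homo = λ x y → unique (trans (+-homo _ _) (+-cong (right x) (right y)))
                      }
                    ; ε-homo = unique 0#-homo
                    }
                  ; *-homo = λ x y → unique (trans (*-homo _ _) (*-cong (right x) (right y)))
                  }
                ; 1#-homo = unique 1#-homo
                }
              ; -‿homo = λ x → unique (trans (-‿homo _) (-‿cong (right x)))
              }
            ; injective = λ {x} {y} p →
                trans (sym (right x)) (trans (⟦⟧-cong p) (right y))
            }
          ; surjective = λ y → ⟦ g ⟧ y , λ p → unique (sym p)
          }
        ; fixes = λ x → unique (fixes x)
        }

  absoluteGaloisGroup : Group (k ⊔ s ⊔ sℓ) (s ⊔ sℓ)
  absoluteGaloisGroup = record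
    { Carrier = Automorphism
    ; _≈_     = λ g h → ∀ x → ⟦ g ⟧ x ≈ ⟦ h ⟧ x
    ; _∙_     = compose
    ; ε       = identity
    ; _⁻¹     = Inverse.inverse-g
    ; isGroup = record
      { isMonoid = record
        { isSemigroup = record
          { isMagma = record
            { isEquivalence = record
              { refl  = λ _ → refl
              ; sym   = λ p x → sym (p x)
              ; trans = λ p q x → trans (p x) (q x)
              }
            ; ∙-cong = λ {g} {g′} {h} {h′} p q x →
                trans (Automorphism.⟦⟧-cong g (q x)) (p (⟦ h′ ⟧ x))
            }
          ; assoc = λ _ _ _ _ → refl
          }
        ; identity = (λ _ _ → refl) , (λ _ _ → refl)
        }
      ; inverse = (λ g x → Inverse.unique g refl) , (λ g x → Inverse.right g x)
      ; ⁻¹-cong = λ {g} {h} p x →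
          Inverse.unique g (trans (p _) (Inverse.right h x))
      }
    }

  private module G = Group absoluteGaloisGroup

  -- Continuity for the Krull topology on the Galois group, where the h agreeing
  -- with g on a finite subset of the closure form a basic neighbourhood of g, and
  -- the discrete topology on the target.

  AgreeOn : List Carrier → Automorphism → Automorphism → Set (s ⊔ sℓ)
  AgreeOn S g h = All (λ x → ⟦ g ⟧ x ≈ ⟦ h ⟧ x) S

  Continuous : ∀ {m mℓ} {M : Set m} → (M → M → Set mℓ) → (Automorphism → M) → Set _
  Continuous _~_ f = ∀ g → ∃[ S ] (∀ h → AgreeOn S g h → f g ~ f h)

  record GaloisModule m mℓ : Set (k ⊔ s ⊔ sℓ ⊔ lsuc (m ⊔ mℓ)) where
    infixr 8 _·_
    field
      abelianGroup : AbelianGroup m mℓ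

    open AbelianGroup abelianGroup public using () renaming
      ( Carrier to ∣M∣; _≈_ to _≈ᴹ_; _∙_ to _+ᴹ_; _⁻¹ to -ᴹ_; ε to 0ᴹ; _-_ to _-ᴹ_ )

    field
      _·_          : Automorphism → ∣M∣ → ∣M∣
      ·-cong       : ∀ {g h x y} → g G.≈ h → x ≈ᴹ y → (g · x) ≈ᴹ (h · y)
      ·-identity   : ∀ x → (G.ε · x) ≈ᴹ x
      ·-assoc      : ∀ g h x → ((g G.∙ h) · x) ≈ᴹ (g · (h · x))
      ·-distrib    : ∀ g x y → (g · (x +ᴹ y)) ≈ᴹ ((g · x) +ᴹ (g · y))
      ·-continuous : ∀ x → Continuous _≈ᴹ_ (_· x)

  module Cohomology {m mℓ} (M : GaloisModule m mℓ) where

    open GaloisModule M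

    record CrossedHomomorphism : Set (k ⊔ s ⊔ sℓ ⊔ m ⊔ mℓ) where
      field
        value      : Automorphism → ∣M∣
        cong       : ∀ {g h} → g G.≈ h → value g ≈ᴹ value h
        crossed    : ∀ g h → value (g G.∙ h) ≈ᴹ (value g +ᴹ (g · value h))
        continuous : Continuous _≈ᴹ_ value

    open CrossedHomomorphism

    infix 4 _∼_

    _∼_ : CrossedHomomorphism → CrossedHomomorphism → Set _
    σ ∼ τ = ∃[ m ] (∀ g → value σ g ≈ᴹ (value τ g +ᴹ ((g · m) -ᴹ m)))

    private
      module M where
        open AbelianGroup abelianGroup public
        open GroupProperties group public using (ε⁻¹≈ε; inverseˡ-unique)
        open AbelianGroupProperties abelianGroup public using (⁻¹-∙-comm)
        open CommutativeSemigroupProperties commutativeSemigroup public using (interchange)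
      open SetoidReasoning M.setoid

      ·-0 : ∀ g → (g · 0ᴹ) ≈ᴹ 0ᴹ
      ·-0 g = begin
        g · 0ᴹ                                     ≈⟨ M.identityʳ _ ⟨
        (g · 0ᴹ) +ᴹ 0ᴹ                             ≈⟨ M.∙-congˡ (M.inverseʳ (g · 0ᴹ)) ⟨
        (g · 0ᴹ) +ᴹ ((g · 0ᴹ) -ᴹ (g · 0ᴹ))         ≈⟨ M.assoc _ _ _ ⟨
        ((g · 0ᴹ) +ᴹ (g · 0ᴹ)) -ᴹ (g · 0ᴹ)         ≈⟨ M.∙-congʳ (·-distrib g 0ᴹ 0ᴹ) ⟨
        (g · (0ᴹ +ᴹ 0ᴹ)) -ᴹ (g · 0ᴹ)               ≈⟨ M.∙-congʳ (·-cong (G.refl {g}) (M.identityʳ 0ᴹ)) ⟩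
        (g · 0ᴹ) -ᴹ (g · 0ᴹ)                       ≈⟨ M.inverseʳ _ ⟩
        0ᴹ                                         ∎

      ·-neg : ∀ g x → (g · (-ᴹ x)) ≈ᴹ (-ᴹ (g · x))
      ·-neg g x = M.inverseˡ-unique _ _ (begin
        (g · (-ᴹ x)) +ᴹ (g · x)   ≈⟨ ·-distrib g _ _ ⟨
        g · ((-ᴹ x) +ᴹ x)         ≈⟨ ·-cong (G.refl {g}) (M.inverseˡ x) ⟩
        g · 0ᴹ                    ≈⟨ ·-0 g ⟩
        0ᴹ                        ∎)

      ∂ : ∣M∣ → Automorphism → ∣M∣
      ∂ m g = (g · m) -ᴹ m

      ∂-0 : ∀ g → ∂ 0ᴹ g ≈ᴹ 0ᴹ
      ∂-0 g = M.trans (M.∙-congʳ (·-0 g)) (M.inverseʳ 0ᴹ)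

      ∂-+ : ∀ m n g → ∂ (m +ᴹ n) g ≈ᴹ (∂ m g +ᴹ ∂ n g)
      ∂-+ m n g = begin
        (g · (m +ᴹ n)) -ᴹ (m +ᴹ n)                       ≈⟨ M.∙-cong (·-distrib g m n) (M.sym (M.⁻¹-∙-comm m n)) ⟩
        ((g · m) +ᴹ (g · n)) +ᴹ ((-ᴹ m) +ᴹ (-ᴹ n))       ≈⟨ M.interchange _ _ _ _ ⟩
        ∂ m g +ᴹ ∂ n g                                   ∎

      ∂-neg : ∀ m g → ∂ (-ᴹ m) g ≈ᴹ (-ᴹ (∂ m g))
      ∂-neg m g = M.inverseˡ-unique _ _ (begin
        ∂ (-ᴹ m) g +ᴹ ∂ m g        ≈⟨ ∂-+ (-ᴹ m) m g ⟨
        ∂ ((-ᴹ m) +ᴹ m) g          ≈⟨ M.∙-cong (·-cong (G.refl {g}) (M.inverseˡ m)) (M.⁻¹-cong (M.inverseˡ m)) ⟩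
        ∂ 0ᴹ g                     ≈⟨ ∂-0 g ⟩
        0ᴹ                         ∎)

      ≈⇒∼ : ∀ {σ τ} → (∀ g → value σ g ≈ᴹ value τ g) → σ ∼ τ
      ≈⇒∼ p = 0ᴹ , λ g → M.trans (p g) (M.sym (M.trans (M.∙-congˡ (∂-0 g)) (M.identityʳ _)))

      ∼-sym : ∀ {σ τ} → σ ∼ τ → τ ∼ σ
      ∼-sym {σ} {τ} (m , p) = -ᴹ m , λ g → begin
        value τ g                                 ≈⟨ M.identityʳ _ ⟨
        value τ g +ᴹ 0ᴹ                           ≈⟨ M.∙-congˡ (M.inverseʳ (∂ m g)) ⟨
        value τ g +ᴹ (∂ m g -ᴹ ∂ m g)             ≈⟨ M.assoc _ _ _ ⟨
        (value τ g +ᴹ ∂ m g) -ᴹ ∂ m g             ≈⟨ M.∙-cong (p g) (∂-neg m g) ⟨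
        value σ g +ᴹ ∂ (-ᴹ m) g                   ∎

      ∼-trans : ∀ {ρ σ τ} → ρ ∼ σ → σ ∼ τ → ρ ∼ τ
      ∼-trans {ρ} {σ} {τ} (m , p) (n , q) = n +ᴹ m , λ g → begin
        value ρ g                          ≈⟨ p g ⟩
        value σ g +ᴹ ∂ m g                 ≈⟨ M.∙-congʳ (q g) ⟩
        (value τ g +ᴹ ∂ n g) +ᴹ ∂ m g      ≈⟨ M.assoc _ _ _ ⟩
        value τ g +ᴹ (∂ n g +ᴹ ∂ m g)      ≈⟨ M.∙-congˡ (∂-+ n m g) ⟨
        value τ g +ᴹ ∂ (n +ᴹ m) g          ∎

      add : CrossedHomomorphism → CrossedHomomorphism → CrossedHomomorphism
      add σ τ = record
        { value      = λ g → value σ g +ᴹ value τ g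
        ; cong       = λ p → M.∙-cong (cong σ p) (cong τ p)
        ; crossed    = λ g h → begin
            value σ (g G.∙ h) +ᴹ value τ (g G.∙ h)
              ≈⟨ M.∙-cong (crossed σ g h) (crossed τ g h) ⟩
            (value σ g +ᴹ (g · value σ h)) +ᴹ (value τ g +ᴹ (g · value τ h))
              ≈⟨ M.interchange _ _ _ _ ⟩
            (value σ g +ᴹ value τ g) +ᴹ ((g · value σ h) +ᴹ (g · value τ h))
              ≈⟨ M.∙-congˡ (·-distrib g _ _) ⟨
            (value σ g +ᴹ value τ g) +ᴹ (g · (value σ h +ᴹ value τ h)) ∎
        ; continuous = λ g →
            let (S , p) = continuous σ g ; (T , q) = continuous τ g in
            S ++ T , λ h r → M.∙-cong (p h (++⁻ˡ S r)) (q h (++⁻ʳ S r))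
        }

      negate : CrossedHomomorphism → CrossedHomomorphism
      negate σ = record
        { value      = λ g → -ᴹ value σ g
        ; cong       = λ p → M.⁻¹-cong (cong σ p)
        ; crossed    = λ g h → begin
            -ᴹ value σ (g G.∙ h)                         ≈⟨ M.⁻¹-cong (crossed σ g h) ⟩
            -ᴹ (value σ g +ᴹ (g · value σ h))            ≈⟨ M.⁻¹-∙-comm _ _ ⟨
            (-ᴹ value σ g) +ᴹ (-ᴹ (g · value σ h))       ≈⟨ M.∙-congˡ (·-neg g _) ⟨
            (-ᴹ value σ g) +ᴹ (g · (-ᴹ value σ h))       ∎
        ; continuous = λ g →
            let (S , p) = continuous σ g in S , λ h r → M.⁻¹-cong (p h r)
        }

      trivial : CrossedHomomorphism
      trivial = record
        { value      = λ _ → 0ᴹ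
        ; cong       = λ _ → M.refl
        ; crossed    = λ g _ → M.sym (M.trans (M.identityˡ _) (·-0 g))
        ; continuous = λ _ → [] , λ _ _ → M.refl
        }

    H¹ : AbelianGroup (k ⊔ s ⊔ sℓ ⊔ m ⊔ mℓ) (k ⊔ s ⊔ sℓ ⊔ m ⊔ mℓ)
    H¹ = record
      { Carrier = CrossedHomomorphism
      ; _≈_     = _∼_
      ; _∙_     = add
      ; ε       = trivial
      ; _⁻¹     = negate
      ; isAbelianGroup = record
        { isGroup = record
          { isMonoid = record
            { isSemigroup = record
              { isMagma = record
                { isEquivalence = record
                  { refl  = λ {σ} → ≈⇒∼ {σ} {σ} (λ _ → M.refl)
                  ; sym   = λ {σ} {τ} → ∼-sym {σ} {τ}
                  ; trans = λ {ρ} {σ} {τ} → ∼-trans {ρ} {σ} {τ}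
                  }
                ; ∙-cong = λ (m , p) (n , q) → m +ᴹ n , λ g →
                    M.trans (M.∙-cong (p g) (q g))
                      (M.trans (M.interchange _ _ _ _) (M.∙-congˡ (M.sym (∂-+ m n g))))
                }
              ; assoc = λ ρ σ τ →
                  ≈⇒∼ {add (add ρ σ) τ} {add ρ (add σ τ)} (λ _ → M.assoc _ _ _)
              }
            ; identity = (λ σ → ≈⇒∼ {add trivial σ} {σ} (λ _ → M.identityˡ _))
                       , (λ σ → ≈⇒∼ {add σ trivial} {σ} (λ _ → M.identityʳ _))
            }
          ; inverse = (λ σ → ≈⇒∼ {add (negate σ) σ} {trivial} (λ _ → M.inverseˡ _))
                    , (λ σ → ≈⇒∼ {add σ (negate σ)} {trivial} (λ _ → M.inverseʳ _))
          ; ⁻¹-cong = λ (m , p) → -ᴹ m , λ g →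
              M.trans (M.⁻¹-cong (p g))
                (M.trans (M.sym (M.⁻¹-∙-comm _ _)) (M.∙-congˡ (M.sym (∂-neg m g))))
          }
        ; comm = λ σ τ → ≈⇒∼ {add σ τ} {add τ σ} (λ _ → M.comm _ _)
        }
      }

    -- For M with four elements: A is the quartic étale algebra attached to the
    -- class of σ. An algebra of degree 4 is étale exactly when it has four
    -- coordinates, so étaleness is part of the bijectivity of the labelling.

    record CorrespondsTo {a aℓ} (σ : CrossedHomomorphism)
                         (A : Algebra K.commutativeRing a aℓ)
                         : Set (k ⊔ kℓ ⊔ s ⊔ sℓ ⊔ m ⊔ mℓ ⊔ a ⊔ aℓ) where
      private module A = Algebra A
      open AlgebraHom using () renaming (⟦_⟧ to apply)
      field
        degree      : HasDegree 4 A
        ι           : ∣M∣ → AlgebraHom A algebra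
        ι-cong      : ∀ {x y} → x ≈ᴹ y → ∀ z → apply (ι x) z ≈ apply (ι y) z
        ι-bijective : Bijective _≈ᴹ_ (λ i j → ∀ z → apply i z ≈ apply j z) ι
        equivariant : ∀ g x z →
          ⟦ g ⟧ (apply (ι x) z) ≈ apply (ι ((g · x) +ᴹ value σ g)) z

infixl 6 _+₄_
infix  8 -₄_

_+₄_ : Fin 4 → Fin 4 → Fin 4
x +₄ y = (toℕ x ℕ.+ toℕ y) mod 4

-₄_ : Fin 4 → Fin 4
-₄ x = (4 ℕ.∸ toℕ x) mod 4

ℤ/4 : AbelianGroup _ _
ℤ/4 = record
  { Carrier = Fin 4
  ; _≈_     = _≡_
  ; _∙_     = _+₄_
  ; ε       = 0F
  ; _⁻¹     = -₄_
  ; isAbelianGroup = record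
    { isGroup = record
      { isMonoid = record
        { isSemigroup = record
          { isMagma = record { isEquivalence = ≡.isEquivalence ; ∙-cong = ≡.cong₂ _+₄_ }
          ; assoc = from-yes (all? λ x → all? λ y → all? λ z →
                      ((x +₄ y) +₄ z) ≟ᶠ (x +₄ (y +₄ z)))
          }
        ; identity = from-yes (all? λ x → (0F +₄ x) ≟ᶠ x)
                   , from-yes (all? λ x → (x +₄ 0F) ≟ᶠ x)
        }
      ; inverse = from-yes (all? λ x → ((-₄ x) +₄ x) ≟ᶠ 0F)
                , from-yes (all? λ x → (x +₄ (-₄ x)) ≟ᶠ 0F)
      ; ⁻¹-cong = ≡.cong -₄_
      }
    ; comm = from-yes (all? λ x → all? λ y → (x +₄ y) ≟ᶠ (y +₄ x))
    }
  }

signed : Sign → Fin 4 → Fin 4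
signed Sign.+ x = x
signed Sign.- x = -₄ x

module Twist {k kℓ s sℓ} (em : ExcludedMiddle sℓ) {K : Field k kℓ}
             (2≉0 : CharacteristicNot2 K)
             {D : Field.Carrier K} (D≉0 : Field._≉_ K D (Field.0# K))
             (Ω : SeparableClosure K s sℓ) (√D : SeparableClosure.Carrier Ω)
             (√D² : SeparableClosure._≈_ Ω (SeparableClosure._*_ Ω √D √D)
                                           (SeparableClosure.embed Ω D))
             where

  open SeparableClosure Ω
  private module K = Field K
  open Galois Ω
  open Automorphism using (⟦_⟧)
  private
    module G = Group absoluteGaloisGroup
    module φ = IsRingHomomorphism embed-isRingHomomorphism
    open RingProperties ring using (-‿distribˡ-*; -‿distribʳ-*; -0#≈0#)
    open GroupProperties +-group using (inverseˡ-unique; x∙y⁻¹≈ε⇒x≈y; ⁻¹-involutive)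
    open SetoidReasoning setoid

  infixr 8 _◁_

  _◁_ : Sign → Carrier → Carrier
  Sign.+ ◁ x = x
  Sign.- ◁ x = - x

  -- g(√D)/√D, which is 1 or -1 according to whether g fixes √D.

  χ : Automorphism → Sign
  χ g with em {⟦ g ⟧ √D ≈ √D}
  ... | yes _ = Sign.+
  ... | no  _ = Sign.-

  private
    unit-≉0 : ∀ {x y} → x * y ≈ 1# → x ≉ 0#
    unit-≉0 p x≈0 = 1≉0 (trans (sym p) (trans (*-congʳ x≈0) (zeroˡ _)))

    embed-≉0 : ∀ {x} → x K.≉ K.0# → embed x ≉ 0#
    embed-≉0 {x} x≉0 with K.inverse x x≉0
    ... | y , _ , p = unit-≉0 (trans (sym (φ.*-homo x y)) (trans (φ.⟦⟧-cong p) φ.1#-homo))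

    cancel : ∀ {x y} → x ≉ 0# → x * y ≈ 0# → y ≈ 0#
    cancel {x} {y} x≉0 p with inverse x x≉0
    ... | x⁻¹ , q , _ = begin
      y              ≈⟨ *-identityˡ y ⟨
      1# * y         ≈⟨ *-congʳ q ⟨
      x⁻¹ * x * y    ≈⟨ *-assoc _ _ _ ⟩
      x⁻¹ * (x * y)  ≈⟨ *-congˡ p ⟩
      x⁻¹ * 0#       ≈⟨ zeroʳ _ ⟩
      0#             ∎

    √D≉0 : √D ≉ 0#
    √D≉0 p = embed-≉0 D≉0 (trans (sym √D²) (trans (*-congʳ p) (zeroˡ _)))

    √D≉-√D : √D ≉ - √D
    √D≉-√D p = embed-≉0 2≉0 (begin
      embed (K.1# K.+ K.1#)        ≈⟨ φ.+-homo _ _ ⟩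
      embed K.1# + embed K.1#      ≈⟨ +-cong φ.1#-homo φ.1#-homo ⟩
      1# + 1#                      ≈⟨ cancel √D≉0 (begin
        √D * (1# + 1#)               ≈⟨ distribˡ _ _ _ ⟩
        √D * 1# + √D * 1#            ≈⟨ +-cong (*-identityʳ √D) (*-identityʳ √D) ⟩
        √D + √D                      ≈⟨ +-congˡ p ⟩
        √D - √D                      ≈⟨ -‿inverseʳ √D ⟩
        0#                           ∎) ⟩
      0#                           ∎)

    square : ∀ g → ⟦ g ⟧ √D * ⟦ g ⟧ √D ≈ √D * √D
    square g = begin
      ⟦ g ⟧ √D * ⟦ g ⟧ √D   ≈⟨ g.*-homo √D √D ⟨
      ⟦ g ⟧ (√D * √D)       ≈⟨ g.⟦⟧-cong √D² ⟩
      ⟦ g ⟧ (embed D)       ≈⟨ g.fixes D ⟩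
      embed D               ≈⟨ √D² ⟨
      √D * √D               ∎
      where module g = Automorphism g

    difference-of-squares : ∀ x y → x * x ≈ y * y → (x - y) * (x + y) ≈ 0#
    difference-of-squares x y p = begin
      (x - y) * (x + y)                      ≈⟨ trans (distribʳ _ _ _) (+-cong (distribˡ _ _ _) (distribˡ _ _ _)) ⟩
      (x * x + x * y) + (- y * x + - y * y)  ≈⟨ +-cong (+-comm _ _) (+-cong (-‿distribˡ-* y x) (-‿distribˡ-* y y)) ⟨
      (x * y + x * x) + (- (y * x) + - (y * y)) ≈⟨ +-cong (+-cong (*-comm x y) p) (+-comm _ _) ⟩
      (y * x + y * y) + (- (y * y) + - (y * x)) ≈⟨ +-assoc _ _ _ ⟩
      y * x + (y * y + (- (y * y) + - (y * x))) ≈⟨ +-congˡ (trans (sym (+-assoc _ _ _)) (trans (+-congʳ (-‿inverseʳ _)) (+-identityˡ _))) ⟩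
      y * x - y * x                          ≈⟨ -‿inverseʳ _ ⟩
      0#                                     ∎

    ◁-cong : ∀ e {x y} → x ≈ y → e ◁ x ≈ e ◁ y
    ◁-cong Sign.+ p = p
    ◁-cong Sign.- p = -‿cong p

    ◁-homo : ∀ g e x → ⟦ g ⟧ (e ◁ x) ≈ e ◁ ⟦ g ⟧ x
    ◁-homo g Sign.+ x = refl
    ◁-homo g Sign.- x = Automorphism.-‿homo g x

    ◁-assoc : ∀ e e′ x → (e *ₛ e′) ◁ x ≈ e′ ◁ (e ◁ x)
    ◁-assoc Sign.+ e′ x = refl
    ◁-assoc Sign.- Sign.+ x = refl
    ◁-assoc Sign.- Sign.- x = sym (⁻¹-involutive x)

    ◁-injective : ∀ e e′ → e ◁ √D ≈ e′ ◁ √D → e ≡ e′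
    ◁-injective Sign.+ Sign.+ _ = ≡.refl
    ◁-injective Sign.+ Sign.- p = ⊥-elim (√D≉-√D p)
    ◁-injective Sign.- Sign.+ p = ⊥-elim (√D≉-√D (sym p))
    ◁-injective Sign.- Sign.- _ = ≡.refl

  χ-spec : ∀ g → ⟦ g ⟧ √D ≈ χ g ◁ √D
  χ-spec g with em {⟦ g ⟧ √D ≈ √D}
  ... | yes p = p
  ... | no ¬p = inverseˡ-unique _ _
    (cancel (λ q → ¬p (x∙y⁻¹≈ε⇒x≈y _ _ q)) (difference-of-squares _ _ (square g)))

  χ-unique : ∀ g e → ⟦ g ⟧ √D ≈ e ◁ √D → χ g ≡ e
  χ-unique g e p = ◁-injective (χ g) e (trans (sym (χ-spec g)) p)

  χ-homo : ∀ g h → χ (g G.∙ h) ≡ χ g *ₛ χ h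
  χ-homo g h = χ-unique (g G.∙ h) _ (begin
    ⟦ g ⟧ (⟦ h ⟧ √D)       ≈⟨ Automorphism.⟦⟧-cong g (χ-spec h) ⟩
    ⟦ g ⟧ (χ h ◁ √D)       ≈⟨ ◁-homo g (χ h) √D ⟩
    χ h ◁ ⟦ g ⟧ √D         ≈⟨ ◁-cong (χ h) (χ-spec g) ⟩
    χ h ◁ χ g ◁ √D         ≈⟨ ◁-assoc (χ g) (χ h) √D ⟨
    (χ g *ₛ χ h) ◁ √D      ∎)

  private
    χ-cong : ∀ g h → ⟦ g ⟧ √D ≈ ⟦ h ⟧ √D → χ g ≡ χ h
    χ-cong g h p = χ-unique g (χ h) (trans p (χ-spec h))

    signed-* : ∀ e e′ x → signed (e *ₛ e′) x ≡ signed e (signed e′ x)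
    signed-* Sign.+ e′ x = ≡.refl
    signed-* Sign.- Sign.+ x = ≡.refl
    signed-* Sign.- Sign.- = from-yes (all? λ x → x ≟ᶠ (-₄ (-₄ x)))

    signed-+ : ∀ e x y → signed e (x +₄ y) ≡ signed e x +₄ signed e y
    signed-+ Sign.+ _ _ = ≡.refl
    signed-+ Sign.- = from-yes (all? λ x → all? λ y → (-₄ (x +₄ y)) ≟ᶠ ((-₄ x) +₄ (-₄ y)))

  twistedℤ/4 : GaloisModule _ _
  twistedℤ/4 = record
    { abelianGroup = ℤ/4
    ; _·_          = λ g x → signed (χ g) x
    ; ·-cong       = λ {g} {h} p q → ≡.cong₂ signed (χ-cong g h (p √D)) q
    ; ·-identity   = λ x → ≡.cong (λ e → signed e x) (χ-unique G.ε Sign.+ refl)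
    ; ·-assoc      = λ g h x →
        ≡.trans (≡.cong (λ e → signed e x) (χ-homo g h)) (signed-* (χ g) (χ h) x)
    ; ·-distrib    = λ g → signed-+ (χ g)
    ; ·-continuous = λ x g → √D ∷ [] , λ { h (p ∷ []) →
        ≡.cong (λ e → signed e x) (χ-cong g h p) }
    }

module NormPairs {k kℓ} (K : Field k kℓ) (D : Field.Carrier K) where

  private module K = Field K
  open K using (commutativeRing)

  module Quadratic = Adjoin commutativeRing (K.- D)
  open Quadratic using (norm; norm-*; norm-1; norm-cong)

  K[√-D] : CommutativeRing k kℓ
  K[√-D] = Quadratic.commutativeRing√

  private
    module E = CommutativeRing K[√-D]
    module EP = CommutativeSemigroupProperties E.*-commutativeSemigroup
    module KP = CommutativeSemigroupProperties K.*-commutativeSemigroup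
    module E^ = Exp E.commutativeSemiring
    module K^ = Exp K.commutativeSemiring

  record NormPair : Set (k ⊔ kℓ) where
    field
      α      : E.Carrier
      c      : K.Carrier
      α-unit : IsUnit K[√-D] α
      c-unit : IsUnit commutativeRing c
      Nα≈c⁴  : norm α K.≈ c K^.^ 4

  open NormPair

  infix 4 _∼_

  _∼_ : NormPair → NormPair → Set (k ⊔ kℓ)
  P ∼ Q = ∃[ β ] IsUnit K[√-D] β ×
                 α P E.≈ (β E^.^ 4) E.* α Q ×
                 c P K.≈ norm β K.* c Q

  private
    IsUnit-* : ∀ {r ℓ} (R : CommutativeRing r ℓ) (let open CommutativeRing R) →
               ∀ {x y} → IsUnit R x → IsUnit R y → IsUnit R (x * y)
    IsUnit-* R {x} {y} (x⁻¹ , p , p′) (y⁻¹ , q , q′) =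
      x⁻¹ * y⁻¹ , product p q , product p′ q′
      where
      open CommutativeRing R
      open CommutativeSemigroupProperties *-commutativeSemigroup using (interchange)
      product : ∀ {u v u′ v′} → u * v ≈ 1# → u′ * v′ ≈ 1# → (u * u′) * (v * v′) ≈ 1#
      product r t = trans (interchange _ _ _ _) (trans (*-cong r t) (*-identityˡ 1#))

    IsUnit-1 : ∀ {r ℓ} (R : CommutativeRing r ℓ) → IsUnit R (CommutativeRing.1# R)
    IsUnit-1 R = 1# , *-identityˡ 1# , *-identityˡ 1#
      where open CommutativeRing R

    IsUnit-⁻¹ : ∀ {r ℓ} (R : CommutativeRing r ℓ) →
                ∀ {x} (u : IsUnit R x) → IsUnit R (proj₁ u)
    IsUnit-⁻¹ R {x} (x⁻¹ , p , q) = x , q , p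

    1^n≈1 : ∀ {r ℓ} (R : CommutativeRing r ℓ) (let open CommutativeRing R)
            (let open Exp commutativeSemiring) → ∀ n → 1# ^ n ≈ 1#
    1^n≈1 R zero    = CommutativeRing.refl R
    1^n≈1 R (suc n) = trans (*-identityˡ _) (1^n≈1 R n)
      where open CommutativeRing R

    ^-inverse : ∀ {r ℓ} (R : CommutativeRing r ℓ) (let open CommutativeRing R)
                (let open Exp commutativeSemiring) →
                ∀ {x y} n → x * y ≈ 1# → x ^ n * y ^ n ≈ 1#
    ^-inverse R {x} {y} n p = trans (sym (^-distrib-* x y n)) (trans (^-congˡ n p) (1^n≈1 R n))
      where
      open CommutativeRing R
      open Exp commutativeSemiring

    inverse-unique : ∀ {x y z} → x K.* y K.≈ K.1# → x K.* z K.≈ K.1# → y K.≈ z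
    inverse-unique {x} {y} {z} p q = begin
      y                   ≈⟨ K.*-identityʳ y ⟨
      y K.* K.1#          ≈⟨ K.*-congˡ q ⟨
      y K.* (x K.* z)     ≈⟨ KP.x∙yz≈yx∙z y x z ⟩
      (x K.* y) K.* z     ≈⟨ K.*-congʳ p ⟩
      K.1# K.* z          ≈⟨ K.*-identityˡ z ⟩
      z                   ∎
      where open SetoidReasoning K.setoid

    norm-inverse : ∀ {x y} → x E.* y E.≈ E.1# → norm x K.* norm y K.≈ K.1#
    norm-inverse {x} {y} p =
      K.trans (K.sym (norm-* x y)) (K.trans (norm-cong p) norm-1)

    ≈⇒∼ : ∀ {P Q} → α P E.≈ α Q → c P K.≈ c Q → P ∼ Q
    ≈⇒∼ {P} {Q} p q = E.1# , IsUnit-1 K[√-D]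
      , E.trans p (E.sym (E.trans (E.*-congʳ (1^n≈1 K[√-D] 4)) (E.*-identityˡ _)))
      , K.trans q (K.sym (K.trans (K.*-congʳ norm-1) (K.*-identityˡ _)))

    ∼-trans : ∀ {P Q R} → P ∼ Q → Q ∼ R → P ∼ R
    ∼-trans (β , u , p , q) (γ , v , p′ , q′) = β E.* γ , IsUnit-* K[√-D] u v
      , E.trans p (E.trans (E.*-congˡ p′) (E.trans (E.sym (E.*-assoc _ _ _))
          (E.*-congʳ (E.sym (E^.^-distrib-* β γ 4)))))
      , K.trans q (K.trans (K.*-congˡ q′) (K.trans (K.sym (K.*-assoc _ _ _))
          (K.*-congʳ (K.sym (norm-* β γ)))))

    ∼-sym : ∀ {P Q} → P ∼ Q → Q ∼ P
    ∼-sym {P} {Q} (β , u@(β⁻¹ , l , _) , p , q) = β⁻¹ , IsUnit-⁻¹ K[√-D] u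
      , E.sym (E.trans (E.*-congˡ p) (E.trans (E.sym (E.*-assoc _ _ _))
          (E.trans (E.*-congʳ (^-inverse K[√-D] 4 l)) (E.*-identityˡ _))))
      , K.sym (K.trans (K.*-congˡ q) (K.trans (K.sym (K.*-assoc _ _ _))
          (K.trans (K.*-congʳ (norm-inverse l)) (K.*-identityˡ _))))

    multiply : NormPair → NormPair → NormPair
    multiply P Q = record
      { α      = α P E.* α Q
      ; c      = c P K.* c Q
      ; α-unit = IsUnit-* K[√-D] (α-unit P) (α-unit Q)
      ; c-unit = IsUnit-* commutativeRing (c-unit P) (c-unit Q)
      ; Nα≈c⁴  = K.trans (norm-* (α P) (α Q))
                   (K.trans (K.*-cong (Nα≈c⁴ P) (Nα≈c⁴ Q))
                            (K.sym (K^.^-distrib-* (c P) (c Q) 4)))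
      }

    one : NormPair
    one = record
      { α      = E.1#
      ; c      = K.1#
      ; α-unit = IsUnit-1 K[√-D]
      ; c-unit = IsUnit-1 commutativeRing
      ; Nα≈c⁴  = K.trans norm-1 (K.sym (1^n≈1 commutativeRing 4))
      }

    invert : NormPair → NormPair
    invert P = record
      { α      = proj₁ (α-unit P)
      ; c      = proj₁ (c-unit P)
      ; α-unit = IsUnit-⁻¹ K[√-D] (α-unit P)
      ; c-unit = IsUnit-⁻¹ commutativeRing (c-unit P)
      ; Nα≈c⁴  = inverse-unique
                   (K.trans (K.*-congʳ (K.sym (Nα≈c⁴ P))) (norm-inverse (proj₂ (proj₂ (α-unit P)))))
                   (^-inverse commutativeRing 4 (proj₂ (proj₂ (c-unit P))))
      }

    multiply-cong : ∀ {P P′ Q Q′} → P ∼ P′ → Q ∼ Q′ → multiply P Q ∼ multiply P′ Q′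
    multiply-cong (β , u , p , q) (γ , v , p′ , q′) = β E.* γ , IsUnit-* K[√-D] u v
      , E.trans (E.*-cong p p′) (E.trans (EP.interchange _ _ _ _)
          (E.*-congʳ (E.sym (E^.^-distrib-* β γ 4))))
      , K.trans (K.*-cong q q′) (K.trans (KP.interchange _ _ _ _)
          (K.*-congʳ (K.sym (norm-* β γ))))

    inverseˡ : ∀ P → multiply (invert P) P ∼ one
    inverseˡ P = ≈⇒∼ {multiply (invert P) P} {one}
      (proj₁ (proj₂ (α-unit P))) (proj₁ (proj₂ (c-unit P)))

    comm : ∀ P Q → multiply P Q ∼ multiply Q P
    comm P Q = ≈⇒∼ {multiply P Q} {multiply Q P} (E.*-comm _ _) (K.*-comm _ _)

    identityˡ : ∀ P → multiply one P ∼ P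
    identityˡ P = ≈⇒∼ {multiply one P} {P} (E.*-identityˡ _) (K.*-identityˡ _)

    assoc : ∀ P Q R → multiply (multiply P Q) R ∼ multiply P (multiply Q R)
    assoc P Q R = ≈⇒∼ {multiply (multiply P Q) R} {multiply P (multiply Q R)}
      (E.*-assoc _ _ _) (K.*-assoc _ _ _)

    refl : ∀ {P} → P ∼ P
    refl {P} = ≈⇒∼ {P} {P} E.refl K.refl

    invert-cong : ∀ {P Q} → P ∼ Q → invert P ∼ invert Q
    invert-cong {P} {Q} r =
      trans {invert P} {multiply (invert P) one} {invert Q}
        (∼-sym {multiply (invert P) one} {invert P} (identityʳ (invert P)))
      (trans {multiply (invert P) one} {multiply (invert P) (multiply Q (invert Q))} {invert Q}
        (multiply-cong {invert P} {invert P} {one} {multiply Q (invert Q)} (refl {invert P})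
          (∼-sym {multiply Q (invert Q)} {one} (inverseʳ Q)))
      (trans {multiply (invert P) (multiply Q (invert Q))} {multiply (multiply (invert P) Q) (invert Q)} {invert Q}
        (∼-sym {multiply (multiply (invert P) Q) (invert Q)} {multiply (invert P) (multiply Q (invert Q))}
          (assoc (invert P) Q (invert Q)))
      (trans {multiply (multiply (invert P) Q) (invert Q)} {multiply one (invert Q)} {invert Q}
        (multiply-cong {multiply (invert P) Q} {one} {invert Q} {invert Q}
          (trans {multiply (invert P) Q} {multiply (invert P) P} {one}
            (multiply-cong {invert P} {invert P} {Q} {P} (refl {invert P}) (∼-sym {P} {Q} r))
            (inverseˡ P))
          (refl {invert Q}))
        (identityˡ (invert Q)))))
      where
      trans : ∀ {P Q R} → P ∼ Q → Q ∼ R → P ∼ R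
      trans {P} {Q} {R} = ∼-trans {P} {Q} {R}
      identityʳ : ∀ P → multiply P one ∼ P
      identityʳ P = trans {multiply P one} {multiply one P} {P} (comm P one) (identityˡ P)
      inverseʳ : ∀ P → multiply P (invert P) ∼ one
      inverseʳ P = trans {multiply P (invert P)} {multiply (invert P) P} {one}
                     (comm P (invert P)) (inverseˡ P)

  normPairGroup : AbelianGroup (k ⊔ kℓ) (k ⊔ kℓ)
  normPairGroup = record
    { Carrier = NormPair
    ; _≈_     = _∼_
    ; _∙_     = multiply
    ; ε       = one
    ; _⁻¹     = invert
    ; isAbelianGroup = record
      { isGroup = record
        { isMonoid = record
          { isSemigroup = record
            { isMagma = record
              { isEquivalence = record
                { refl  = λ {P} → refl {P}
                ; sym   = λ {P} {Q} → ∼-sym {P} {Q}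
                ; trans = λ {P} {Q} {R} → ∼-trans {P} {Q} {R}
                }
              ; ∙-cong = λ {P} {P′} {Q} {Q′} → multiply-cong {P} {P′} {Q} {Q′}
              }
            ; assoc = assoc
            }
          ; identity = identityˡ
                     , λ P → ∼-trans {multiply P one} {multiply one P} {P} (comm P one) (identityˡ P)
          }
        ; inverse = inverseˡ
                  , λ P → ∼-trans {multiply P (invert P)} {multiply (invert P) P} {one}
                            (comm P (invert P)) (inverseˡ P)
        ; ⁻¹-cong = λ {P} {Q} → invert-cong {P} {Q}
        }
      ; comm = comm
      }
    }

{-# OPTIONS --safe #-}

-- Let i² = −1 and w = i √D, so that w² = −D and K[√-D] embeds in Ω × Ω through ± w; let
-- ε(g) = g(w)/w. A cocycle σ and a pair (α, c) are matched when there is β in Ω × Ω with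
-- β⁴ = α, β₊ β₋ = c and g(β₊) = i^(ε(g) σ(g)) β_ε(g). Given (α, c), a fourth root β₊ exists
-- because Ω is separably closed, and it determines σ. Given σ, Hilbert's theorem 90 for the
-- kernel of ε yields β₊, transport by an automorphism with ε = −1 yields β₋, and β⁴ and
-- β₊ β₋ descend to K since the field fixed by all automorphisms of Ω is K. Matching is
-- multiplicative, and ambiguity in β is a fourth root of unity on one side and an element
-- of K[√-D] on the other, so it is a bijection of classes.
--
-- That the fixed field is K is the only use of Zorn's lemma: an element x outside K has a
-- conjugate z ≠ x, and a maximal K-isomorphism of subextensions sending x to z is an
-- automorphism of Ω.
--
-- The coordinates of the quartic algebra send v to i^x β₊ + i^(−x) β₋ and u to
-- (−1)^x (β₊² + β₋²), for x in ℤ/4; they are distinct because b ≠ 0 makes β₊⁴ ≠ β₋⁴.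

module Submission where

open import Defs
open import Algebra.Bundles using (AbelianGroup; CommutativeMonoid; CommutativeRing; CommutativeSemiring; Group; RawRing; Ring)
import Algebra.Morphism.RingMonomorphism as RingMonomorphism
open import Algebra.Morphism.Structures using (IsGroupIsomorphism; IsRingHomomorphism; IsRingMonomorphism)
import Algebra.Properties.CommutativeMonoid.Mult as CommutativeMonoidMult
import Algebra.Properties.CommutativeSemigroup as CommutativeSemigroupProperties
import Algebra.Properties.CommutativeSemiring.Exp as Exp
import Algebra.Properties.Group as GroupProperties
import Algebra.Properties.Ring as RingProperties
import Algebra.Properties.Semiring.Mult as SemiringMult
import Algebra.Properties.Semiring.Mult.TCOptimised as Mult
import Algebra.Solver.Ring as RingSolver
open import Algebra.Solver.Ring.AlmostCommutativeRing using (_-Raw-AlmostCommutative⟶_; fromCommutativeRing)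
import Algebra.Solver.Ring.NaturalCoefficients.Default as Solver
open import Algebra.Structures.Biased using (isCommutativeSemiringˡ)
open import Axiom.ExcludedMiddle using (ExcludedMiddle)
open import Data.Bool using (Bool; T)
open import Data.Empty using (⊥; ⊥-elim)
open import Data.Fin using (Fin; toℕ)
open import Data.Fin.Patterns using (0F; 1F; 2F; 3F)
open import Data.Fin.Properties using (all?; toℕ-fromℕ<) renaming (_≟_ to _≟ᶠ_)
open import Data.Integer as ℤ using (+_; -[1+_]; ℤ)
import Data.Integer.Properties as ℤ
open import Data.List using (List; []; _++_; _∷_; cartesianProductWith; deduplicate; length; map)
import Data.List.Membership.Setoid as Membership
open import Data.List.Membership.Setoid.Properties using (∈-deduplicate⁺)
open import Data.List.Properties using (map-∘)
open import Data.List.Relation.Unary.All as All using (All; []; _∷_)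
open import Data.List.Relation.Unary.AllPairs as AllPairs using ([]; _∷_)
import Data.List.Relation.Unary.AllPairs.Properties as AllPairs
open import Data.List.Relation.Unary.Any as Any using (Any; here; there)
import Data.List.Relation.Unary.Any.Properties as Any
open import Data.List.Relation.Unary.Unique.DecSetoid.Properties using (deduplicate-!)
import Data.List.Relation.Unary.Unique.Setoid as Unique
open import Data.Maybe using (Maybe; just; nothing)
open import Data.Nat as ℕ using (suc; s≤s; zero; z≤n; ℕ)
open import Data.Nat.DivMod using (_%_; m%n<n; m*n%n≡0; m≡m%n+[m/n]*n)
open import Data.Nat.Induction using (<-rec)
import Data.Nat.Properties as ℕ
open import Data.Product using (_,_; _×_; proj₁; proj₂; ∃-syntax)
open import Data.Sign using (Sign) renaming (_*_ to _*ₛ_)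
import Data.Sign.Properties as Sign
open import Data.Sum using (_⊎_; inj₁; inj₂)
open import Data.Vec as Vec using (Vec; []; _∷_; toList)
open import Data.Vec.Properties using (length-toList)
open import Function using (id)
open import Level using (_⊔_)
open import Relation.Binary using (DecSetoid; Poset; Setoid)
open import Relation.Binary.PropositionalEquality as ≡ using (_≡_)
import Relation.Binary.Reasoning.Setoid as SetoidReasoning
open import Relation.Nullary using (Dec; no; yes; ¬_)
open import Relation.Nullary.Decidable using (_×-dec_; from-yes; fromWitness; isYes; map′; toWitness)
open import Relation.Unary using (Pred) renaming (_∈_ to _∈ᵤ_)

-- Galois acts on the fourth roots of unity through the character η of i and on M through χ, and η =
-- εχ. So M is μ₄ twisted by ε, and x ↦ (i^x, i^(-x)) identifies it with the kernel of the product
-- map on μ₄ × μ₄, where automorphisms with ε = -1 also exchange the factors. The theorem is Kummer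
-- theory for this kernel. It explains the role of c: fourth roots of the two images of α have a
-- product known only up to a fourth root of unity, and c fixes that product. The case distinction
-- to be absorbed is whether -D is a square in K. If it is, K[√-D] is not a field and no
-- automorphism exchanges the two factors. Most of the argument is therefore written for functions
-- on the two signs, permuted by ε, and is uniform in both cases; only the construction of β₋ from a
-- cocycle splits. Finite Galois extensions are replaced by finite lists S of elements of Ω:
-- automorphisms are compared by their values on S, and continuity makes a cocycle depend only on
-- such values.

-- Ring identities with integer coefficients

module IntegerCoefficients {c ℓ} (R : CommutativeRing c ℓ) where

  open CommutativeRing R
  open RingProperties ring
    using (-‿distribˡ-*; -‿involutive; -0#≈0#; -‿+-comm)
  open Mult semiring using (1+×; ×-homo-+; ×1-homo-*) renaming (_×_ to _·_)
  open SetoidReasoning setoid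

  fromℤ : ℤ → Carrier
  fromℤ (+ n)    = n · 1#
  fromℤ -[1+ n ] = - (suc n · 1#)

  private
    neg : ∀ i → fromℤ (ℤ.- i) ≈ - fromℤ i
    neg (+ zero)  = sym -0#≈0#
    neg (+ suc n) = refl
    neg -[1+ n ]  = sym (-‿involutive _)

    cancel : ∀ a x y → (a + x) - (a + y) ≈ x - y
    cancel a x y = begin
      (a + x) - (a + y)        ≈⟨ +-cong (+-comm a x) (sym (-‿+-comm a y)) ⟩
      (x + a) + (- a + - y)    ≈⟨ +-assoc x a _ ⟩
      x + (a + (- a + - y))    ≈⟨ +-congˡ (+-assoc a (- a) (- y)) ⟨
      x + ((a - a) + - y)      ≈⟨ +-congˡ (+-congʳ (-‿inverseʳ a)) ⟩
      x + (0# + - y)           ≈⟨ +-congˡ (+-identityˡ _) ⟩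
      x - y                    ∎

    ⊖-homo : ∀ m n → fromℤ (m ℤ.⊖ n) ≈ m · 1# - n · 1#
    ⊖-homo zero    zero    = sym (-‿inverseʳ 0#)
    ⊖-homo zero    (suc n) = sym (+-identityˡ _)
    ⊖-homo (suc m) zero    = sym (trans (+-congˡ -0#≈0#) (+-identityʳ _))
    ⊖-homo (suc m) (suc n) = begin
      fromℤ (suc m ℤ.⊖ suc n)          ≡⟨ ≡.cong fromℤ (ℤ.[1+m]⊖[1+n]≡m⊖n m n) ⟩
      fromℤ (m ℤ.⊖ n)                  ≈⟨ ⊖-homo m n ⟩
      m · 1# - n · 1#                  ≈⟨ cancel 1# _ _ ⟨
      (1# + m · 1#) - (1# + n · 1#)    ≈⟨ +-cong (1+× m 1#) (-‿cong (1+× n 1#)) ⟨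
      suc m · 1# - suc n · 1#          ∎

    add : ∀ i j → fromℤ (i ℤ.+ j) ≈ fromℤ i + fromℤ j
    add (+ m)    (+ n)    = ×-homo-+ 1# m n
    add (+ m)    -[1+ n ] = ⊖-homo m (suc n)
    add -[1+ m ] (+ n)    = trans (⊖-homo n (suc m)) (+-comm _ _)
    add -[1+ m ] -[1+ n ] = begin
      fromℤ (-[1+ m ] ℤ.+ -[1+ n ])       ≡⟨ ≡.cong fromℤ (ℤ.neg-distrib-+ (+ suc m) (+ suc n)) ⟨
      fromℤ (ℤ.- (+ (suc m ℕ.+ suc n)))   ≈⟨ -‿cong (×-homo-+ 1# (suc m) (suc n)) ⟩
      - (suc m · 1# + suc n · 1#)         ≈⟨ -‿+-comm _ _ ⟨
      fromℤ -[1+ m ] + fromℤ -[1+ n ]     ∎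

    mul⁺ : ∀ m j → fromℤ (+ m ℤ.* j) ≈ m · 1# * fromℤ j
    mul⁺ m (+ n) = begin
      fromℤ (+ m ℤ.* + n)      ≡⟨ ≡.cong fromℤ (ℤ.pos-* m n) ⟨
      (m ℕ.* n) · 1#           ≈⟨ ×1-homo-* m n ⟩
      m · 1# * (n · 1#)        ∎
    mul⁺ m -[1+ n ] = begin
      fromℤ (+ m ℤ.* -[1+ n ])          ≡⟨ ≡.cong fromℤ (ℤ.neg-distribʳ-* (+ m) (+ suc n)) ⟨
      fromℤ (ℤ.- (+ m ℤ.* + suc n))     ≈⟨ neg (+ m ℤ.* + suc n) ⟩
      - fromℤ (+ m ℤ.* + suc n)         ≈⟨ -‿cong (mul⁺ m (+ suc n)) ⟩
      - (m · 1# * (suc n · 1#))         ≈⟨ RingProperties.-‿distribʳ-* ring _ _ ⟩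
      m · 1# * - (suc n · 1#)           ∎

    mul : ∀ i j → fromℤ (i ℤ.* j) ≈ fromℤ i * fromℤ j
    mul (+ m)    j = mul⁺ m j
    mul -[1+ m ] j = begin
      fromℤ (-[1+ m ] ℤ.* j)          ≡⟨ ≡.cong fromℤ (ℤ.neg-distribˡ-* (+ suc m) j) ⟨
      fromℤ (ℤ.- (+ suc m ℤ.* j))     ≈⟨ neg (+ suc m ℤ.* j) ⟩
      - fromℤ (+ suc m ℤ.* j)         ≈⟨ -‿cong (mul⁺ (suc m) j) ⟩
      - (suc m · 1# * fromℤ j)        ≈⟨ -‿distribˡ-* _ _ ⟩
      fromℤ -[1+ m ] * fromℤ j        ∎

    ℤ-rawRing : RawRing _ _
    ℤ-rawRing = record
      { Carrier = ℤ ; _≈_ = _≡_ ; _+_ = ℤ._+_ ; _*_ = ℤ._*_ ; -_ = ℤ.-_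
      ; 0# = + 0 ; 1# = + 1 }

    morphism : ℤ-rawRing -Raw-AlmostCommutative⟶ fromCommutativeRing R
    morphism = record
      { ⟦_⟧ = fromℤ ; +-homo = add ; *-homo = mul ; -‿homo = neg ; 0-homo = refl ; 1-homo = refl }

    -- Coefficients are compared as integers because equality in `R` is not decidable. Distinct
    -- integers may have equal images in positive characteristic, so `nothing` only means that no
    -- equality is claimed.
    decide : ∀ i j → Maybe (fromℤ i ≈ fromℤ j)
    decide i j with i ℤ.≟ j
    ... | yes p = just (reflexive (≡.cong fromℤ p))
    ... | no  _ = nothing

  open RingSolver ℤ-rawRing (fromCommutativeRing R) morphism decide public
    using (solve; con; :-_; _:+_; _:*_; _:-_; _:=_; _:^_)

-- Polynomial arithmetic, evaluation, derivatives and separability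

module PolynomialSemiring {c ℓ} (R : CommutativeRing c ℓ) where

  open CommutativeRing R hiding (zero)
  open Polynomial R

  -- Unlike _≈ₚ_, a record type determines the two polynomials.

  infix 4 _≋_

  record _≋_ (p q : Poly) : Set ℓ where
    constructor ⟪_⟫
    field at : p ≈ₚ q

  open _≋_ public

  ≋-refl : ∀ {p} → p ≋ p
  ≋-refl = ⟪ (λ _ → refl) ⟫

  ≋-sym : ∀ {p q} → p ≋ q → q ≋ p
  ≋-sym e = ⟪ (λ n → sym (at e n)) ⟫

  ≋-trans : ∀ {p q r} → p ≋ q → q ≋ r → p ≋ r
  ≋-trans e f = ⟪ (λ n → trans (at e n) (at f n)) ⟫

  scale : Carrier → Poly → Poly
  scale a = map (a *_)

  X*_ : Poly → Poly
  X* p = 0# ∷ p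

  ∷-cong : ∀ {a b p q} → a ≈ b → p ≋ q → a ∷ p ≋ b ∷ q
  ∷-cong e f = ⟪ (λ { zero → e ; (suc n) → at f n }) ⟫

  coefficient-+ : ∀ p q n → coefficient (p +ₚ q) n ≈ coefficient p n + coefficient q n
  coefficient-+ []      q       n       = sym (+-identityˡ _)
  coefficient-+ (a ∷ p) []      n       = sym (+-identityʳ _)
  coefficient-+ (a ∷ p) (b ∷ q) zero    = refl
  coefficient-+ (a ∷ p) (b ∷ q) (suc n) = coefficient-+ p q n

  coefficient-scale : ∀ a p n → coefficient (scale a p) n ≈ a * coefficient p n
  coefficient-scale a []      n       = sym (zeroʳ a)
  coefficient-scale a (b ∷ p) zero    = refl
  coefficient-scale a (b ∷ p) (suc n) = coefficient-scale a p n

  +ₚ-cong : ∀ {p p′ q q′} → p ≋ p′ → q ≋ q′ → p +ₚ q ≋ p′ +ₚ q′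
  +ₚ-cong {p} {p′} {q} {q′} e f = ⟪ (λ n →
    trans (coefficient-+ p q n) (trans (+-cong (at e n) (at f n)) (sym (coefficient-+ p′ q′ n)))) ⟫

  +ₚ-comm : ∀ p q → p +ₚ q ≋ q +ₚ p
  +ₚ-comm p q = ⟪ (λ n →
    trans (coefficient-+ p q n) (trans (+-comm _ _) (sym (coefficient-+ q p n)))) ⟫

  +ₚ-assoc : ∀ p q r → (p +ₚ q) +ₚ r ≋ p +ₚ (q +ₚ r)
  +ₚ-assoc p q r = ⟪ (λ n →
    trans (trans (coefficient-+ (p +ₚ q) r n) (+-congʳ (coefficient-+ p q n)))
    (trans (+-assoc _ _ _)
    (sym (trans (coefficient-+ p (q +ₚ r) n) (+-congˡ (coefficient-+ q r n)))))) ⟫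

  +ₚ-identityʳ : ∀ p → p +ₚ [] ≋ p
  +ₚ-identityʳ p = ⟪ (λ n → trans (coefficient-+ p [] n) (+-identityʳ _)) ⟫


  +ₚ-commutativeMonoid : CommutativeMonoid _ _
  +ₚ-commutativeMonoid = record
    { _∙_ = _+ₚ_
    ; ε   = []
    ; isCommutativeMonoid = record
      { isMonoid = record
        { isSemigroup = record
          { isMagma = record
            { isEquivalence = record { refl = ≋-refl ; sym = ≋-sym ; trans = ≋-trans }
            ; ∙-cong = +ₚ-cong
            }
          ; assoc = +ₚ-assoc
          }
        ; identity = (λ _ → ≋-refl) , +ₚ-identityʳ
        }
      ; comm = +ₚ-comm
      }
    }

  private
    module A = CommutativeMonoid +ₚ-commutativeMonoid
    open CommutativeSemigroupProperties A.commutativeSemigroup using (interchange; x∙yz≈y∙xz)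
    open SetoidReasoning A.setoid

  X*-+ : ∀ p q → X* (p +ₚ q) ≋ X* p +ₚ X* q
  X*-+ p q = ∷-cong (sym (+-identityʳ 0#)) ≋-refl

  scale-cong : ∀ {a b p q} → a ≈ b → p ≋ q → scale a p ≋ scale b q
  scale-cong {a} {b} {p} {q} e f = ⟪ (λ n →
    trans (coefficient-scale a p n) (trans (*-cong e (at f n)) (sym (coefficient-scale b q n)))) ⟫

  scale-+ : ∀ a p q → scale a (p +ₚ q) ≋ scale a p +ₚ scale a q
  scale-+ a []      q       = ≋-refl
  scale-+ a (b ∷ p) []      = ≋-refl
  scale-+ a (b ∷ p) (d ∷ q) = ∷-cong (distribˡ a b d) (scale-+ a p q)

  +-scale : ∀ a b p → scale (a + b) p ≋ scale a p +ₚ scale b p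
  +-scale a b []      = ≋-refl
  +-scale a b (d ∷ p) = ∷-cong (distribʳ d a b) (+-scale a b p)

  scale-scale : ∀ a b p → scale a (scale b p) ≋ scale (a * b) p
  scale-scale a b []      = ≋-refl
  scale-scale a b (d ∷ p) = ∷-cong (sym (*-assoc a b d)) (scale-scale a b p)

  scale-X* : ∀ a p → scale a (X* p) ≋ X* scale a p
  scale-X* a p = ∷-cong (zeroʳ a) ≋-refl

  scale-1 : ∀ p → scale 1# p ≋ p
  scale-1 []      = ≋-refl
  scale-1 (a ∷ p) = ∷-cong (*-identityˡ a) (scale-1 p)

  scale-0 : ∀ p → scale 0# p ≋ []
  scale-0 p = ⟪ (λ n → trans (coefficient-scale 0# p n) (zeroˡ _)) ⟫

  X*[] : X* [] ≋ []
  X*[] = ⟪ (λ { zero → refl ; (suc n) → refl }) ⟫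

  *ₚ-congˡ : ∀ p {q q′} → q ≋ q′ → p *ₚ q ≋ p *ₚ q′
  *ₚ-congˡ []      e = ≋-refl
  *ₚ-congˡ (a ∷ p) e = +ₚ-cong (scale-cong refl e) (∷-cong refl (*ₚ-congˡ p e))

  *ₚ-distribʳ : ∀ q p p′ → (p +ₚ p′) *ₚ q ≋ p *ₚ q +ₚ p′ *ₚ q
  *ₚ-distribʳ q []      p′       = ≋-refl
  *ₚ-distribʳ q (a ∷ p) []       = ≋-sym (+ₚ-identityʳ _)
  *ₚ-distribʳ q (a ∷ p) (b ∷ p′) = begin
    scale (a + b) q +ₚ X* ((p +ₚ p′) *ₚ q)
      ≈⟨ +ₚ-cong (+-scale a b q) (≋-trans (∷-cong refl (*ₚ-distribʳ q p p′)) (X*-+ (p *ₚ q) (p′ *ₚ q))) ⟩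
    (scale a q +ₚ scale b q) +ₚ (X* (p *ₚ q) +ₚ X* (p′ *ₚ q))
      ≈⟨ interchange (scale a q) (scale b q) (X* (p *ₚ q)) (X* (p′ *ₚ q)) ⟩
    (a ∷ p) *ₚ q +ₚ (b ∷ p′) *ₚ q ∎

  scale-* : ∀ a p q → scale a p *ₚ q ≋ scale a (p *ₚ q)
  scale-* a []      q = ≋-refl
  scale-* a (b ∷ p) q = begin
    scale (a * b) q +ₚ X* (scale a p *ₚ q)
      ≈⟨ +ₚ-cong (≋-sym (scale-scale a b q)) (≋-trans (∷-cong refl (scale-* a p q)) (≋-sym (scale-X* a _))) ⟩
    scale a (scale b q) +ₚ scale a (X* (p *ₚ q))
      ≈⟨ scale-+ a (scale b q) (X* (p *ₚ q)) ⟨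
    scale a ((b ∷ p) *ₚ q) ∎

  X*-* : ∀ p q → (X* p) *ₚ q ≋ X* (p *ₚ q)
  X*-* p q = +ₚ-cong (scale-0 q) ≋-refl

  *ₚ-zeroʳ : ∀ p → p *ₚ [] ≋ []
  *ₚ-zeroʳ []      = ≋-refl
  *ₚ-zeroʳ (a ∷ p) = ≋-trans (∷-cong refl (*ₚ-zeroʳ p)) X*[]

  -- Multiplication recurses on its left factor; this mirror image of its defining equation is what
  -- commutativity rests on.
  *ₚ-∷ : ∀ p b q → p *ₚ (b ∷ q) ≋ scale b p +ₚ X* (p *ₚ q)
  *ₚ-∷ []      b q = ≋-sym X*[]
  *ₚ-∷ (a ∷ p) b q = ∷-cong (+-congʳ (*-comm a b)) (begin
    scale a q +ₚ p *ₚ (b ∷ q)               ≈⟨ +ₚ-cong ≋-refl (*ₚ-∷ p b q) ⟩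
    scale a q +ₚ (scale b p +ₚ X* (p *ₚ q)) ≈⟨ x∙yz≈y∙xz (scale a q) (scale b p) (X* (p *ₚ q)) ⟩
    scale b p +ₚ (scale a q +ₚ X* (p *ₚ q)) ∎)

  *ₚ-comm : ∀ p q → p *ₚ q ≋ q *ₚ p
  *ₚ-comm []      q = ≋-sym (*ₚ-zeroʳ q)
  *ₚ-comm (a ∷ p) q = ≋-trans (+ₚ-cong ≋-refl (∷-cong refl (*ₚ-comm p q))) (≋-sym (*ₚ-∷ q a p))

  -- Equal polynomials may be lists of different lengths, so recursion on the left factor does not
  -- respect equality directly. Commutativity moves each change to the right factor.
  *ₚ-cong : ∀ {p p′ q q′} → p ≋ p′ → q ≋ q′ → p *ₚ q ≋ p′ *ₚ q′
  *ₚ-cong {p} {p′} {q} {q′} e f = begin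
    p *ₚ q    ≈⟨ *ₚ-congˡ p f ⟩
    p *ₚ q′   ≈⟨ *ₚ-comm p q′ ⟩
    q′ *ₚ p   ≈⟨ *ₚ-congˡ q′ e ⟩
    q′ *ₚ p′  ≈⟨ *ₚ-comm q′ p′ ⟩
    p′ *ₚ q′  ∎

  *ₚ-assoc : ∀ p q r → (p *ₚ q) *ₚ r ≋ p *ₚ (q *ₚ r)
  *ₚ-assoc []      q r = ≋-refl
  *ₚ-assoc (a ∷ p) q r = begin
    (scale a q +ₚ X* (p *ₚ q)) *ₚ r           ≈⟨ *ₚ-distribʳ r (scale a q) _ ⟩
    scale a q *ₚ r +ₚ (X* (p *ₚ q)) *ₚ r      ≈⟨ +ₚ-cong (scale-* a q r)
                                                  (≋-trans (X*-* (p *ₚ q) r) (∷-cong refl (*ₚ-assoc p q r))) ⟩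
    (a ∷ p) *ₚ (q *ₚ r)                       ∎

  *ₚ-identityˡ : ∀ p → (1# ∷ []) *ₚ p ≋ p
  *ₚ-identityˡ p = ≋-trans (+ₚ-cong (scale-1 p) X*[]) (+ₚ-identityʳ p)

  polynomialSemiring : CommutativeSemiring _ _
  polynomialSemiring = record
    { 0# = []
    ; 1# = 1# ∷ []
    ; isCommutativeSemiring = isCommutativeSemiringˡ record
      { +-isCommutativeMonoid = A.isCommutativeMonoid
      ; *-isCommutativeMonoid = record
        { isMonoid = record
          { isSemigroup = record
            { isMagma = record { isEquivalence = A.isEquivalence ; ∙-cong = *ₚ-cong }
            ; assoc = *ₚ-assoc
            }
          ; identity = *ₚ-identityˡ , λ p → ≋-trans (*ₚ-comm p _) (*ₚ-identityˡ p)
          }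
        ; comm = *ₚ-comm
        }
      ; distribʳ = *ₚ-distribʳ
      ; zeroˡ    = λ _ → ≋-refl
      }
    }

  evaluate-zero : ∀ {p} x → p ≋ [] → evaluate p x ≈ 0#
  evaluate-zero {[]}    x e = refl
  evaluate-zero {a ∷ p} x e =
    trans (+-cong (at e 0) (trans (*-congˡ (evaluate-zero {p} x ⟪ (λ n → at e (suc n)) ⟫)) (zeroʳ x)))
          (+-identityʳ 0#)

  evaluate-cong : ∀ {p q} x → p ≋ q → evaluate p x ≈ evaluate q x
  evaluate-cong {[]}    {q}     x e = sym (evaluate-zero {q} x (≋-sym e))
  evaluate-cong {a ∷ p} {[]}    x e = evaluate-zero {a ∷ p} x e
  evaluate-cong {a ∷ p} {b ∷ q} x e =
    +-cong (at e 0) (*-congˡ (evaluate-cong {p} {q} x ⟪ (λ n → at e (suc n)) ⟫))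

  evaluate-congʳ : ∀ p {x y} → x ≈ y → evaluate p x ≈ evaluate p y
  evaluate-congʳ []      e = refl
  evaluate-congʳ (a ∷ p) e = +-congˡ (*-cong e (evaluate-congʳ p e))

  evaluate-constant : ∀ a x → evaluate (a ∷ []) x ≈ a
  evaluate-constant a x = trans (+-congˡ (zeroʳ x)) (+-identityʳ a)

  open CommutativeSemigroupProperties +-commutativeSemigroup
    using () renaming (interchange to +-interchange)
  open CommutativeSemigroupProperties *-commutativeSemigroup
    using () renaming (x∙yz≈y∙xz to x*yz≈y*xz)

  evaluate-+ : ∀ p q x → evaluate (p +ₚ q) x ≈ evaluate p x + evaluate q x
  evaluate-+ []      q       x = sym (+-identityˡ _)
  evaluate-+ (a ∷ p) []      x = sym (+-identityʳ _)
  evaluate-+ (a ∷ p) (b ∷ q) x =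
    trans (+-congˡ (trans (*-congˡ (evaluate-+ p q x)) (distribˡ x _ _))) (+-interchange a b _ _)

  evaluate-scale : ∀ a p x → evaluate (scale a p) x ≈ a * evaluate p x
  evaluate-scale a []      x = sym (zeroʳ a)
  evaluate-scale a (b ∷ p) x =
    trans (+-congˡ (trans (*-congˡ (evaluate-scale a p x)) (x*yz≈y*xz x a _))) (sym (distribˡ a _ _))

  evaluate-* : ∀ p q x → evaluate (p *ₚ q) x ≈ evaluate p x * evaluate q x
  evaluate-* []      q x = sym (zeroˡ _)
  evaluate-* (a ∷ p) q x =
    trans (evaluate-+ (scale a q) (X* (p *ₚ q)) x)
    (trans (+-cong (evaluate-scale a q x)
             (trans (+-identityˡ _) (trans (*-congˡ (evaluate-* p q x)) (sym (*-assoc x _ _)))))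
           (sym (distribʳ _ a _)))

  open SemiringMult semiring using (×-comm-*; ×-congʳ) renaming (_×_ to _·_)
  open CommutativeMonoidMult +-commutativeMonoid using (×-distrib-+)

  -- A description of the derivative that depends on the coefficients alone; congruence and
  -- linearity then follow without comparing the shapes of lists.
  coefficient-derivative : ∀ p n → coefficient (derivative p) n ≈ suc n · coefficient p (suc n)
  coefficient-derivative []      n = sym (trans (+-identityˡ _) (zeros n))
    where
    zeros : ∀ n → n · 0# ≈ 0#
    zeros zero    = refl
    zeros (suc n) = trans (+-identityˡ _) (zeros n)
  coefficient-derivative (a ∷ p) n = trans (coefficient-+ p (X* derivative p) n) (+-congˡ (shifted n))
    where
    shifted : ∀ n → coefficient (X* derivative p) n ≈ n · coefficient p n
    shifted zero    = refl
    shifted (suc n) = coefficient-derivative p n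

  derivative-cong : ∀ {p q} → p ≋ q → derivative p ≋ derivative q
  derivative-cong {p} {q} e = ⟪ (λ n → trans (coefficient-derivative p n)
    (trans (×-congʳ (suc n) (at e (suc n))) (sym (coefficient-derivative q n)))) ⟫

  derivative-+ : ∀ p q → derivative (p +ₚ q) ≋ derivative p +ₚ derivative q
  derivative-+ p q = ⟪ (λ n → trans (coefficient-derivative (p +ₚ q) n)
    (trans (×-congʳ (suc n) (coefficient-+ p q (suc n)))
    (trans (×-distrib-+ _ _ (suc n))
    (trans (sym (+-cong (coefficient-derivative p n) (coefficient-derivative q n)))
           (sym (coefficient-+ (derivative p) (derivative q) n)))))) ⟫

  derivative-scale : ∀ a p → derivative (scale a p) ≋ scale a (derivative p)
  derivative-scale a p = ⟪ (λ n → trans (coefficient-derivative (scale a p) n)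
    (trans (×-congʳ (suc n) (coefficient-scale a p (suc n)))
    (trans (sym (×-comm-* (suc n) a _))
    (trans (*-congˡ (sym (coefficient-derivative p n)))
           (sym (coefficient-scale a (derivative p) n)))))) ⟫

  derivative-* : ∀ p q → derivative (p *ₚ q) ≋ derivative p *ₚ q +ₚ p *ₚ derivative q
  derivative-* []      q = ≋-refl
  derivative-* (a ∷ p) q = begin
    derivative (scale a q +ₚ X* (p *ₚ q))
      ≈⟨ derivative-+ (scale a q) (X* (p *ₚ q)) ⟩
    derivative (scale a q) +ₚ (p *ₚ q +ₚ X* derivative (p *ₚ q))
      ≈⟨ +ₚ-cong (derivative-scale a q)
           (+ₚ-cong ≋-refl (≋-trans (∷-cong refl (derivative-* p q)) (X*-+ (derivative p *ₚ q) _))) ⟩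
    scale a (derivative q) +ₚ (p *ₚ q +ₚ (X* (derivative p *ₚ q) +ₚ X* (p *ₚ derivative q)))
      ≈⟨ +ₚ-cong (≋-refl {scale a (derivative q)})
           (+ₚ-assoc (p *ₚ q) (X* (derivative p *ₚ q)) (X* (p *ₚ derivative q))) ⟨
    scale a (derivative q) +ₚ ((p *ₚ q +ₚ X* (derivative p *ₚ q)) +ₚ X* (p *ₚ derivative q))
      ≈⟨ x∙yz≈y∙xz (scale a (derivative q)) (p *ₚ q +ₚ X* (derivative p *ₚ q)) (X* (p *ₚ derivative q)) ⟩
    (p *ₚ q +ₚ X* (derivative p *ₚ q)) +ₚ (a ∷ p) *ₚ derivative q
      ≈⟨ +ₚ-cong (≋-sym (≋-trans (*ₚ-distribʳ q p (X* derivative p)) (+ₚ-cong (≋-refl {p *ₚ q}) (X*-* (derivative p) q)))) ≋-refl ⟩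
    derivative (a ∷ p) *ₚ q +ₚ (a ∷ p) *ₚ derivative q ∎

  separable-cong : ∀ {p q} → p ≋ q → Separable p → Separable q
  separable-cong {p} {q} e (u , v , f) = u , v , at
    (≋-trans {q = u *ₚ p +ₚ v *ₚ derivative p} (+ₚ-cong (*ₚ-congˡ u (≋-sym e)) (*ₚ-congˡ v (derivative-cong (≋-sym e)))) (⟪_⟫ {q = 1# ∷ []} f))

  -- By the Leibniz rule, u(qm) + v(qm)′ = (uq + vq′)m + (vq)m′, so a Bézout identity for the
  -- product is one for each factor.
  separable-factor : ∀ {q m} → Separable (q *ₚ m) → Separable m
  separable-factor {q} {m} (u , v , f) = u *ₚ q +ₚ v *ₚ derivative q , v *ₚ q , at (begin
    (u *ₚ q +ₚ v *ₚ derivative q) *ₚ m +ₚ v *ₚ q *ₚ derivative m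
      ≈⟨ solve 6 (λ u v q m q′ m′ →
           (u :* q :+ v :* q′) :* m :+ v :* q :* m′ := u :* (q :* m) :+ v :* (q′ :* m :+ q :* m′))
           ≋-refl u v q m (derivative q) (derivative m) ⟩
    u *ₚ (q *ₚ m) +ₚ v *ₚ (derivative q *ₚ m +ₚ q *ₚ derivative m)
      ≈⟨ +ₚ-cong ≋-refl (*ₚ-congˡ v (derivative-* q m)) ⟨
    u *ₚ (q *ₚ m) +ₚ v *ₚ derivative (q *ₚ m)
      ≈⟨ ⟪ f ⟫ ⟩
    1# ∷ [] ∎)
    where open Solver polynomialSemiring using (solve; _:+_; _:*_; _:=_)

  separable-≉0 : 1# ≉ 0# → ∀ {p} → Separable p → p ≋ [] → ⊥
  separable-≉0 1≉0 {p} (u , v , f) e = 1≉0 (at (begin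
    1# ∷ []                            ≈⟨ ⟪ f ⟫ ⟨
    u *ₚ p +ₚ v *ₚ derivative p        ≈⟨ +ₚ-cong (≋-trans (*ₚ-congˡ u e) (*ₚ-zeroʳ u))
                                            (≋-trans (*ₚ-congˡ v (derivative-cong e)) (*ₚ-zeroʳ v)) ⟩
    []                                 ∎) 0)

  -- Evaluating the Bézout identity at a common zero of the polynomial and its derivative gives 1 =
  -- 0.
  separable-simple : 1# ≉ 0# → ∀ {p} x → Separable p →
                     evaluate p x ≈ 0# → evaluate (derivative p) x ≈ 0# → ⊥
  separable-simple 1≉0 {p} x (u , v , f) e e′ = 1≉0 (S.begin
    1#                                                    S.≈⟨ evaluate-constant 1# x ⟨
    evaluate (1# ∷ []) x                                  S.≈⟨ evaluate-cong {u *ₚ p +ₚ v *ₚ derivative p} {1# ∷ []} x ⟪ f ⟫ ⟨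
    evaluate (u *ₚ p +ₚ v *ₚ derivative p) x              S.≈⟨ evaluate-+ (u *ₚ p) _ x ⟩
    evaluate (u *ₚ p) x + evaluate (v *ₚ derivative p) x  S.≈⟨ +-cong (vanish u p e) (vanish v (derivative p) e′) ⟩
    0# + 0#                                               S.≈⟨ +-identityʳ 0# ⟩
    0#                                                    S.∎)
    where
    module S = SetoidReasoning setoid
    vanish : ∀ u p → evaluate p x ≈ 0# → evaluate (u *ₚ p) x ≈ 0#
    vanish u p e = trans (evaluate-* u p x) (trans (*-congˡ e) (zeroʳ _))

module MapPolynomial {a aℓ b bℓ} {A : CommutativeRing a aℓ} {B : CommutativeRing b bℓ}
  {j : CommutativeRing.Carrier A → CommutativeRing.Carrier B}
  (j-hom : IsRingHomomorphism (CommutativeRing.rawRing A) (CommutativeRing.rawRing B) j) where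

  private
    module A[X] where
      open Polynomial A public
      open PolynomialSemiring A public
    module B where
      open CommutativeRing B public
      open Polynomial B public
      open PolynomialSemiring B public
  open CommutativeRing A using (_≈_)
  open B using (_≋_; ≋-refl; ≋-sym; ≋-trans; ⟪_⟫; ∷-cong)
  open IsRingHomomorphism j-hom

  coefficient-map : ∀ p n → B.coefficient (map j p) n B.≈ j (A[X].coefficient p n)
  coefficient-map []      n       = B.sym 0#-homo
  coefficient-map (a ∷ p) zero    = B.refl
  coefficient-map (a ∷ p) (suc n) = coefficient-map p n

  map-cong : ∀ {p q} → p A[X].≋ q → map j p ≋ map j q
  map-cong {p} {q} e = ⟪ (λ n →
    B.trans (coefficient-map p n) (B.trans (⟦⟧-cong (A[X].at e n)) (B.sym (coefficient-map q n)))) ⟫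

  map-+ : ∀ p q → map j (p A[X].+ₚ q) ≋ map j p B.+ₚ map j q
  map-+ []      q       = ≋-refl
  map-+ (a ∷ p) []      = ≋-refl
  map-+ (a ∷ p) (b ∷ q) = ∷-cong (+-homo a b) (map-+ p q)

  map-scale : ∀ a p → map j (A[X].scale a p) ≋ B.scale (j a) (map j p)
  map-scale a []      = ≋-refl
  map-scale a (b ∷ p) = ∷-cong (*-homo a b) (map-scale a p)

  map-* : ∀ p q → map j (p A[X].*ₚ q) ≋ map j p B.*ₚ map j q
  map-* []      q = ≋-refl
  map-* (a ∷ p) q = ≋-trans (map-+ (A[X].scale a q) _)
    (B.+ₚ-cong (map-scale a q) (∷-cong 0#-homo (map-* p q)))

  map-derivative : ∀ p → map j (A[X].derivative p) ≋ B.derivative (map j p)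
  map-derivative []      = ≋-refl
  map-derivative (a ∷ p) = ≋-trans (map-+ p _) (B.+ₚ-cong ≋-refl (∷-cong 0#-homo (map-derivative p)))

  separable-map : ∀ {p} → A[X].Separable p → B.Separable (map j p)
  separable-map {p} (u , v , f) = map j u , map j v , B.at
    (≋-trans (B.+ₚ-cong (≋-sym (map-* u p))
        (≋-trans (B.*ₚ-congˡ (map j v) (≋-sym (map-derivative p))) (≋-sym (map-* v _))))
    (≋-trans (≋-sym (map-+ (u A[X].*ₚ p) _))
    (≋-trans (map-cong {q = _ ∷ []} A[X].⟪ f ⟫) (∷-cong 1#-homo ≋-refl))))

  evaluate-map : ∀ p x → B.evaluate (map j p) (j x) B.≈ j (A[X].evaluate p x)
  evaluate-map []      x = B.sym 0#-homo
  evaluate-map (a ∷ p) x = B.trans (B.+-congˡ (B.trans (B.*-congˡ (evaluate-map p x)) (B.sym (*-homo x _))))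
                                   (B.sym (+-homo a _))

-- Fields, division with remainder, and roots

module FieldProperties {c ℓ} (F : Field c ℓ) where

  open Field F

  *-cancel-≉0 : ∀ {x y} → x ≉ 0# → x * y ≈ 0# → y ≈ 0#
  *-cancel-≉0 {x} {y} x≉0 p with inverse x x≉0
  ... | x⁻¹ , q , _ = trans (sym (*-identityˡ y)) (trans (*-congʳ (sym q))
    (trans (*-assoc _ _ _) (trans (*-congˡ p) (zeroʳ _))))

  *-≉0 : ∀ {x y} → x ≉ 0# → y ≉ 0# → x * y ≉ 0#
  *-≉0 x≉0 y≉0 p = y≉0 (*-cancel-≉0 x≉0 p)

  unit-≉0 : ∀ {x y} → x * y ≈ 1# → x ≉ 0#
  unit-≉0 p x≈0 = 1≉0 (trans (sym p) (trans (*-congʳ x≈0) (zeroˡ _)))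

module FieldHomomorphism {a aℓ b bℓ} (A : Field a aℓ) (B : Field b bℓ)
  {j : Field.Carrier A → Field.Carrier B}
  (j-hom : IsRingHomomorphism (Field.rawRing A) (Field.rawRing B) j) where

  private
    module A = Field A
    module B = Field B
  open IsRingHomomorphism j-hom

  preserves-≉0 : ∀ {x} → x A.≉ A.0# → j x B.≉ B.0#
  preserves-≉0 {x} x≉0 with A.inverse x x≉0
  ... | y , _ , p = FieldProperties.unit-≉0 B
    (B.trans (B.sym (*-homo x y)) (B.trans (⟦⟧-cong p) 1#-homo))

module Division {c ℓ} (R : CommutativeRing c ℓ) where

  open CommutativeRing R hiding (zero)
  open Polynomial R
  open PolynomialSemiring R
  open RingProperties ring using (-‿distribˡ-*)
  private
    module A = CommutativeMonoid +ₚ-commutativeMonoid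
    open SetoidReasoning A.setoid

  monic : ∀ {n} → Vec Carrier n → Poly
  monic v = toList v ++ (1# ∷ [])

  coefficient-monic : ∀ {n} (v : Vec Carrier n) → coefficient (monic v) n ≈ 1#
  coefficient-monic []      = refl
  coefficient-monic (a ∷ v) = coefficient-monic v

  private
    subtract-add : ∀ x y → x + (y - x) ≈ y
    subtract-add x y = trans (+-congˡ (+-comm y (- x))) (trans (sym (+-assoc x (- x) y))
      (trans (+-congʳ (-‿inverseʳ x)) (+-identityˡ y)))

    -- The multiplier is the last entry of `w`: subtracting that multiple of the monic polynomial
    -- cancels the term of degree n. The lengths of vectors serve as strict degree bounds.
    reduce : ∀ {n} (w : Vec Carrier (suc n)) (v : Vec Carrier n) →
             ∃[ r ] ∃[ u ] toList w ≋ scale r (monic v) +ₚ toList {n = n} u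
    reduce (a ∷ [])        []      = a , [] , ∷-cong (sym (*-identityʳ a)) ≋-refl
    reduce (a ∷ w@(_ ∷ _)) (b ∷ v) with reduce w v
    ... | r , u , e = r , a - r * b ∷ u , ∷-cong (sym (subtract-add (r * b) a)) e

    zeros : ∀ n → [] ≋ toList (Vec.replicate n 0#)
    zeros zero    = ≋-refl
    zeros (suc n) = ≋-trans (≋-sym X*[]) (∷-cong refl (zeros n))

  -- If p = qm + u, then a + Xp = (Xq)m + (a + Xu), and the last summand exceeds the degree bound by
  -- one, so a single `reduce` finishes.
  divide : ∀ {n} (v : Vec Carrier n) p → ∃[ q ] ∃[ u ] p ≋ q *ₚ monic v +ₚ toList {n = n} u
  divide {n} v [] = [] , Vec.replicate n 0# , zeros n
  divide v (a ∷ p) with divide v p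
  ... | q , u , e with reduce (a ∷ u) v
  ...   | r , w , f = r ∷ q , w , (begin
    a ∷ p
      ≈⟨ ∷-cong (sym (+-identityˡ a)) e ⟩
    X* (q *ₚ monic v) +ₚ (a ∷ toList u)
      ≈⟨ +ₚ-cong (≋-refl {X* (q *ₚ monic v)}) f ⟩
    X* (q *ₚ monic v) +ₚ (scale r (monic v) +ₚ toList w)
      ≈⟨ x∙yz≈yx∙z (X* (q *ₚ monic v)) (scale r (monic v)) (toList w) ⟩
    (r ∷ q) *ₚ monic v +ₚ toList w ∎)
    where open CommutativeSemigroupProperties A.commutativeSemigroup using (x∙yz≈yx∙z)

  linear : Carrier → Poly
  linear r = - r ∷ 1# ∷ []

  evaluate-linear : ∀ r x → evaluate (linear r) x ≈ x - r
  evaluate-linear r x = trans (+-comm _ _)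
    (+-congʳ (trans (*-congˡ (evaluate-constant 1# x)) (*-identityʳ x)))

  -- Synthetic division of `a ∷ p` by X - r: the coefficients of the quotient are the intermediate
  -- values of Horner's scheme at r.
  deflate : Carrier → Carrier → Poly → Poly
  deflate r a []      = []
  deflate r a (b ∷ p) = evaluate (b ∷ p) r ∷ deflate r b p

  length-deflate : ∀ r a p → length (deflate r a p) ≡.≡ length p
  length-deflate r a []      = ≡.refl
  length-deflate r a (b ∷ p) = ≡.cong suc (length-deflate r b p)

  deflate-spec : ∀ r a p → a ∷ p ≋ linear r *ₚ deflate r a p +ₚ (evaluate (a ∷ p) r ∷ [])
  deflate-spec r a [] = ≋-trans
    (∷-cong (sym (trans (+-congˡ (zeroʳ r)) (+-identityʳ a))) ≋-refl)
    (+ₚ-cong (≋-sym (*ₚ-zeroʳ (linear r))) (≋-refl {a + r * 0# ∷ []}))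
  deflate-spec r a (b ∷ p) = begin
    a ∷ b ∷ p
      ≈⟨ ∷-cong (constant-term e a) (≋-trans (deflate-spec r b p) (≋-trans (+ₚ-comm Q (e ∷ []))
           (∷-cong′ Q))) ⟩
    (scale e (linear r) +ₚ X* Q) +ₚ (a + r * e ∷ [])
      ≈⟨ +ₚ-cong (*ₚ-∷ (linear r) e (deflate r b p)) (≋-refl {a + r * e ∷ []}) ⟨
    linear r *ₚ (e ∷ deflate r b p) +ₚ (a + r * e ∷ []) ∎
    where
    e = evaluate (b ∷ p) r
    Q = linear r *ₚ deflate r b p
    constant-term : ∀ e a → a ≈ e * - r + 0# + (a + r * e)
    constant-term e a = trans (sym (subtract-add (- (r * e)) a))
      (+-cong (trans (trans (-‿distribˡ-* r e) (*-comm _ _)) (sym (+-identityʳ _)))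
              (+-congˡ (RingProperties.-‿involutive ring _)))
    ∷-cong′ : ∀ Q → (e ∷ []) +ₚ Q ≋ ((e * 1# ∷ []) +ₚ Q) +ₚ []
    ∷-cong′ Q = ≋-trans (+ₚ-cong {q = Q} (∷-cong (sym (*-identityʳ e)) (≋-refl {[]})) ≋-refl)
      (≋-sym (+ₚ-identityʳ _))

  deflate-root : ∀ {r a p} → evaluate (a ∷ p) r ≈ 0# → a ∷ p ≋ linear r *ₚ deflate r a p
  deflate-root {r} {a} {p} e = ≋-trans (deflate-spec r a p)
    (≋-trans (+ₚ-cong (≋-refl {linear r *ₚ deflate r a p})
                      (≋-trans (∷-cong e (≋-refl {[]})) X*[]))
      (+ₚ-identityʳ _))

module FieldDivision (classical : Classical) {c ℓ} (F : Field c ℓ) where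

  open Classical classical
  open Field F hiding (zero)
  open FieldProperties F
  open Polynomial commutativeRing
  open PolynomialSemiring commutativeRing
  open Division commutativeRing
  private module A = CommutativeMonoid +ₚ-commutativeMonoid

  -- Splitting off a factor X - r shortens the list by one, and every root other than r is a root of
  -- the quotient. The recursion runs on a bound for the length, as the quotient is not a sublist.
  finitely-many-roots : ∀ p → ¬ p ≋ [] → ∃[ R ] (∀ x → evaluate p x ≈ 0# → Any (x ≈_) R)
  finitely-many-roots p = bounded (length p) p ℕ.≤-refl
    where
    bounded : ∀ n p → length p ℕ.≤ n → ¬ p ≋ [] → ∃[ R ] (∀ x → evaluate p x ≈ 0# → Any (x ≈_) R)
    bounded n       []      _         p≉0 = ⊥-elim (p≉0 ≋-refl)
    bounded (suc n) (a ∷ p) (s≤s p≤n) p≉0 with em {P = ∃[ r ] evaluate (a ∷ p) r ≈ 0#}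
    ... | no  ¬root = [] , λ x e → ⊥-elim (¬root (x , e))
    ... | yes (r , e) with bounded n (deflate r a p)
                        (≡.subst (ℕ._≤ n) (≡.sym (length-deflate r a p)) p≤n)
                        (λ q≈0 → p≉0 (≋-trans (deflate-root {r} {a} {p} e)
                          (≋-trans (*ₚ-congˡ (linear r) q≈0) (*ₚ-zeroʳ (linear r)))))
    ...   | R , f = r ∷ R , roots
      where
      roots : ∀ x → evaluate (a ∷ p) x ≈ 0# → Any (x ≈_) (r ∷ R)
      roots x g with em {P = x ≈ r}
      ... | yes x≈r = here x≈r
      ... | no  x≉r = there (f x (*-cancel-≉0 x-r≉0 (trans (sym (*-congʳ (evaluate-linear r x)))
              (trans (sym (evaluate-* (linear r) (deflate r a p) x))
              (trans (sym (evaluate-cong {a ∷ p} {linear r *ₚ deflate r a p} x (deflate-root {r} {a} {p} e))) g)))))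
        where
        x-r≉0 : x - r ≉ 0#
        x-r≉0 h = x≉r (RingProperties.x∙y⁻¹≈ε⇒x≈y ring x r h)

  -- Trailing zeros hide the degree, so the leading coefficient has to be searched for. The bound n
  -- < `length p` is what makes a nonzero remainder have smaller degree than the divisor.
  normalise : ∀ p → p ≋ [] ⊎ (∃[ a ] ∃[ n ] ∃[ v ] n ℕ.< length p × a ≉ 0# × p ≋ scale a (monic {n} v))
  normalise [] = inj₁ ≋-refl
  normalise (b ∷ p) with normalise p
  ... | inj₂ (a , n , v , n<p , a≉0 , e) with inverse a a≉0
  ...   | a⁻¹ , _ , f = inj₂ (a , suc n , a⁻¹ * b ∷ v , s≤s n<p , a≉0
            , ∷-cong (sym (trans (sym (*-assoc a a⁻¹ b)) (trans (*-congʳ f) (*-identityˡ b)))) e)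
  normalise (b ∷ p) | inj₁ p≈0 with em {P = b ≈ 0#}
  ... | yes b≈0 = inj₁ (≋-trans (∷-cong b≈0 p≈0) X*[])
  ... | no  b≉0 = inj₂ (b , 0 , [] , s≤s z≤n , b≉0 , ∷-cong (sym (*-identityʳ b)) p≈0)

-- Minimal polynomials

module MinimalPolynomial (classical : Classical) {a aℓ b bℓ} (F : Field a aℓ) (E : Field b bℓ)
  {j : Field.Carrier F → Field.Carrier E}
  (j-hom : IsRingHomomorphism (Field.rawRing F) (Field.rawRing E) j) where

  open Classical classical
  private
    module F where
      open Field F public
      open Polynomial commutativeRing public
      open PolynomialSemiring commutativeRing public
      open Division commutativeRing public
      open FieldDivision classical F public
    module E where
      open Field E public
      open Polynomial commutativeRing public
      open PolynomialSemiring commutativeRing public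
  open F using (_≋_; ≋-sym; ≋-trans; ≋-refl; monic)
  open MapPolynomial {A = F.commutativeRing} {B = E.commutativeRing} j-hom

  Annihilates : F.Poly → E.Carrier → Set bℓ
  Annihilates p y = E.evaluate (map j p) y E.≈ E.0#

  annihilates-* : ∀ p q {y} → Annihilates q y → Annihilates (p F.*ₚ q) y
  annihilates-* p q {y} e = E.trans (E.evaluate-cong {map j (p F.*ₚ q)} y (map-* p q))
    (E.trans (E.evaluate-* (map j p) (map j q) y) (E.trans (E.*-congˡ e) (E.zeroʳ _)))

  annihilates-cong : ∀ {p q y} → p ≋ q → Annihilates p y → Annihilates q y
  annihilates-cong {p} {q} {y} e f = E.trans (E.evaluate-cong {map j q} {map j p} y (map-cong (≋-sym e))) f

  IsMinimal : ∀ {n} → Vec F.Carrier n → E.Carrier → Set (a ⊔ aℓ ⊔ bℓ)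
  IsMinimal v y = Annihilates (monic v) y ×
    (∀ p → Annihilates p y → ∃[ q ] p ≋ q F.*ₚ monic v)

  private
    Degree : ℕ → E.Carrier → Set _
    Degree n y = ∃[ v ] Annihilates (monic {n} v) y

    least : ∀ y n → Degree n y → ∃[ n ] Degree n y × (∀ k → k ℕ.< n → ¬ Degree k y)
    least y = <-rec _ step
      where
      step : ∀ n → (∀ {k} → k ℕ.< n → Degree k y → _) → Degree n y → _
      step n rec d with em {P = ∃[ k ] k ℕ.< n × Degree k y}
      ... | yes (k , k<n , e) = rec k<n e
      ... | no ¬e             = n , d , λ k k<n e → ¬e (k , k<n , e)

    degree : ∀ p {y} → Annihilates p y →
             p ≋ [] ⊎ (∃[ n ] n ℕ.< length p × Degree n y)
    degree p {y} e with F.normalise p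
    ... | inj₁ p≈0 = inj₁ p≈0
    ... | inj₂ (a , n , v , n<p , a≉0 , f) = inj₂ (n , n<p , v ,
      FieldProperties.*-cancel-≉0 E (FieldHomomorphism.preserves-≉0 F E j-hom a≉0)
        (E.trans (E.sym (E.evaluate-scale (j a) (map j (monic v)) y))
        (E.trans (E.evaluate-cong {E.scale (j a) (map j (monic v))} y (E.≋-sym (map-scale a (monic v))))
          (annihilates-cong {p} {F.scale a (monic v)} f e))))

    +-cancelˡ : ∀ {x y} → x E.+ y E.≈ E.0# → x E.≈ E.0# → y E.≈ E.0#
    +-cancelˡ e f = E.trans (E.sym (E.+-identityˡ _)) (E.trans (E.+-congʳ (E.sym f)) e)

  -- A monic annihilator of least degree divides every annihilator: the remainder annihilates y as
  -- well, and were it nonzero, its normalisation would be monic of smaller degree.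
  minimalPolynomial : ∀ {p} y → ¬ p ≋ [] → Annihilates p y → ∃[ n ] ∃[ v ] IsMinimal {n} v y
  minimalPolynomial {p} y p≉0 e with degree p e
  ... | inj₁ p≈0 = ⊥-elim (p≉0 p≈0)
  ... | inj₂ (k , _ , d) with least y k d
  ...   | n , (v , f) , minimal = n , v , f , divisible
    where
    divisible : ∀ p → Annihilates p y → ∃[ q ] p ≋ q F.*ₚ monic v
    divisible p g with F.divide v p
    ... | q , u , h with degree (toList u) {y} (+-cancelˡ
            (E.trans (E.sym (E.evaluate-+ (map j (q F.*ₚ monic v)) (map j (toList u)) y))
            (E.trans (E.evaluate-cong {map j (q F.*ₚ monic v) E.+ₚ map j (toList u)} y
                (E.≋-sym (map-+ (q F.*ₚ monic v) (toList u))))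
              (annihilates-cong {p} {q F.*ₚ monic v F.+ₚ toList u} h g)))
            (annihilates-* q (monic v) f))
    ...   | inj₁ u≈0 = q , ≋-trans h (≋-trans (F.+ₚ-cong (≋-refl {q F.*ₚ monic v}) u≈0) (F.+ₚ-identityʳ _))
    ...   | inj₂ (k , k<u , d) = ⊥-elim (minimal k (≡.subst (k ℕ.<_) (length-toList u) k<u) d)

module _ {a aℓ b bℓ} (A : Ring a aℓ) (B : Ring b bℓ) where

  private
    module A = Ring A
    module B = Ring B
    module PB = RingProperties B

  isRingHomomorphism : (f : A.Carrier → B.Carrier) →
    (∀ {x y} → x A.≈ y → f x B.≈ f y) →
    (∀ x y → f (x A.+ y) B.≈ f x B.+ f y) →
    (∀ x y → f (x A.* y) B.≈ f x B.* f y) →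
    f A.1# B.≈ B.1# →
    IsRingHomomorphism A.rawRing B.rawRing f
  isRingHomomorphism f cong +-homo *-homo 1-homo = record
    { isSemiringHomomorphism = record
      { isNearSemiringHomomorphism = record
        { +-isMonoidHomomorphism = record
          { isMagmaHomomorphism = record { isRelHomomorphism = record { cong = cong } ; homo = +-homo }
          ; ε-homo = 0-homo
          }
        ; *-homo = *-homo
        }
      ; 1#-homo = 1-homo
      }
    ; -‿homo = λ x → PB.+-inverseˡ-unique (f (A.- x)) (f x)
        (B.trans (B.sym (+-homo (A.- x) x)) (B.trans (cong (A.-‿inverseˡ x)) 0-homo))
    }
    where
    0-homo : f A.0# B.≈ B.0#
    0-homo = PB.x+x≈x⇒x≈0 _ (B.trans (B.sym (+-homo A.0# A.0#)) (cong (A.+-identityʳ A.0#)))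

-- The field fixed by all automorphisms

module FixedField (classical : Classical) {k kℓ s sℓ} {K : Field k kℓ}
  (Ω : SeparableClosure K s sℓ) where

  open Classical classical
  private
    module K where
      open Field K public
      open Polynomial commutativeRing public
      open PolynomialSemiring commutativeRing public
      open Division commutativeRing public
    module Ω = SeparableClosure Ω
  open Ω hiding (zero)
  private
    module φ = IsRingHomomorphism embed-isRingHomomorphism
    open Polynomial commutativeRing
    open PolynomialSemiring commutativeRing
    open Division commutativeRing
    open RingProperties ring using (-1*x≈-x; x∙y⁻¹≈ε⇒x≈y; +-inverseʳ-unique)
    open FieldProperties closure
    open Galois Ω
    open Automorphism using (⟦_⟧)

  1-embedded : ∀ {x} → embed (K.- K.1#) * x ≈ - x
  1-embedded = trans (*-congʳ (trans (φ.-‿homo _) (-‿cong φ.1#-homo))) (-1*x≈-x _)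

  module Specialisation {f fℓ} (F : Field f fℓ) {j₁ j₂ : Field.Carrier F → Carrier}
    (j₁-hom : IsRingHomomorphism (Field.rawRing F) rawRing j₁)
    (j₂-hom : IsRingHomomorphism (Field.rawRing F) rawRing j₂) where

    private
      module F = Field F
      module F[X] where
        open Polynomial F.commutativeRing public
        open PolynomialSemiring F.commutativeRing public
        open Division F.commutativeRing public
      module J₂ = MapPolynomial {A = F.commutativeRing} {B = commutativeRing} j₂-hom
      module j₁ = IsRingHomomorphism j₁-hom
      module j₂ = IsRingHomomorphism j₂-hom
    module M₁ = MinimalPolynomial classical F closure j₁-hom
    module M₂ = MinimalPolynomial classical F closure j₂-hom

    -- Exactly the condition under which P(y) ↦ P(z) is well defined, where the coefficients of P
    -- are embedded by j₁ on the side of y and by j₂ on the side of z.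
    _↝_ : Carrier → Carrier → Set _
    y ↝ z = ∀ P → M₁.Annihilates P y → M₂.Annihilates P z

    -- The minimal polynomial divides p, so its image under j₂ divides a separable polynomial. Its
    -- degree is positive because the constant 1 annihilates nothing.
    minimal-separable : ∀ p y → M₁.Annihilates p y → Separable (map j₂ p) →
      ∃[ n ] ∃[ v ] M₁.IsMinimal {suc n} v y × Separable (map j₂ (F[X].monic v))
    minimal-separable p y e sep with M₁.minimalPolynomial {p} y
      (λ p≈0 → separable-≉0 1≉0 sep (J₂.map-cong {q = []} p≈0)) e
    ... | zero , [] , e′ , _ = ⊥-elim (1≉0 (trans (sym (trans (evaluate-constant _ y) j₁.1#-homo)) e′))
    ... | suc n , v , minimal@(_ , divisible) with divisible p e
    ...   | q , p≈qm = n , v , minimal , separable-factor {map j₂ q}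
      (separable-cong (≋-trans (J₂.map-cong p≈qm) (J₂.map-* q _)) sep)

    -- Every polynomial vanishing at y is a multiple of the minimal one, and divisibility survives
    -- the passage from j₁ to j₂.
    root-specialises : ∀ {n y z} {v : Vec F.Carrier n} → M₁.IsMinimal v y →
                       M₂.Annihilates (F[X].monic v) z → y ↝ z
    root-specialises {v = v} (_ , divisible) e P g with divisible P g
    ... | q , P≈qm = M₂.annihilates-cong (F[X].≋-sym P≈qm) (M₂.annihilates-* q (F[X].monic v) e)

    leading : ∀ {n} (v : Vec F.Carrier n) → coefficient (map j₂ (F[X].monic v)) n ≉ 0#
    leading {n} v e = 1≉0 (trans (sym (trans (J₂.coefficient-map (F[X].monic v) n)
      (trans (j₂.⟦⟧-cong (F[X].coefficient-monic v)) j₂.1#-homo))) e)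

    specialise : ∀ p y → M₁.Annihilates p y → Separable (map j₂ p) → ∃[ z ] y ↝ z
    specialise p y e sep with minimal-separable p y e sep
    ... | n , v , minimal , sep′ with closed _ sep′ (n , leading v)
    ...   | z , e′ = z , root-specialises minimal e′

  module _ {n} (M : Poly) (x : Carrier) (separable-M : Separable M) (M[x]≈0 : evaluate M x ≈ 0#)
    (leading : coefficient M (suc (suc n)) ≉ 0#) where

    private
      factorise : ∀ M → evaluate M x ≈ 0# → ∃[ q ] M ≋ linear x *ₚ q
      factorise []      e = [] , ≋-sym (*ₚ-zeroʳ (linear x))
      factorise (a ∷ p) e = deflate x a p , deflate-root {x} e

      q = proj₁ (factorise M M[x]≈0)
      lin = linear x

      M≋ : M ≋ lin *ₚ q
      M≋ = proj₂ (factorise M M[x]≈0)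

      separable-q : Separable q
      separable-q = separable-factor {lin} (separable-cong M≋ separable-M)

      coefficients : ∀ i → coefficient q i ≈ 0# → coefficient q (suc i) ≈ 0# → coefficient M (suc i) ≈ 0#
      coefficients i e e′ = trans (at M≋ (suc i))
        (trans (coefficient-+ (scale (- x) q) (X* ((1# ∷ []) *ₚ q)) (suc i))
        (trans (+-cong (trans (coefficient-scale (- x) q (suc i)) (trans (*-congˡ e′) (zeroʳ _)))
                       (trans (at (*ₚ-identityˡ q) i) e))
               (+-identityʳ 0#)))

      -- M = (X - x)q gives M(n+2) = q(n+1) - x q(n+2) for the coefficients, so one of these two
      -- coefficients of q is nonzero.
      nonconstant : NonConstant q
      nonconstant with em {P = coefficient q (suc n) ≈ 0#}
      ... | no  q≉0 = n , q≉0
      ... | yes q≈0 = suc n , λ q≈0′ → leading (coefficients (suc n) q≈0 q≈0′)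

    open SetoidReasoning setoid

    -- A zero of M / (X − x); it differs from x because M has no repeated zeros.

    other-root : ∃[ z ] z ≉ x × evaluate M z ≈ 0#
    other-root = z , z≉x , (begin
      evaluate M z                            ≈⟨ evaluate-cong z M≋ ⟩
      evaluate (lin *ₚ q) z                   ≈⟨ evaluate-* lin q z ⟩
      evaluate lin z * evaluate q z           ≈⟨ *-congˡ q[z]≈0 ⟩
      evaluate lin z * 0#                     ≈⟨ zeroʳ _ ⟩
      0#                                      ∎)
      where
      z = proj₁ (closed q separable-q nonconstant)
      q[z]≈0 : evaluate q z ≈ 0#
      q[z]≈0 = proj₂ (closed q separable-q nonconstant)
      z≉x : z ≉ x
      z≉x z≈x = separable-simple 1≉0 {M} x separable-M M[x]≈0 (begin
        evaluate (derivative M) x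
          ≈⟨ evaluate-cong x (≋-trans (derivative-cong M≋) (derivative-* lin q)) ⟩
        evaluate (derivative lin *ₚ q +ₚ lin *ₚ derivative q) x
          ≈⟨ evaluate-+ (derivative lin *ₚ q) _ x ⟩
        evaluate (derivative lin *ₚ q) x + evaluate (lin *ₚ derivative q) x
          ≈⟨ +-cong (evaluate-* (derivative lin) q x) (evaluate-* lin (derivative q) x) ⟩
        evaluate (derivative lin) x * evaluate q x + evaluate lin x * evaluate (derivative q) x
          ≈⟨ +-cong (*-congˡ (trans (evaluate-congʳ q (sym z≈x)) q[z]≈0))
                    (*-congʳ (trans (evaluate-linear x x) (-‿inverseʳ x))) ⟩
        evaluate (derivative lin) x * 0# + 0# * evaluate (derivative q) x
          ≈⟨ +-cong (zeroʳ _) (zeroˡ _) ⟩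
        0# + 0#
          ≈⟨ +-identityʳ 0# ⟩
        0# ∎)

  -- With both embeddings equal to that of K, specialisation is conjugacy over K.
  module Base = Specialisation K embed-isRingHomomorphism embed-isRingHomomorphism

  -- A minimal polynomial of degree 1 would place x in K; in degree at least 2 it has a second zero.
  conjugate : ∀ x → ¬ (∃[ a ] embed a ≈ x) → ∃[ z ] z ≉ x × x Base.↝ z
  conjugate x x∉K = from-minimal (Base.minimal-separable p x e
    (MapPolynomial.separable-map {A = K.commutativeRing} embed-isRingHomomorphism sep))
    where
    p = proj₁ (separable x)
    sep = proj₁ (proj₂ (separable x))
    e = proj₂ (proj₂ (separable x))

    embedded : ∀ a → Base.M₁.Annihilates (K.monic (a ∷ [])) x → embed (K.- a) ≈ x
    embedded a e′ = begin
      embed (K.- a)                  ≈⟨ φ.-‿homo a ⟩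
      - embed a                      ≈⟨ +-inverseʳ-unique (embed a) _ e′ ⟨
      x * (embed K.1# + x * 0#)      ≈⟨ *-congˡ (trans (evaluate-constant _ x) φ.1#-homo) ⟩
      x * 1#                         ≈⟨ *-identityʳ x ⟩
      x                              ∎
      where open SetoidReasoning setoid

    from-minimal : ∃[ n ] ∃[ v ] Base.M₁.IsMinimal {suc n} v x × Separable (map embed (K.monic v)) →
                   ∃[ z ] z ≉ x × x Base.↝ z
    from-minimal (zero , a ∷ [] , (e′ , _) , _) = ⊥-elim (x∉K (K.- a , embedded a e′))
    from-minimal (suc n , v , minimal , sep′) =
      let (z , z≉x , e″) = other-root (map embed (K.monic v)) x sep′ (proj₁ minimal) (Base.leading v) in
      z , z≉x , Base.root-specialises minimal e″

  -- The graph of a K-isomorphism between subextensions of Ω. It is Bool-valued so that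
  -- the union of a chain of such relations lies in the same universe.

  record PartialIsomorphism : Set (k ⊔ s ⊔ sℓ) where
    field
      relation : Carrier → Carrier → Bool

    infix 4 _∼_
    _∼_ : Carrier → Carrier → Set
    x ∼ y = T (relation x y)

    field
      respects   : ∀ {x x′ y y′} → x ≈ x′ → y ≈ y′ → x ∼ y → x′ ∼ y′
      constants  : ∀ a → embed a ∼ embed a
      +-closed   : ∀ {x x′ y y′} → x ∼ y → x′ ∼ y′ → x + x′ ∼ y + y′
      *-closed   : ∀ {x x′ y y′} → x ∼ y → x′ ∼ y′ → x * x′ ∼ y * y′
      functional : ∀ {x y} → x ∼ y → x ≈ 0# → y ≈ 0#

    negated : ∀ {x y} → x ∼ y → - x ∼ - y
    negated r = respects 1-embedded 1-embedded (*-closed (constants _) r)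

    zero∼ : 0# ∼ 0#
    zero∼ = respects φ.0#-homo φ.0#-homo (constants _)

    one∼ : 1# ∼ 1#
    one∼ = respects φ.1#-homo φ.1#-homo (constants _)

    -- The relation is closed under differences, so respecting zero already makes it single-valued.
    deterministic : ∀ {x x′ y y′} → x ∼ y → x′ ∼ y′ → x ≈ x′ → y ≈ y′
    deterministic {x} {x′} {y} {y′} r r′ e = x∙y⁻¹≈ε⇒x≈y y y′
      (functional (+-closed r (negated r′)) (trans (+-congʳ e) (-‿inverseʳ x′)))

    evaluated : ∀ p {x y} → x ∼ y → evaluate (map embed p) x ∼ evaluate (map embed p) y
    evaluated []      r = zero∼
    evaluated (a ∷ p) r = +-closed (constants a) (*-closed r (evaluated p r))

    -- The domain is a ring of elements algebraic over K, hence a field: after cancelling powers of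
    -- X from an annihilating polynomial, a + x p(x) = 0 with a ≠ 0, and the inverse -p(x)/a is a
    -- polynomial in x, related to the same polynomial in y.
    invertible : ∀ {x y} → x ∼ y → x ≉ 0# → ∃[ x′ ] ∃[ y′ ] x′ ∼ y′ × x * x′ ≈ 1#
    invertible {x} {y} r x≉0 with separable x
    ... | p , sep , e = search p (K.separable-≉0 K.1≉0 sep) e
      where
      search : ∀ p → ¬ p K.≋ [] → evaluate (map embed p) x ≈ 0# → ∃[ x′ ] ∃[ y′ ] x′ ∼ y′ × x * x′ ≈ 1#
      search []      p≉0 e = ⊥-elim (p≉0 K.≋-refl)
      search (a ∷ p) p≉0 e with em {P = a K.≈ K.0#}
      ... | yes a≈0 = search p (λ p≈0 → p≉0 (K.≋-trans (K.∷-cong a≈0 p≈0) K.X*[]))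
          (*-cancel-≉0 x≉0 (trans (sym (+-identityˡ _)) (trans (+-congʳ (trans (sym φ.0#-homo) (sym (φ.⟦⟧-cong a≈0)))) e)))
      ... | no  a≉0 with K.inverse a a≉0
      ...   | a⁻¹ , f , _ = embed (K.- a⁻¹) * evaluate (map embed p) x
                          , embed (K.- a⁻¹) * evaluate (map embed p) y
                          , *-closed (constants _) (evaluated p r) , (begin
          x * (embed (K.- a⁻¹) * px)       ≈⟨ *-congˡ (*-congʳ (φ.-‿homo a⁻¹)) ⟩
          x * (- embed a⁻¹ * px)           ≈⟨ trans (sym (*-assoc _ _ _)) (trans (*-congʳ (*-comm _ _)) (*-assoc _ _ _)) ⟩
          - embed a⁻¹ * (x * px)           ≈⟨ *-congˡ (+-inverseʳ-unique (embed a) _ e) ⟩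
          - embed a⁻¹ * - embed a          ≈⟨ neg-neg _ _ ⟩
          embed a⁻¹ * embed a              ≈⟨ trans (sym (φ.*-homo _ _)) (trans (φ.⟦⟧-cong f) φ.1#-homo) ⟩
          1#                               ∎)
        where
        open SetoidReasoning setoid
        px = evaluate (map embed p) x
        neg-neg : ∀ a b → - a * - b ≈ a * b
        neg-neg a b = trans (sym (RingProperties.-‿distribˡ-* ring a (- b)))
          (trans (-‿cong (sym (RingProperties.-‿distribʳ-* ring a b))) (RingProperties.-‿involutive ring _))

    -- An inverse of x is related to some y′, so that y y′ is related to 1 and y cannot vanish.
    injective : ∀ {x y} → x ∼ y → y ≈ 0# → x ≈ 0#
    injective {x} {y} r y≈0 with em {P = x ≈ 0#}
    ... | yes x≈0 = x≈0
    ... | no  x≉0 with invertible r x≉0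
    ...   | x′ , y′ , r′ , e = ⊥-elim (1≉0 (trans (sym (deterministic (*-closed r r′) one∼ e))
              (trans (*-congʳ y≈0) (zeroˡ y′))))

  open PartialIsomorphism using (_∼_)

  -- Reduces surjectivity of a maximal isomorphism to totality of its inverse.
  flip : PartialIsomorphism → PartialIsomorphism
  flip Γ = record
    { relation   = λ x y → relation y x
    ; respects   = λ e f → respects f e
    ; constants  = constants
    ; +-closed   = +-closed
    ; *-closed   = *-closed
    ; functional = injective
    }
    where open PartialIsomorphism Γ

  infix 4 _≼_

  _≼_ : PartialIsomorphism → PartialIsomorphism → Set s
  Γ ≼ Δ = ∀ x y → _∼_ Γ x y → _∼_ Δ x y

  -- The relation consists of the pairs (P(y), P(z)) for P over F, and `y ↝ z` makes it respect
  -- zero. The hypothesis on constants says that F contains K and that both embeddings restrict to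
  -- the given one there.
  adjoin : ∀ {f fℓ} (F : Field f fℓ) (let module F = Field F) {j₁ j₂ : F.Carrier → Carrier}
    (j₁-hom : IsRingHomomorphism F.rawRing rawRing j₁)
    (j₂-hom : IsRingHomomorphism F.rawRing rawRing j₂) →
    (∀ a → ∃[ b ] j₁ b ≈ embed a × j₂ b ≈ embed a) →
    ∀ {y z} → Specialisation._↝_ F j₁-hom j₂-hom y z →
    ∃[ Δ ] _∼_ Δ y z × (∀ b → _∼_ Δ (j₁ b) (j₂ b))
  adjoin F {j₁} {j₂} j₁-hom j₂-hom ι {y} {z} y↝z = Δ
    , fromWitness (X , sym (X≈ j₁-hom) , sym (X≈ j₂-hom))
    , λ b → fromWitness (b ∷ [] , sym (evaluate-constant _ y) , sym (evaluate-constant _ z))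
    where
    module F = Field F
    module F[X] where
      open Polynomial F.commutativeRing public
      open PolynomialSemiring F.commutativeRing public
    R : Carrier → Carrier → Set _
    R u v = ∃[ P ] u ≈ evaluate (map j₁ P) y × v ≈ evaluate (map j₂ P) z
    X = F.0# ∷ F.1# ∷ []
    module _ {j} (j-hom : IsRingHomomorphism F.rawRing rawRing j) where
      open IsRingHomomorphism j-hom
      open MapPolynomial {A = F.commutativeRing} {B = commutativeRing} j-hom
      X≈ : ∀ {x} → evaluate (map j X) x ≈ x
      X≈ {x} = trans (+-cong 0#-homo (trans (*-congˡ (trans (evaluate-constant _ x) 1#-homo)) (*-identityʳ x)))
                     (+-identityˡ x)
      sum≈ : ∀ P Q x → evaluate (map j P) x + evaluate (map j Q) x ≈ evaluate (map j (P F[X].+ₚ Q)) x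
      sum≈ P Q x = sym (trans (evaluate-cong {map j (P F[X].+ₚ Q)} x (map-+ P Q)) (evaluate-+ (map j P) (map j Q) x))
      product≈ : ∀ P Q x → evaluate (map j P) x * evaluate (map j Q) x ≈ evaluate (map j (P F[X].*ₚ Q)) x
      product≈ P Q x = sym (trans (evaluate-cong {map j (P F[X].*ₚ Q)} x (map-* P Q)) (evaluate-* (map j P) (map j Q) x))
    Δ : PartialIsomorphism
    Δ = record
      { relation   = λ u v → isYes (em {P = R u v})
      ; respects   = λ e f r → let (P , p , q) = toWitness r in
                       fromWitness (P , trans (sym e) p , trans (sym f) q)
      ; constants  = λ a → let (b , p , q) = ι a in fromWitness
                       (b ∷ [] , trans (sym p) (sym (evaluate-constant _ y)) , trans (sym q) (sym (evaluate-constant _ z)))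
      ; +-closed   = λ r r′ → let (P , p , q) = toWitness r ; (P′ , p′ , q′) = toWitness r′ in
                       fromWitness (P F[X].+ₚ P′ , trans (+-cong p p′) (sum≈ j₁-hom P P′ y)
                                                 , trans (+-cong q q′) (sum≈ j₂-hom P P′ z))
      ; *-closed   = λ r r′ → let (P , p , q) = toWitness r ; (P′ , p′ , q′) = toWitness r′ in
                       fromWitness (P F[X].*ₚ P′ , trans (*-cong p p′) (product≈ j₁-hom P P′ y)
                                                 , trans (*-cong q q′) (product≈ j₂-hom P P′ z))
      ; functional = λ r e → let (P , p , q) = toWitness r in trans q (y↝z P (trans (sym p) e))
      }

  -- The subextension on which Γ is defined, encoded by related pairs with equality of first
  -- components. The two projections are then its two embeddings into Ω.
  module Domain (Γ : PartialIsomorphism) where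
    open PartialIsomorphism Γ hiding (_∼_)

    private
      D : Set _
      D = ∃[ x ] ∃[ y ] _∼_ Γ x y

      domainRing : CommutativeRing _ _
      domainRing = record
        { Carrier = D
        ; _≈_ = λ u v → proj₁ u ≈ proj₁ v
        ; _+_ = λ (x , y , r) (x′ , y′ , r′) → x + x′ , y + y′ , +-closed r r′
        ; _*_ = λ (x , y , r) (x′ , y′ , r′) → x * x′ , y * y′ , *-closed r r′
        ; -_  = λ (x , y , r) → - x , - y , negated r
        ; 0#  = 0# , 0# , zero∼
        ; 1#  = 1# , 1# , one∼
        ; isCommutativeRing = RingMonomorphism.isCommutativeRing monomorphism isCommutativeRing
        }
        where
        monomorphism : IsRingMonomorphism _ rawRing proj₁
        monomorphism = record
          { isRingHomomorphism = record
            { isSemiringHomomorphism = record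
              { isNearSemiringHomomorphism = record
                { +-isMonoidHomomorphism = record
                  { isMagmaHomomorphism = record
                    { isRelHomomorphism = record { cong = id } ; homo = λ _ _ → refl }
                  ; ε-homo = refl
                  }
                ; *-homo = λ _ _ → refl
                }
              ; 1#-homo = refl
              }
            ; -‿homo = λ _ → refl
            }
          ; injective = id
          }

    domain : Field _ _
    domain = record
      { commutativeRing = domainRing
      ; 1≉0     = 1≉0
      ; inverse = λ (x , y , r) x≉0 → let (x′ , y′ , r′ , e) = invertible r x≉0 in
                  (x′ , y′ , r′) , trans (*-comm x′ x) e , e
      }

    private module D = Field domain

    first-hom : IsRingHomomorphism D.rawRing rawRing proj₁
    first-hom = isRingHomomorphism D.ring ring proj₁ id (λ _ _ → refl) (λ _ _ → refl) refl

    second-hom : IsRingHomomorphism D.rawRing rawRing (λ u → proj₁ (proj₂ u))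
    second-hom = isRingHomomorphism D.ring ring (λ u → proj₁ (proj₂ u))
      (λ {u} {v} → deterministic (proj₂ (proj₂ u)) (proj₂ (proj₂ v))) (λ _ _ → refl) (λ _ _ → refl) refl

  -- A separable polynomial of y over K, read over the domain of Γ, has the same image under both
  -- embeddings, since Γ fixes K. So the image needed for finding z is separable too.
  extend : ∀ Γ y → ∃[ z ] ∃[ Δ ] Γ ≼ Δ × _∼_ Δ y z
  extend Γ y = z , proj₁ adjoined , (λ u v r → proj₂ (proj₂ adjoined) (u , v , r)) , proj₁ (proj₂ adjoined)
    where
    open Domain Γ
    open Specialisation domain first-hom second-hom
    p = proj₁ (separable y)
    ι : K.Carrier → Field.Carrier domain
    ι a = embed a , embed a , PartialIsomorphism.constants Γ a
    annihilates : evaluate (map proj₁ (map ι p)) y ≈ 0#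
    annihilates = ≡.subst (λ q → evaluate q y ≈ 0#) (map-∘ {g = proj₁} {f = ι} p) (proj₂ (proj₂ (separable y)))
    separable-second : Separable (map (λ u → proj₁ (proj₂ u)) (map ι p))
    separable-second = ≡.subst Separable (map-∘ {g = λ u → proj₁ (proj₂ u)} {f = ι} p)
      (MapPolynomial.separable-map {A = K.commutativeRing} embed-isRingHomomorphism (proj₁ (proj₂ (separable y))))
    specialised : ∃[ z ] y ↝ z
    specialised = specialise (map ι p) y annihilates separable-second
    z = proj₁ specialised
    adjoined : ∃[ Δ ] _∼_ Δ y z × (∀ u → _∼_ Δ (proj₁ u) (proj₁ (proj₂ u)))
    adjoined = adjoin domain first-hom second-hom (λ a → ι a , refl , refl) (proj₂ specialised)

  extensions : PartialIsomorphism → Poset _ _ _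
  extensions Γ₀ = record
    { Carrier = ∃[ Γ ] Γ₀ ≼ Γ
    ; _≈_ = λ (Γ , _) (Δ , _) → Γ ≼ Δ × Δ ≼ Γ
    ; _≤_ = λ (Γ , _) (Δ , _) → Γ ≼ Δ
    ; isPartialOrder = record
      { isPreorder = record
        { isEquivalence = record
          { refl  = (λ _ _ r → r) , (λ _ _ r → r)
          ; sym   = λ (p , q) → q , p
          ; trans = λ (p , q) (p′ , q′) → (λ x y r → p′ x y (p x y r)) , (λ x y r → q x y (q′ x y r))
          }
        ; reflexive = proj₁
        ; trans     = λ p q x y r → q x y (p x y r)
        }
      ; antisym = _,_
      }
    }

  module _ (Γ₀ : PartialIsomorphism) where

    private
      E = ∃[ Γ ] Γ₀ ≼ Γ
      module Γ = PartialIsomorphism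

      module Union (C : Pred E (k ⊔ s ⊔ sℓ))
        (chain : ∀ {Γ Δ} → Γ ∈ᵤ C → Δ ∈ᵤ C → proj₁ Γ ≼ proj₁ Δ ⊎ proj₁ Δ ≼ proj₁ Γ)
        (Γ₁ : E) (Γ₁∈C : Γ₁ ∈ᵤ C) where

        R : Carrier → Carrier → Set _
        R x y = ∃[ Γ ] Γ ∈ᵤ C × _∼_ (proj₁ Γ) x y

        together : ∀ {x y x′ y′} → R x y → R x′ y′ →
                   ∃[ Γ ] Γ ∈ᵤ C × _∼_ (proj₁ Γ) x y × _∼_ (proj₁ Γ) x′ y′
        together (Γ , i , r) (Γ′ , i′ , r′) with chain i i′
        ... | inj₁ Γ≼Γ′ = Γ′ , i′ , Γ≼Γ′ _ _ r , r′
        ... | inj₂ Γ′≼Γ = Γ , i , r , Γ′≼Γ _ _ r′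

        union : PartialIsomorphism
        union = record
          { relation   = λ x y → isYes (em {P = R x y})
          ; respects   = λ e f r → let (Γ , i , r) = toWitness r in
                           fromWitness (Γ , i , Γ.respects (proj₁ Γ) e f r)
          ; constants  = λ a → fromWitness (Γ₁ , Γ₁∈C , Γ.constants (proj₁ Γ₁) a)
          ; +-closed   = λ r r′ → let (Γ , i , r , r′) = together (toWitness r) (toWitness r′) in
                           fromWitness (Γ , i , Γ.+-closed (proj₁ Γ) r r′)
          ; *-closed   = λ r r′ → let (Γ , i , r , r′) = together (toWitness r) (toWitness r′) in
                           fromWitness (Γ , i , Γ.*-closed (proj₁ Γ) r r′)
          ; functional = λ r → let (Γ , i , r) = toWitness r in Γ.functional (proj₁ Γ) r
          }

        bound : E
        bound = union , λ x y r → fromWitness (Γ₁ , Γ₁∈C , proj₂ Γ₁ x y r)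

    maximal : ∃[ Γ ] Γ₀ ≼ Γ × (∀ Δ → Γ ≼ Δ → Δ ≼ Γ)
    maximal with zorn (extensions Γ₀) upper-bound
      where
      upper-bound : ∀ (C : Pred E (k ⊔ s ⊔ sℓ)) →
        (∀ {Γ Δ} → Γ ∈ᵤ C → Δ ∈ᵤ C → proj₁ Γ ≼ proj₁ Δ ⊎ proj₁ Δ ≼ proj₁ Γ) →
        ∃[ u ] (∀ {Γ} → Γ ∈ᵤ C → proj₁ Γ ≼ proj₁ {B = λ Γ → Γ₀ ≼ Γ} u)
      upper-bound C chain with em {P = ∃[ Γ ] Γ ∈ᵤ C}
      -- The union of an empty chain would not contain the constants, so `Γ₀` itself serves as the
      -- bound.
      ... | no  empty        = (Γ₀ , λ _ _ r → r) , λ i → ⊥-elim (empty (_ , i))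
      ... | yes (Γ₁ , Γ₁∈C) = Union.bound C chain Γ₁ Γ₁∈C
                            , λ {Γ} i x y r → fromWitness (Γ , i , r)
    ... | (Γ , Γ₀≼Γ) , top = Γ , Γ₀≼Γ , λ Δ Γ≼Δ → top (Δ , λ x y r → Γ≼Δ x y (Γ₀≼Γ x y r)) Γ≼Δ

  module _ (Γ : PartialIsomorphism) (top : ∀ Δ → Γ ≼ Δ → Δ ≼ Γ) where

    open PartialIsomorphism Γ hiding (_∼_)

    private
      total : ∀ x → ∃[ y ] _∼_ Γ x y
      total x = let (y , Δ , Γ≼Δ , r) = extend Γ x in y , top Δ Γ≼Δ x y r

      onto : ∀ y → ∃[ x ] _∼_ Γ x y
      onto y = let (x , Δ , Γ≼Δ , r) = extend (flip Γ) y in x , top (flip Δ) (λ u v → Γ≼Δ v u) x y r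

      image : Carrier → Carrier
      image x = proj₁ (total x)

      spec : ∀ x → _∼_ Γ x (image x)
      spec x = proj₂ (total x)

      image-hom : IsRingHomomorphism rawRing rawRing image
      image-hom = isRingHomomorphism ring ring image
        (λ {x} {y} → deterministic (spec x) (spec y))
        (λ x y → deterministic (spec (x + y)) (+-closed (spec x) (spec y)) refl)
        (λ x y → deterministic (spec (x * y)) (*-closed (spec x) (spec y)) refl)
        (deterministic (spec 1#) one∼ refl)

    maximal-automorphism : Automorphism
    maximal-automorphism = record
      { ⟦_⟧ = image
      ; isRingIsomorphism = record
        { isRingMonomorphism = record
          { isRingHomomorphism = image-hom
          ; injective = λ {x} {y} → PartialIsomorphism.deterministic (flip Γ) (spec x) (spec y)
          }
        ; surjective = λ y → proj₁ (onto y) , λ {x} e → deterministic (spec x) (proj₂ (onto y)) e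
        }
      ; fixes = λ a → deterministic (spec (embed a)) (constants a) refl
      }

    maximal-automorphism-extends : ∀ {x y} → _∼_ Γ x y → ⟦ maximal-automorphism ⟧ x ≈ y
    maximal-automorphism-extends {x} r = deterministic (spec x) r refl

  extend-automorphism : ∀ Γ₀ → ∃[ g ] (∀ x y → _∼_ Γ₀ x y → ⟦ g ⟧ x ≈ y)
  extend-automorphism Γ₀ = from (maximal Γ₀)
    where
    from : ∃[ Γ ] Γ₀ ≼ Γ × (∀ Δ → Γ ≼ Δ → Δ ≼ Γ) → ∃[ g ] (∀ x y → _∼_ Γ₀ x y → ⟦ g ⟧ x ≈ y)
    from (Γ , Γ₀≼Γ , top) = maximal-automorphism Γ top
                          , λ x y r → maximal-automorphism-extends Γ top (Γ₀≼Γ x y r)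

  fixed⇒embedded : ∀ x → (∀ g → ⟦ g ⟧ x ≈ x) → ∃[ a ] embed a ≈ x
  fixed⇒embedded x fixed with em {P = ∃[ a ] embed a ≈ x}
  ... | yes x∈K = x∈K
  ... | no  x∉K = ⊥-elim (moved (conjugate x x∉K))
    where
    moved-by : ∀ {z} → z ≉ x → ∀ Γ₀ → _∼_ Γ₀ x z → ∃[ g ] (∀ u v → _∼_ Γ₀ u v → ⟦ g ⟧ u ≈ v) → ⊥
    moved-by {z} z≉x Γ₀ x∼z (g , extends) = z≉x (trans (sym (extends x z x∼z)) (fixed g))

    moved-within : ∀ {z} → z ≉ x → ∃[ Γ₀ ] _∼_ Γ₀ x z × (∀ a → _∼_ Γ₀ (embed a) (embed a)) → ⊥
    moved-within z≉x (Γ₀ , x∼z , _) = moved-by z≉x Γ₀ x∼z (extend-automorphism Γ₀)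

    moved : ∃[ z ] z ≉ x × x Base.↝ z → ⊥
    moved (z , z≉x , x↝z) = moved-within z≉x
      (adjoin K embed-isRingHomomorphism embed-isRingHomomorphism (λ a → a , refl , refl) x↝z)

-- Finite sums and their reindexing

module Summation {r ℓ} (R : CommutativeRing r ℓ) where

  open CommutativeRing R hiding (zero)
  open CommutativeSemigroupProperties +-commutativeSemigroup using (interchange; x∙yz≈y∙xz)
  open SetoidReasoning setoid

  ∑ : ∀ {x} {X : Set x} → (X → Carrier) → List X → Carrier
  ∑ f []       = 0#
  ∑ f (x ∷ xs) = f x + ∑ f xs

  module _ {x} {X : Set x} where

    ∑-cong : ∀ {f g : X → Carrier} → (∀ x → f x ≈ g x) → ∀ xs → ∑ f xs ≈ ∑ g xs
    ∑-cong e []       = refl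
    ∑-cong e (x ∷ xs) = +-cong (e x) (∑-cong e xs)

    ∑-linear : ∀ a (f g : X → Carrier) xs → ∑ (λ x → f x + a * g x) xs ≈ ∑ f xs + a * ∑ g xs
    ∑-linear a f g []       = sym (trans (+-congˡ (zeroʳ a)) (+-identityʳ 0#))
    ∑-linear a f g (x ∷ xs) = begin
      f x + a * g x + ∑ (λ x → f x + a * g x) xs    ≈⟨ +-congˡ (∑-linear a f g xs) ⟩
      f x + a * g x + (∑ f xs + a * ∑ g xs)         ≈⟨ interchange _ _ _ _ ⟩
      f x + ∑ f xs + (a * g x + a * ∑ g xs)         ≈⟨ +-congˡ (distribˡ a _ _) ⟨
      f x + ∑ f xs + a * (g x + ∑ g xs)             ∎

    ∑-hom : ∀ {j} → IsRingHomomorphism rawRing rawRing j →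
            ∀ (f : X → Carrier) xs → j (∑ f xs) ≈ ∑ (λ x → j (f x)) xs
    ∑-hom j-hom f []       = IsRingHomomorphism.0#-homo j-hom
    ∑-hom j-hom f (x ∷ xs) = trans (IsRingHomomorphism.+-homo j-hom _ _) (+-congˡ (∑-hom j-hom f xs))

    ∑-zero : ∀ {f : X → Carrier} {xs} → All (λ x → f x ≈ 0#) xs → ∑ f xs ≈ 0#
    ∑-zero []       = refl
    ∑-zero (e ∷ es) = trans (+-cong e (∑-zero es)) (+-identityʳ 0#)

  ∑-map : ∀ {x y} {X : Set x} {Y : Set y} (f : Y → Carrier) (g : X → Y) xs →
          ∑ f (map g xs) ≡.≡ ∑ (λ x → f (g x)) xs
  ∑-map f g []       = ≡.refl
  ∑-map f g (x ∷ xs) = ≡.cong (λ y → f (g x) + y) (∑-map f g xs)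

  module _ {x xℓ} (S : Setoid x xℓ) where

    private module S = Setoid S
    open Membership S using (_∈_)
    open Unique S using (Unique)

    private
      remove : ∀ {x xs} → x ∈ xs → List S.Carrier
      remove {xs = _ ∷ xs} (here _)  = xs
      remove {xs = y ∷ _}  (there i) = y ∷ remove i

      remove-All : ∀ {p} {P : S.Carrier → Set p} {x xs} (i : x ∈ xs) → All P xs → All P (remove i)
      remove-All (here _)  (_ ∷ ps) = ps
      remove-All (there i) (p ∷ ps) = p ∷ remove-All i ps

      remove-unique : ∀ {x xs} (i : x ∈ xs) → Unique xs → Unique (remove i)
      remove-unique (here _)  (_ ∷ u) = u
      remove-unique (there i) (p ∷ u) = remove-All i p ∷ remove-unique i u

      remove-∈ : ∀ {x y xs} (i : x ∈ xs) → y ∈ xs → ¬ y S.≈ x → y ∈ remove i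
      remove-∈ (here x≈z) (here y≈z) y≉x = ⊥-elim (y≉x (S.trans y≈z (S.sym x≈z)))
      remove-∈ (here x≈z) (there j)  y≉x = j
      remove-∈ (there i)  (here y≈z) y≉x = here y≈z
      remove-∈ (there i)  (there j)  y≉x = there (remove-∈ i j y≉x)

      ∈-remove : ∀ {x y xs} (i : x ∈ xs) → y ∈ remove i → y ∈ xs
      ∈-remove (here _)  j         = there j
      ∈-remove (there i) (here e)  = here e
      ∈-remove (there i) (there j) = there (∈-remove i j)

      All-∈ : ∀ {p} {P : S.Carrier → Set p} → (∀ {x y} → x S.≈ y → P y → P x) →
              ∀ {x xs} → All P xs → x ∈ xs → P x
      All-∈ resp (p ∷ ps) (here e)  = resp e p
      All-∈ resp (p ∷ ps) (there i) = All-∈ resp ps i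

      remove-≉ : ∀ {x y xs} (i : x ∈ xs) → Unique xs → y ∈ remove i → ¬ y S.≈ x
      remove-≉ (here e)  (p ∷ u) j        y≈x = All-∈ (λ e ne z≈ → ne (S.trans z≈ e)) p j (S.sym (S.trans y≈x e))
      remove-≉ (there i) (p ∷ u) (here e) y≈x = All-∈ (λ e ne z≈ → ne (S.trans z≈ e)) p i (S.trans (S.sym e) y≈x)
      remove-≉ (there i) (p ∷ u) (there j) y≈x = remove-≉ i u j y≈x

      ∑-remove : ∀ {f} → (∀ {x y} → x S.≈ y → f x ≈ f y) →
                 ∀ {x xs} (i : x ∈ xs) → ∑ f xs ≈ f x + ∑ f (remove i)
      ∑-remove resp (here e)  = +-congʳ (resp (S.sym e))
      ∑-remove resp (there i) = trans (+-congˡ (∑-remove resp i)) (x∙yz≈y∙xz _ _ _)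

    -- Duplicate-free lists with the same members are permutations of each other up to the setoid
    -- equality. The partner of the head is removed from the second list, and uniqueness on both
    -- sides keeps the remaining members equal.
    ∑-reindex : ∀ {f} → (∀ {x y} → x S.≈ y → f x ≈ f y) → ∀ {xs ys} → Unique xs → Unique ys →
                (∀ {x} → x ∈ xs → x ∈ ys) → (∀ {y} → y ∈ ys → y ∈ xs) → ∑ f xs ≈ ∑ f ys
    ∑-reindex resp {[]} {[]}    _ _ _ _    = refl
    ∑-reindex resp {[]} {y ∷ _} _ _ _ back with () ← back (here S.refl)
    ∑-reindex {f} resp {x ∷ xs} {ys} (p ∷ u) v to back = begin
      f x + ∑ f xs           ≈⟨ +-congˡ (∑-reindex resp u (remove-unique i v) to′ back′) ⟩
      f x + ∑ f (remove i)   ≈⟨ ∑-remove resp i ⟨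
      ∑ f ys                 ∎
      where
      i = to (here S.refl)
      to′ : ∀ {y} → y ∈ xs → y ∈ remove i
      to′ j = remove-∈ i (to (there j)) λ y≈x →
        All-∈ (λ e ne z≈ → ne (S.trans z≈ e)) p j (S.sym y≈x)
      back′ : ∀ {y} → y ∈ remove i → y ∈ xs
      back′ {y} j with back (∈-remove i j)
      ... | here y≈x = ⊥-elim (remove-≉ i v j y≈x)
      ... | there k  = k

-- Independence of automorphisms and Hilbert's theorem 90

module Hilbert90 (classical : Classical) {k kℓ s sℓ} {K : Field k kℓ} (Ω : SeparableClosure K s sℓ) where

  open Classical classical
  private
    module K = Field K
    module G = Group (Galois.absoluteGaloisGroup Ω)
  open SeparableClosure Ω hiding (zero)
  open Polynomial commutativeRing
  open PolynomialSemiring commutativeRing using (separable-≉0)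
  open FieldProperties closure
  open Galois Ω
  open Automorphism using (⟦_⟧)
  open Summation commutativeRing
  open RingProperties ring using (x∙y⁻¹≈ε⇒x≈y)
  open SetoidReasoning setoid

  private
    module Aut = Automorphism

    g-hom : ∀ g → IsRingHomomorphism rawRing rawRing ⟦ g ⟧
    g-hom g = Aut.isRingHomomorphism g

    evaluate-fixed : ∀ g p x → ⟦ g ⟧ (evaluate (map embed p) x) ≈ evaluate (map embed p) (⟦ g ⟧ x)
    evaluate-fixed g []      x = Aut.0#-homo g
    evaluate-fixed g (a ∷ p) x = trans (Aut.+-homo g _ _) (+-cong (Aut.fixes g a)
      (trans (Aut.*-homo g _ _) (*-congˡ (evaluate-fixed g p x))))

  -- Automorphisms permute the roots of a polynomial over K.
  finitely-many-conjugates : ∀ x → ∃[ R ] (∀ g → Any (⟦ g ⟧ x ≈_) R)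
  finitely-many-conjugates x = from (separable x)
    where
    from : (∃[ p ] Polynomial.Separable K.commutativeRing p × evaluate (map embed p) x ≈ 0#) → _
    from (p , sep , e) =
      let (R , roots) = FieldDivision.finitely-many-roots classical closure (map embed p)
                          (separable-≉0 1≉0 (MapPolynomial.separable-map
                            {A = K.commutativeRing} embed-isRingHomomorphism sep))
      in R , λ g → roots (⟦ g ⟧ x) (trans (sym (evaluate-fixed g p x)) (trans (Aut.⟦⟧-cong g e) (Aut.0#-homo g)))

  -- A class of automorphisms for this relation is an embedding of K(S) into Ω, so the quotient is
  -- the finite object over which the sums below are taken.
  agreement : List Carrier → DecSetoid _ _
  agreement S = record
    { Carrier = Automorphism
    ; _≈_ = AgreeOn S
    ; isDecEquivalence = record
      { isEquivalence = record
        { refl  = All.universal (λ _ → refl) S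
        ; sym   = All.map sym
        ; trans = λ p q → All.zipWith (λ (a , b) → trans a b) (p , q)
        }
      ; _≟_ = λ _ _ → em
      }
    }

  private
    module _ (S : List Carrier) where
      open DecSetoid (agreement S) public using () renaming (setoid to agreementSetoid)
    module ~ {S : List Carrier} = DecSetoid (agreement S)

  Complete : List Carrier → List Automorphism → Set _
  Complete S L = ∀ g → Any (AgreeOn S g) L

  Distinct : List Carrier → List Automorphism → Set _
  Distinct S = Unique.Unique (agreementSetoid S)

  -- An automorphism is determined on `x ∷ S` by its class on S and by its value at x, and each
  -- ranges over a finite list.
  complete : ∀ S → ∃[ L ] Complete S L
  complete []      = G.ε ∷ [] , λ _ → here []
  complete (x ∷ S) =
    let (L , agree) = complete S
        (R , roots) = finitely-many-conjugates x
    in cartesianProductWith pick L R , λ g →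
       Any.cartesianProductWith⁺ pick {R = AgreeOn (x ∷ S) g} (pick-agrees g) (agree g) (roots g)
    where
    pick : Automorphism → Carrier → Automorphism
    pick γ r with em {P = ∃[ g ] ⟦ g ⟧ x ≈ r × AgreeOn S g γ}
    ... | yes (g , _) = g
    -- An arbitrary filler: no automorphism realises this combination, so completeness never appeals
    -- to it.
    ... | no  _       = γ
    pick-agrees : ∀ g {γ r} → AgreeOn S g γ → ⟦ g ⟧ x ≈ r → AgreeOn (x ∷ S) g (pick γ r)
    pick-agrees g {γ} {r} p e with em {P = ∃[ g ] ⟦ g ⟧ x ≈ r × AgreeOn S g γ}
    ... | yes (h , f , q) = trans e (sym f) ∷ ~.trans {S} {g} {γ} {h} p (~.sym {S} {h} {γ} q)
    ... | no  none        = ⊥-elim (none (g , e , p))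

  representatives : ∀ S → ∃[ L ] Complete S L × Distinct S L
  representatives S =
    let (L , agree) = complete S in
    deduplicate (DecSetoid._≟_ (agreement S)) L
    , (λ g → ∈-deduplicate⁺ (agreementSetoid S) (DecSetoid._≟_ (agreement S))
               (λ {γ} {h} {h′} p q → ~.trans {S} {γ} {h} {h′} q (~.sym {S} {h′} {h} p))
               {L} {g} (agree g))
    , deduplicate-! (agreement S) L

  -- Stands in for membership in K(S): the value of an automorphism at x depends only on its class.
  Determined : List Carrier → Carrier → Set _
  Determined S x = ∀ g h → AgreeOn S g h → ⟦ g ⟧ x ≈ ⟦ h ⟧ x

  determined-* : ∀ {S x y} → Determined S x → Determined S y → Determined S (x * y)
  determined-* p q g h e = trans (Aut.*-homo g _ _) (trans (*-cong (p g h e) (q g h e)) (sym (Aut.*-homo h _ _)))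

  determined-member : ∀ S → All (Determined S) S
  determined-member S = All.tabulate λ i g h e → All.lookup e i

  -- Dedekind's argument: the relation at m x minus γ₁(m) times the relation at x is a
  -- relation among the remaining automorphisms.

  independent : ∀ S L → Distinct S L → (c : Automorphism → Carrier) →
    (∀ x → Determined S x → ∑ (λ γ → c γ * ⟦ γ ⟧ x) L ≈ 0#) → All (λ γ → c γ ≈ 0#) L
  independent S []       _       c vanish = []
  independent S (γ₁ ∷ L) (p ∷ u) c vanish = c[γ₁]≈0 ∷ rest
    where
    c′ : Carrier → Automorphism → Carrier
    c′ m γ = c γ * (⟦ γ ⟧ m - ⟦ γ₁ ⟧ m)

    vanish′ : ∀ {m} → Determined S m → ∀ x → Determined S x → ∑ (λ γ → c′ m γ * ⟦ γ ⟧ x) L ≈ 0#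
    vanish′ {m} dm x dx = begin
      ∑ (λ γ → c′ m γ * ⟦ γ ⟧ x) L
        ≈⟨ +-identityˡ _ ⟨
      0# + ∑ (λ γ → c′ m γ * ⟦ γ ⟧ x) L
        ≈⟨ +-congʳ (trans (*-congʳ (trans (*-congˡ (-‿inverseʳ _)) (zeroʳ _))) (zeroˡ _)) ⟨
      ∑ (λ γ → c′ m γ * ⟦ γ ⟧ x) (γ₁ ∷ L)
        ≈⟨ ∑-cong expand (γ₁ ∷ L) ⟩
      ∑ (λ γ → c γ * ⟦ γ ⟧ (m * x) + - ⟦ γ₁ ⟧ m * (c γ * ⟦ γ ⟧ x)) (γ₁ ∷ L)
        ≈⟨ ∑-linear (- ⟦ γ₁ ⟧ m) (λ γ → c γ * ⟦ γ ⟧ (m * x)) (λ γ → c γ * ⟦ γ ⟧ x) (γ₁ ∷ L) ⟩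
      ∑ (λ γ → c γ * ⟦ γ ⟧ (m * x)) (γ₁ ∷ L) + - ⟦ γ₁ ⟧ m * ∑ (λ γ → c γ * ⟦ γ ⟧ x) (γ₁ ∷ L)
        ≈⟨ +-cong (vanish (m * x) (determined-* {S} {m} {x} dm dx)) (trans (*-congˡ (vanish x dx)) (zeroʳ _)) ⟩
      0# + 0#
        ≈⟨ +-identityʳ 0# ⟩
      0# ∎
      where
      open IntegerCoefficients commutativeRing using (solve; _:*_; _:+_; _:-_; :-_; _:=_)
      expand : ∀ γ → c′ m γ * ⟦ γ ⟧ x ≈ c γ * ⟦ γ ⟧ (m * x) + - ⟦ γ₁ ⟧ m * (c γ * ⟦ γ ⟧ x)
      expand γ = trans
        (solve 4 (λ c a b x → (c :* (a :- b)) :* x := c :* (a :* x) :+ :- b :* (c :* x))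
          refl (c γ) (⟦ γ ⟧ m) (⟦ γ₁ ⟧ m) (⟦ γ ⟧ x))
        (+-congʳ (*-congˡ (sym (Aut.*-homo γ m x))))

    vanishing : All (λ m → All (λ γ → c′ m γ ≈ 0#) L) S
    vanishing = All.map (λ {m} d → independent S L u (c′ m) (vanish′ d)) (determined-member S)

    -- If c(γ) were nonzero, it could be cancelled from c(γ)(γ(m) - γ₁(m)) = 0 for every m in S, and
    -- γ would agree with γ₁.
    coefficient≈0 : ∀ {γ} → ¬ AgreeOn S γ₁ γ → All (λ m → c′ m γ ≈ 0#) S → c γ ≈ 0#
    coefficient≈0 {γ} γ₁≁γ es with em {P = c γ ≈ 0#}
    ... | yes e = e
    ... | no ne = ⊥-elim (γ₁≁γ (All.map (λ {m} e → sym (x∙y⁻¹≈ε⇒x≈y _ _ (*-cancel-≉0 ne e))) es))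

    transpose : ∀ {L} → All (λ m → All (λ γ → c′ m γ ≈ 0#) L) S → All (λ γ → All (λ m → c′ m γ ≈ 0#) S) L
    transpose {[]}    _  = []
    transpose {γ ∷ L} es = All.map All.head es ∷ transpose (All.map All.tail es)

    rest : All (λ γ → c γ ≈ 0#) L
    rest = All.zipWith (λ (ne , es) → coefficient≈0 ne es) (p , transpose vanishing)

    c[γ₁]≈0 : c γ₁ ≈ 0#
    c[γ₁]≈0 = begin
      c γ₁                                          ≈⟨ trans (*-congˡ (Aut.1#-homo γ₁)) (*-identityʳ _) ⟨
      c γ₁ * ⟦ γ₁ ⟧ 1#                              ≈⟨ +-identityʳ _ ⟨
      c γ₁ * ⟦ γ₁ ⟧ 1# + 0#                         ≈⟨ +-congˡ (∑-zero (All.map (λ e → trans (*-congʳ e) (zeroˡ _)) rest)) ⟨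
      ∑ (λ γ → c γ * ⟦ γ ⟧ 1#) (γ₁ ∷ L)             ≈⟨ vanish 1# (λ g h _ → trans (Aut.1#-homo g) (sym (Aut.1#-homo h))) ⟩
      0#                                            ∎

  -- t is the sum of the c(γ) γ(x) over representatives γ, with x chosen by independence so that the
  -- sum is nonzero. The weights may vanish at some γ and the transformation rule is asked of one h
  -- at a time, so the statement also covers a subgroup, through weights extended by zero.
  hilbert90 : ∀ S (c : Automorphism → Carrier) → (∀ g h → AgreeOn S g h → c g ≈ c h) → c G.ε ≉ 0# →
    ∃[ t ] t ≉ 0# × (∀ h a → (∀ γ → ⟦ h ⟧ (c γ) ≈ a * c (h G.∙ γ)) → ⟦ h ⟧ t ≈ a * t)
  hilbert90 S c c-resp c≉0 = from (representatives S)
    where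
    module _ (L : List Automorphism) (agree : Complete S L) (distinct : Distinct S L) where

      nonzero : ∃[ x ] Determined S x × ∑ (λ γ → c γ * ⟦ γ ⟧ x) L ≉ 0#
      nonzero with em {P = ∃[ x ] Determined S x × ∑ (λ γ → c γ * ⟦ γ ⟧ x) L ≉ 0#}
      ... | yes found = found
      ... | no  none  = ⊥-elim (contradict (agree G.ε) (independent S L distinct c vanish))
        where
        vanish : ∀ x → Determined S x → ∑ (λ γ → c γ * ⟦ γ ⟧ x) L ≈ 0#
        vanish x dx with em {P = ∑ (λ γ → c γ * ⟦ γ ⟧ x) L ≈ 0#}
        ... | yes e = e
        ... | no ne = ⊥-elim (none (x , dx , ne))
        contradict : ∀ {L} → Any (AgreeOn S G.ε) L → All (λ γ → c γ ≈ 0#) L → ⊥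
        contradict (here {x = γ} p) (e ∷ _)  = c≉0 (trans (c-resp G.ε γ p) e)
        contradict (there i)        (_ ∷ es) = contradict i es

      module _ (x : Carrier) (dx : Determined S x) where

        t : Carrier
        t = ∑ (λ γ → c γ * ⟦ γ ⟧ x) L

        -- Left translation by h turns a system of representatives into another one: injectivity of
        -- h keeps them distinct, and g is represented by h times the representative of h⁻¹g.
        shift : ∀ h → ∑ (λ γ → c (h G.∙ γ) * ⟦ h G.∙ γ ⟧ x) L ≈ t
        shift h = trans (reflexive (≡.sym (∑-map (λ γ → c γ * ⟦ γ ⟧ x) (h G.∙_) L)))
          (∑-reindex (agreementSetoid S) {f = λ γ → c γ * ⟦ γ ⟧ x}
            (λ {g} {g′} p → *-cong (c-resp g g′ p) (dx g g′ p))
            (AllPairs.map⁺ (AllPairs.map (λ {g} {g′} ne p → ne (All.map (Aut.injective h) p)) distinct)) distinct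
            (λ {g} _ → agree g)
            (λ {g} _ → Any.map⁺ (Any.map (λ {γ} p → All.map (translate g {γ}) p) (agree (h G.⁻¹ G.∙ g)))))
          where
          translate : ∀ g {γ x} → ⟦ h G.⁻¹ G.∙ g ⟧ x ≈ ⟦ γ ⟧ x → ⟦ g ⟧ x ≈ ⟦ h G.∙ γ ⟧ x
          translate g {γ} {x} e = trans (sym (G.inverseʳ h (⟦ g ⟧ x))) (Aut.⟦⟧-cong h e)

        equivariant : ∀ h a → (∀ γ → ⟦ h ⟧ (c γ) ≈ a * c (h G.∙ γ)) → ⟦ h ⟧ t ≈ a * t
        equivariant h a e = begin
          ⟦ h ⟧ t
            ≈⟨ ∑-hom (g-hom h) (λ γ → c γ * ⟦ γ ⟧ x) L ⟩
          ∑ (λ γ → ⟦ h ⟧ (c γ * ⟦ γ ⟧ x)) L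
            ≈⟨ ∑-cong (λ γ → trans (Aut.*-homo h _ _) (trans (*-congʳ (e γ))
                 (trans (*-assoc _ _ _) (sym (+-identityˡ _))))) L ⟩
          ∑ (λ γ → 0# + a * (c (h G.∙ γ) * ⟦ h G.∙ γ ⟧ x)) L
            ≈⟨ ∑-linear a (λ _ → 0#) (λ γ → c (h G.∙ γ) * ⟦ h G.∙ γ ⟧ x) L ⟩
          ∑ (λ _ → 0#) L + a * ∑ (λ γ → c (h G.∙ γ) * ⟦ h G.∙ γ ⟧ x) L
            ≈⟨ +-cong (∑-zero (All.universal (λ _ → refl) L)) (*-congˡ (shift h)) ⟩
          0# + a * t
            ≈⟨ +-identityˡ _ ⟩
          a * t ∎

      result : (∃[ x ] Determined S x × ∑ (λ γ → c γ * ⟦ γ ⟧ x) L ≉ 0#) → _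
      result (x , dx , t≉0) = t x dx , t≉0 , equivariant x dx

    from : (∃[ L ] Complete S L × Distinct S L) → _
    from (L , agree , distinct) = result L agree distinct (nonzero L agree distinct)

-- Signs, square roots and fourth roots of unity

-- Together with `all?`, proves by exhaustion the identities between exponents in ℤ/4 twisted by
-- signs.
allSign? : ∀ {p} {P : Sign → Set p} → (∀ s → Dec (P s)) → Dec (∀ s → P s)
allSign? P? = map′ (λ (p , q) → λ { Sign.+ → p ; Sign.- → q }) (λ f → f Sign.+ , f Sign.-)
  (P? Sign.+ ×-dec P? Sign.-)

signed-+₄ : ∀ s x y → signed s (x +₄ y) ≡ signed s x +₄ signed s y
signed-+₄ = from-yes (allSign? λ s → all? λ x → all? λ y → signed s (x +₄ y) ≟ᶠ (signed s x +₄ signed s y))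

signed-* : ∀ s s′ x → signed (s *ₛ s′) x ≡ signed s (signed s′ x)
signed-* = from-yes (allSign? λ s → allSign? λ s′ → all? λ x → signed (s *ₛ s′) x ≟ᶠ signed s (signed s′ x))

signed-injective : ∀ s x y → signed s x ≡ signed s y → x ≡ y
signed-injective s x y e = ≡.trans (≡.sym (signed² s x)) (≡.trans (≡.cong (signed s) e) (signed² s y))
  where
  signed² : ∀ s x → signed s (signed s x) ≡ x
  signed² = from-yes (allSign? λ s → all? λ x → signed s (signed s x) ≟ᶠ x)

module SquareRoots {s sℓ} (F : Field s sℓ) (2≉0 : CharacteristicNot2 F)
  (closed : ∀ p → Polynomial.Separable (Field.commutativeRing F) p →
            Polynomial.NonConstant (Field.commutativeRing F) p →
            ∃[ x ] Field._≈_ F (Polynomial.evaluate (Field.commutativeRing F) p x) (Field.0# F)) where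

  open Field F hiding (zero)
  open Polynomial commutativeRing
  open IntegerCoefficients commutativeRing using (solve; con; :-_; _:+_; _:*_; _:-_; _:=_)
  open RingProperties ring using (x∙y⁻¹≈ε⇒x≈y)

  -- The Bézout identity −(X² − a)/a + (X/2a) · 2X = 1.

  square-separable : ∀ {a} → a ≉ 0# → Separable (- a ∷ 0# ∷ 1# ∷ [])
  square-separable {a} a≉0 = bezout (proj₁ (inverse a a≉0)) (proj₁ (inverse (1# + 1#) 2≉0))
    (proj₁ (proj₂ (inverse a a≉0))) (proj₁ (proj₂ (inverse (1# + 1#) 2≉0)))
    where
    bezout : ∀ b h → b * a ≈ 1# → h * (1# + 1#) ≈ 1# → Separable (- a ∷ 0# ∷ 1# ∷ [])
    bezout b h p q = - b ∷ [] , 0# ∷ b * h ∷ [] , λ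
      { 0 → trans (solve 2 (λ a b → :- b :* :- a :+ con (+ 0) :+ (con (+ 0) :* (con (+ 0) :+ con (+ 0)) :+ con (+ 0)) := b :* a)
              refl a b) p
      ; 1 → solve 2 (λ b h → :- b :* con (+ 0) :+ (con (+ 0) :* (con (+ 1) :+ (con (+ 1) :+ con (+ 0))) :+ (b :* h :* (con (+ 0) :+ con (+ 0)) :+ con (+ 0))) := con (+ 0))
              refl b h
      ; 2 → trans (solve 2 (λ b h → :- b :* con (+ 1) :+ (con (+ 0) :* con (+ 0) :+ b :* h :* (con (+ 1) :+ (con (+ 1) :+ con (+ 0))))
                     := b :* (h :* (con (+ 1) :+ con (+ 1)) :- con (+ 1))) refl b h)
              (trans (*-congˡ (trans (+-congʳ q) (-‿inverseʳ 1#))) (zeroʳ b))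
      ; 3 → zeroʳ (b * h)
      ; 4 → refl
      ; (suc (suc (suc (suc (suc n))))) → refl }


  square-root : ∀ a → a ≉ 0# → ∃[ r ] r * r ≈ a
  square-root a a≉0 = from (closed _ (square-separable a≉0) (1 , 1≉0))
    where
    from : (∃[ x ] evaluate (- a ∷ 0# ∷ 1# ∷ []) x ≈ 0#) → ∃[ r ] r * r ≈ a
    from (r , e) = r , x∙y⁻¹≈ε⇒x≈y (r * r) a
      (trans (solve 2 (λ a r → r :* r :- a := :- a :+ r :* (con (+ 0) :+ r :* (con (+ 1) :+ r :* con (+ 0)))) refl a r) e)

module FourthRootsOfUnity {s sℓ} (F : Field s sℓ) (2≉0 : CharacteristicNot2 F) (i : Field.Carrier F)
  (i² : Field._≈_ F (Field._*_ F i i) (Field.-_ F (Field.1# F))) where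

  open Field F hiding (zero)
  open Exp commutativeSemiring using (_^_; ^-homo-*; ^-assocʳ; ^-congˡ)
  open RingProperties ring using (-‿involutive; -1*x≈-x; x∙y⁻¹≈ε⇒x≈y)
  open FieldProperties F
  open SetoidReasoning setoid

  private
    ^4 : i ^ 4 ≈ 1#
    ^4 = begin
      i * (i * (i * (i * 1#)))  ≈⟨ *-congˡ (*-congˡ (*-congˡ (*-identityʳ i))) ⟩
      i * (i * (i * i))         ≈⟨ *-assoc i i (i * i) ⟨
      i * i * (i * i)           ≈⟨ *-cong i² i² ⟩
      - 1# * - 1#               ≈⟨ -1*x≈-x (- 1#) ⟩
      - - 1#                    ≈⟨ -‿involutive 1# ⟩
      1#                        ∎

    1^ : ∀ n → 1# ^ n ≈ 1#
    1^ zero    = refl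
    1^ (suc n) = trans (*-identityˡ _) (1^ n)

    i^% : ∀ n → i ^ n ≈ i ^ (n % 4)
    i^% n = begin
      i ^ n                                       ≡⟨ ≡.cong (i ^_) (m≡m%n+[m/n]*n n 4) ⟩
      i ^ (n % 4 ℕ.+ n ℕ./ 4 ℕ.* 4)               ≈⟨ ^-homo-* i (n % 4) _ ⟩
      i ^ (n % 4) * i ^ (n ℕ./ 4 ℕ.* 4)           ≡⟨ ≡.cong (λ m → i ^ (n % 4) * i ^ m) (ℕ.*-comm (n ℕ./ 4) 4) ⟩
      i ^ (n % 4) * i ^ (4 ℕ.* (n ℕ./ 4))         ≈⟨ *-congˡ (^-assocʳ i 4 (n ℕ./ 4)) ⟨
      i ^ (n % 4) * (i ^ 4) ^ (n ℕ./ 4)           ≈⟨ *-congˡ (trans (^-congˡ (n ℕ./ 4) ^4) (1^ (n ℕ./ 4))) ⟩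
      i ^ (n % 4) * 1#                            ≈⟨ *-identityʳ _ ⟩
      i ^ (n % 4)                                 ∎

  abstract

    ζ : Fin 4 → Carrier
    ζ x = i ^ toℕ x

    ζ-+ : ∀ x y → ζ (x +₄ y) ≈ ζ x * ζ y
    ζ-+ x y = begin
      i ^ toℕ (x +₄ y)            ≡⟨ ≡.cong (i ^_) (toℕ-fromℕ< (m%n<n (toℕ x ℕ.+ toℕ y) 4)) ⟩
      i ^ ((toℕ x ℕ.+ toℕ y) % 4) ≈⟨ i^% (toℕ x ℕ.+ toℕ y) ⟨
      i ^ (toℕ x ℕ.+ toℕ y)       ≈⟨ ^-homo-* i (toℕ x) (toℕ y) ⟩
      ζ x * ζ y                   ∎

    ζ^4 : ∀ x → ζ x ^ 4 ≈ 1#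
    ζ^4 x = begin
      (i ^ toℕ x) ^ 4           ≈⟨ ^-assocʳ i (toℕ x) 4 ⟩
      i ^ (toℕ x ℕ.* 4)         ≈⟨ i^% (toℕ x ℕ.* 4) ⟩
      i ^ (toℕ x ℕ.* 4 % 4)     ≡⟨ ≡.cong (i ^_) (m*n%n≡0 (toℕ x) 4) ⟩
      1#                        ∎

    ζ0≈1 : ζ 0F ≈ 1#
    ζ0≈1 = refl

    ζ1≈i : ζ 1F ≈ i
    ζ1≈i = *-identityʳ i

    ζ2≈-1 : ζ 2F ≈ - 1#
    ζ2≈-1 = trans (*-congˡ (*-identityʳ i)) i²

  ζ-neg : ∀ x → ζ (-₄ x) * ζ x ≈ 1#
  ζ-neg x = trans (sym (ζ-+ (-₄ x) x))
    (trans (reflexive (≡.cong ζ (AbelianGroup.inverseˡ ℤ/4 x))) ζ0≈1)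

  ζ≉0 : ∀ x → ζ x ≉ 0#
  ζ≉0 x = unit-≉0 (trans (*-comm _ _) (ζ-neg x))

  -1≉1 : - 1# ≉ 1#
  -1≉1 e = 2≉0 (trans (+-congˡ (sym e)) (-‿inverseʳ 1#))

  private
    -- For odd x the square of i^x is -1, which differs from 1 because the characteristic is not 2.
    ζ≈1 : ∀ x → ζ x ≈ 1# → x ≡ 0F
    ζ≈1 0F e = ≡.refl
    ζ≈1 1F e = ⊥-elim (-1≉1 (begin
      - 1#           ≈⟨ ζ2≈-1 ⟨
      ζ 2F           ≈⟨ ζ-+ 1F 1F ⟩
      ζ 1F * ζ 1F    ≈⟨ trans (*-cong e e) (*-identityʳ 1#) ⟩
      1#             ∎))
    ζ≈1 2F e = ⊥-elim (-1≉1 (trans (sym ζ2≈-1) e))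
    ζ≈1 3F e = ⊥-elim (-1≉1 (begin
      - 1#           ≈⟨ ζ2≈-1 ⟨
      ζ 2F           ≈⟨ ζ-+ 3F 3F ⟩
      ζ 3F * ζ 3F    ≈⟨ trans (*-cong e e) (*-identityʳ 1#) ⟩
      1#             ∎))

  ζ-injective : ∀ x y → ζ x ≈ ζ y → x ≡ y
  ζ-injective x y e = AP.x∙y⁻¹≈ε⇒x≈y x y (ζ≈1 (x +₄ (-₄ y)) (begin
    ζ (x +₄ (-₄ y))   ≈⟨ ζ-+ x (-₄ y) ⟩
    ζ x * ζ (-₄ y)    ≈⟨ trans (*-congʳ e) (*-comm _ _) ⟩
    ζ (-₄ y) * ζ y    ≈⟨ ζ-neg y ⟩
    1#                ∎))
    where
    module AP = GroupProperties (AbelianGroup.group ℤ/4)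

  module _ (em : ExcludedMiddle sℓ) where

    open IntegerCoefficients commutativeRing using (solve; :-_; _:*_; _:-_; _:=_; _:^_)

    private
      zero-product : ∀ {x y} → x * y ≈ 0# → x ≈ 0# ⊎ y ≈ 0#
      zero-product {x} {y} e with em {P = x ≈ 0#}
      ... | yes x≈0 = inj₁ x≈0
      ... | no  x≉0 = inj₂ (*-cancel-≉0 x≉0 e)

      as-power : ∀ {x y z} k → z ≈ ζ k → x - z * y ≈ 0# → ∃[ k ] x ≈ ζ k * y
      as-power {x} {y} {z} k e f = k , trans (x∙y⁻¹≈ε⇒x≈y x (z * y) f) (*-congʳ e)

      ζ3≈-i : - i ≈ ζ 3F
      ζ3≈-i = trans (sym (-1*x≈-x i)) (trans (*-comm _ _)
        (trans (*-cong (sym ζ1≈i) (sym ζ2≈-1)) (sym (ζ-+ 1F 2F))))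

    -- From the factorisation x⁴ - y⁴ = (x - y)(x + y)(x - iy)(x + iy).
    fourth-roots : ∀ {x y} → x ^ 4 ≈ y ^ 4 → ∃[ k ] x ≈ ζ k * y
    fourth-roots {x} {y} e = from (zero-product (begin
        (x - 1# * y) * ((x - - 1# * y) * ((x - i * y) * (x - - i * y)))
          ≈⟨ *-cong (+-congˡ (-‿cong (*-identityˡ y))) (*-cong (+-congˡ (-‿cong (-1*x≈-x y)))
               (solve 3 (λ x y i → (x :- i :* y) :* (x :- :- i :* y) := x :* x :- (i :* i) :* (y :* y)) refl x y i)) ⟩
        (x - y) * ((x - - y) * (x * x - i * i * (y * y)))
          ≈⟨ *-congˡ (*-congˡ (+-congˡ (-‿cong (trans (*-congʳ i²) (-1*x≈-x _))))) ⟩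
        (x - y) * ((x - - y) * (x * x - - (y * y)))
          ≈⟨ solve 2 (λ x y → (x :- y) :* ((x :- :- y) :* (x :* x :- :- (y :* y))) := x :^ 4 :- y :^ 4) refl x y ⟩
        x ^ 4 - y ^ 4
          ≈⟨ trans (+-congʳ e) (-‿inverseʳ _) ⟩
        0# ∎))
      where
      from : x - 1# * y ≈ 0# ⊎ (x - - 1# * y) * ((x - i * y) * (x - - i * y)) ≈ 0# → ∃[ k ] x ≈ ζ k * y
      from (inj₁ f) = as-power 0F (sym ζ0≈1) f
      from (inj₂ f) with zero-product f
      ... | inj₁ f = as-power 2F (sym ζ2≈-1) f
      ... | inj₂ f with zero-product f
      ...   | inj₁ f = as-power 1F (sym ζ1≈i) f
      ...   | inj₂ f = as-power 3F ζ3≈-i f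

-- Three quadratic characters, the two places of K[√-D], and descent

module Setting (classical : Classical) {k kℓ s sℓ} {K : Field k kℓ} (2≉0 : CharacteristicNot2 K)
  {D : Field.Carrier K} (D≉0 : Field._≉_ K D (Field.0# K))
  (Ω : SeparableClosure K s sℓ) (√D : SeparableClosure.Carrier Ω)
  (√D² : SeparableClosure._≈_ Ω (SeparableClosure._*_ Ω √D √D) (SeparableClosure.embed Ω D))
  (i : SeparableClosure.Carrier Ω)
  (i² : SeparableClosure._≈_ Ω (SeparableClosure._*_ Ω i i) (SeparableClosure.-_ Ω (SeparableClosure.1# Ω))) where

  open Classical classical
  open SeparableClosure Ω hiding (zero)
  open Galois Ω
  open Automorphism using (⟦_⟧)
  open RingProperties ring using (-1*x≈-x; x∙y⁻¹≈ε⇒x≈y; -0#≈0#; -‿involutive)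
  open FieldProperties closure
  open IntegerCoefficients commutativeRing using (solve; con; :-_; _:+_; _:*_; _:-_; _:=_; _:^_)
  open Exp commutativeSemiring using (_^_; ^-congˡ; ^-distrib-*)
  open CommutativeSemigroupProperties *-commutativeSemigroup using (interchange; x∙yz≈y∙xz)
  open SetoidReasoning setoid
  open NormPairs K D using (NormPair; K[√-D]; module Quadratic) renaming (_∼_ to _∼ᴾ_)
  open Quadratic using (norm)
  private
    module K where
      open Field K public
      open Exp (Field.commutativeSemiring K) public using (_^_)
      open RingProperties (Field.ring K) public using (-‿involutive; -0#≈0#; x∙y⁻¹≈ε⇒x≈y)
      open FieldProperties K public
    module E where
      open CommutativeRing K[√-D] public
      open Exp (CommutativeRing.commutativeSemiring K[√-D]) public using (_^_)
    module Aut = Automorphism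
    module G = Group absoluteGaloisGroup
    module φ = IsRingHomomorphism embed-isRingHomomorphism

    -‿≉0 : ∀ {x} → x K.≉ K.0# → K.- x K.≉ K.0#
    -‿≉0 x≉0 e = x≉0 (K.trans (K.sym (K.-‿involutive _)) (K.trans (K.-‿cong e) K.-0#≈0#))

  embed-≉0 : ∀ {x} → x K.≉ K.0# → embed x ≉ 0#
  embed-≉0 = FieldHomomorphism.preserves-≉0 K closure embed-isRingHomomorphism

  embed-injective : ∀ {x y} → embed x ≈ embed y → x K.≈ y
  embed-injective {x} {y} e with em {P = x K.≈ y}
  ... | yes p = p
  ... | no ¬p = ⊥-elim (embed-≉0 (λ q → ¬p (K.x∙y⁻¹≈ε⇒x≈y x y q))
    (trans (φ.+-homo x (K.- y)) (trans (+-cong e (φ.-‿homo y)) (-‿inverseʳ _))))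

  private
    2≈ : embed (K.1# K.+ K.1#) ≈ 1# + 1#
    2≈ = trans (φ.+-homo _ _) (+-cong φ.1#-homo φ.1#-homo)

    Ω2≉0 : 1# + 1# ≉ 0#
    Ω2≉0 e = embed-≉0 2≉0 (trans 2≈ e)

  open SquareRoots closure Ω2≉0 closed public using (square-root)

  open FourthRootsOfUnity closure Ω2≉0 i i² public

  w : Carrier
  w = i * √D

  w² : w * w ≈ embed (K.- D)
  w² = begin
    i * √D * (i * √D)     ≈⟨ solve 2 (λ i r → i :* r :* (i :* r) := i :* i :* (r :* r)) refl i √D ⟩
    i * i * (√D * √D)     ≈⟨ *-cong i² √D² ⟩
    - 1# * embed D        ≈⟨ -1*x≈-x _ ⟩
    - embed D             ≈⟨ φ.-‿homo D ⟨
    embed (K.- D)         ∎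

  sign : Sign → Carrier
  sign Sign.+ = 1#
  sign Sign.- = - 1#

  sign-* : ∀ s t → sign (s *ₛ t) ≈ sign s * sign t
  sign-* Sign.+ t      = sym (*-identityˡ _)
  sign-* Sign.- Sign.+ = sym (*-identityʳ _)
  sign-* Sign.- Sign.- = sym (trans (-1*x≈-x _) (-‿involutive 1#))

  sign² : ∀ s → sign s * sign s ≈ 1#
  sign² Sign.+ = *-identityʳ 1#
  sign² Sign.- = trans (-1*x≈-x _) (-‿involutive 1#)

  private
    -- The sign character of a square root of any nonzero d in K; d = D, -1 and -D give χ, η and ε.
    module _ {d} (d≉0 : d K.≉ K.0#) (r : Carrier) (r² : r * r ≈ embed d) where

      private module T = Twist em 2≉0 d≉0 Ω r r²

      ◁≈ : ∀ s x → s T.◁ x ≈ sign s * x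
      ◁≈ Sign.+ x = sym (*-identityˡ x)
      ◁≈ Sign.- x = sym (-1*x≈-x x)

      root-moves : ∀ g → ⟦ g ⟧ r ≈ sign (T.χ g) * r
      root-moves g = trans (T.χ-spec g) (◁≈ (T.χ g) r)

      sign-unique : ∀ g s → ⟦ g ⟧ r ≈ sign s * r → T.χ g ≡ s
      sign-unique g s e = T.χ-unique g s (trans e (sym (◁≈ s r)))

      sign-homo : ∀ g h → T.χ (g G.∙ h) ≡ T.χ g *ₛ T.χ h
      sign-homo = T.χ-homo

    -1≉0 : K.- K.1# K.≉ K.0#
    -1≉0 = -‿≉0 K.1≉0

    i²≈ : i * i ≈ embed (K.- K.1#)
    i²≈ = trans i² (trans (-‿cong (sym φ.1#-homo)) (sym (φ.-‿homo K.1#)))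

    -D≉0 : K.- D K.≉ K.0#
    -D≉0 = -‿≉0 D≉0

  χ η ε : Automorphism → Sign
  χ = Twist.χ em 2≉0 D≉0 Ω √D √D²
  η = Twist.χ em 2≉0 -1≉0 Ω i i²≈
  ε = Twist.χ em 2≉0 -D≉0 Ω w w²

  χ-moves : ∀ g → ⟦ g ⟧ √D ≈ sign (χ g) * √D
  χ-moves = root-moves D≉0 √D √D²

  η-moves : ∀ g → ⟦ g ⟧ i ≈ sign (η g) * i
  η-moves = root-moves -1≉0 i i²≈

  ε-moves : ∀ g → ⟦ g ⟧ w ≈ sign (ε g) * w
  ε-moves = root-moves -D≉0 w w²

  ε-unique : ∀ g s → ⟦ g ⟧ w ≈ sign s * w → ε g ≡ s
  ε-unique = sign-unique -D≉0 w w²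

  ε-homo : ∀ g h → ε (g G.∙ h) ≡ ε g *ₛ ε h
  ε-homo = sign-homo -D≉0 w w²

  ε≡η*χ : ∀ g → ε g ≡ η g *ₛ χ g
  ε≡η*χ g = ε-unique g (η g *ₛ χ g) (begin
    ⟦ g ⟧ (i * √D)                          ≈⟨ Aut.*-homo g i √D ⟩
    ⟦ g ⟧ i * ⟦ g ⟧ √D                      ≈⟨ *-cong (η-moves g) (χ-moves g) ⟩
    sign (η g) * i * (sign (χ g) * √D)      ≈⟨ solve 4 (λ a i b r → a :* i :* (b :* r) := a :* b :* (i :* r)) refl _ _ _ _ ⟩
    sign (η g) * sign (χ g) * w             ≈⟨ *-congʳ (sign-* (η g) (χ g)) ⟨
    sign (η g *ₛ χ g) * w                   ∎)

  -- This relation converts the action on roots of unity into the action on M: every exponent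
  -- computation below rewrites η in this way and is then a finite identity in ℤ/4.
  η≡ε*χ : ∀ g → η g ≡ ε g *ₛ χ g
  η≡ε*χ g = ≡.sym (≡.trans (≡.cong (_*ₛ χ g) (ε≡η*χ g)) (≡.trans (Sign.*-assoc (η g) (χ g) (χ g))
    (≡.trans (≡.cong (η g *ₛ_) (Sign.s*s≡+ (χ g))) (Sign.*-identityʳ (η g)))))

  ε-identity : ε G.ε ≡ Sign.+
  ε-identity = ε-unique G.ε Sign.+ (sym (*-identityˡ w))

  private
    sign*i : ∀ s → sign s * i ≈ ζ (signed s 1F)
    sign*i Sign.+ = trans (*-identityˡ i) (sym ζ1≈i)
    sign*i Sign.- = trans (*-comm _ _) (trans (*-cong (sym ζ1≈i) (sym ζ2≈-1)) (sym (ζ-+ 1F 2F)))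

    ζ1-moves : ∀ g → ⟦ g ⟧ (ζ 1F) ≈ ζ (signed (η g) 1F)
    ζ1-moves g = trans (Aut.⟦⟧-cong g ζ1≈i) (trans (η-moves g) (sign*i (η g)))

    ζ-moves-+ : ∀ g x y → ⟦ g ⟧ (ζ x) ≈ ζ (signed (η g) x) → ⟦ g ⟧ (ζ y) ≈ ζ (signed (η g) y) →
                ⟦ g ⟧ (ζ (x +₄ y)) ≈ ζ (signed (η g) (x +₄ y))
    ζ-moves-+ g x y p q = begin
      ⟦ g ⟧ (ζ (x +₄ y))                         ≈⟨ Aut.⟦⟧-cong g (ζ-+ x y) ⟩
      ⟦ g ⟧ (ζ x * ζ y)                          ≈⟨ Aut.*-homo g _ _ ⟩
      ⟦ g ⟧ (ζ x) * ⟦ g ⟧ (ζ y)                  ≈⟨ *-cong p q ⟩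
      ζ (signed (η g) x) * ζ (signed (η g) y)    ≈⟨ ζ-+ (signed (η g) x) (signed (η g) y) ⟨
      ζ (signed (η g) x +₄ signed (η g) y)       ≡⟨ ≡.cong ζ (signed-+₄ (η g) x y) ⟨
      ζ (signed (η g) (x +₄ y))                  ∎

  ζ-moves : ∀ g x → ⟦ g ⟧ (ζ x) ≈ ζ (signed (η g) x)
  ζ-moves g 0F = trans (Aut.⟦⟧-cong g ζ0≈1) (trans (Aut.1#-homo g)
    (trans (sym ζ0≈1) (reflexive (≡.cong ζ (signed-0 (η g))))))
    where
    signed-0 : ∀ s → 0F ≡ signed s 0F
    signed-0 Sign.+ = ≡.refl
    signed-0 Sign.- = ≡.refl
  ζ-moves g 1F = ζ1-moves g
  ζ-moves g 2F = ζ-moves-+ g 1F 1F (ζ1-moves g) (ζ1-moves g)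
  ζ-moves g 3F = ζ-moves-+ g 1F 2F (ζ1-moves g) (ζ-moves g 2F)

  ω : Sign → Carrier
  ω t = sign t * w

  ω² : ∀ t → ω t * ω t ≈ embed (K.- D)
  ω² t = begin
    sign t * w * (sign t * w)      ≈⟨ solve 2 (λ a w → a :* w :* (a :* w) := a :* a :* (w :* w)) refl (sign t) w ⟩
    sign t * sign t * (w * w)      ≈⟨ *-cong (sign² t) w² ⟩
    1# * embed (K.- D)             ≈⟨ *-identityˡ _ ⟩
    embed (K.- D)                  ∎

  -- The two K-algebra maps from K[√-D] to Ω.

  place : Sign → E.Carrier → Carrier
  place t (a , b) = embed a + ω t * embed b

  place-cong : ∀ t {α β} → α E.≈ β → place t α ≈ place t β
  place-cong t (p , q) = +-cong (φ.⟦⟧-cong p) (*-congˡ (φ.⟦⟧-cong q))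

  place-* : ∀ t α β → place t (α E.* β) ≈ place t α * place t β
  place-* t (a , b) (a′ , b′) = begin
    embed (a K.* a′ K.+ K.- D K.* (b K.* b′)) + ω t * embed (a K.* b′ K.+ b K.* a′)
      ≈⟨ +-cong (trans (φ.+-homo _ _) (+-cong (φ.*-homo _ _) (trans (φ.*-homo _ _) (*-cong (sym (ω² t)) (φ.*-homo b b′)))))
                (*-congˡ (trans (φ.+-homo _ _) (+-cong (φ.*-homo _ _) (φ.*-homo _ _)))) ⟩
    embed a * embed a′ + ω t * ω t * (embed b * embed b′) + ω t * (embed a * embed b′ + embed b * embed a′)
      ≈⟨ solve 5 (λ a b a′ b′ r → a :* a′ :+ r :* r :* (b :* b′) :+ r :* (a :* b′ :+ b :* a′)
                                  := (a :+ r :* b) :* (a′ :+ r :* b′))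
           refl (embed a) (embed b) (embed a′) (embed b′) (ω t) ⟩
    place t (a , b) * place t (a′ , b′) ∎

  place-1 : ∀ t → place t E.1# ≈ 1#
  place-1 t = trans (+-cong φ.1#-homo (trans (*-congˡ φ.0#-homo) (zeroʳ _))) (+-identityʳ 1#)

  place-^4 : ∀ t α → place t (α E.^ 4) ≈ place t α ^ 4
  place-^4 t α = step (step (step (step (place-1 t))))
    where
    step : ∀ {β x} → place t β ≈ x → place t (α E.* β) ≈ place t α * x
    step e = trans (place-* t α _) (*-congˡ e)

  place-norm : ∀ α → embed (norm α) ≈ place Sign.+ α * place Sign.- α
  place-norm (a , b) = begin
    embed (a K.* a K.- K.- D K.* (b K.* b))
      ≈⟨ trans (φ.+-homo _ _) (+-cong (φ.*-homo a a) (trans (φ.-‿homo _)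
           (-‿cong (trans (φ.*-homo _ _) (*-cong (sym w²) (φ.*-homo b b)))))) ⟩
    embed a * embed a - w * w * (embed b * embed b)
      ≈⟨ solve 3 (λ a b w → a :* a :- w :* w :* (b :* b)
                            := (a :+ con (+ 1) :* w :* b) :* (a :+ con -[1+ 0 ] :* w :* b))
           refl (embed a) (embed b) w ⟩
    place Sign.+ (a , b) * place Sign.- (a , b) ∎

  place-moves : ∀ g t α → ⟦ g ⟧ (place t α) ≈ place (ε g *ₛ t) α
  place-moves g t (a , b) = begin
    ⟦ g ⟧ (embed a + ω t * embed b)
      ≈⟨ trans (Aut.+-homo g _ _) (+-cong (Aut.fixes g a) (trans (Aut.*-homo g _ _) (*-cong (ω-moves t) (Aut.fixes g b)))) ⟩
    embed a + ω (ε g *ₛ t) * embed b ∎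
    where
    sign-fixed : ∀ t → ⟦ g ⟧ (sign t) ≈ sign t
    sign-fixed Sign.+ = Aut.1#-homo g
    sign-fixed Sign.- = trans (Aut.-‿homo g 1#) (-‿cong (Aut.1#-homo g))
    ω-moves : ∀ t → ⟦ g ⟧ (ω t) ≈ ω (ε g *ₛ t)
    ω-moves t = begin
      ⟦ g ⟧ (sign t * w)              ≈⟨ Aut.*-homo g _ _ ⟩
      ⟦ g ⟧ (sign t) * ⟦ g ⟧ w        ≈⟨ *-cong (sign-fixed t) (ε-moves g) ⟩
      sign t * (sign (ε g) * w)       ≈⟨ solve 3 (λ a b w → a :* (b :* w) := b :* a :* w) refl (sign t) (sign (ε g)) w ⟩
      sign (ε g) * sign t * w         ≈⟨ *-congʳ (sign-* (ε g) t) ⟨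
      ω (ε g *ₛ t)                    ∎

  private
    ½ : K.Carrier
    ½ = proj₁ (K.inverse _ 2≉0)

    embed-½ : embed ½ * (1# + 1#) ≈ 1#
    embed-½ = begin
      embed ½ * (1# + 1#)                  ≈⟨ *-congˡ (trans (φ.+-homo _ _) (+-cong φ.1#-homo φ.1#-homo)) ⟨
      embed ½ * embed (K.1# K.+ K.1#)      ≈⟨ φ.*-homo _ _ ⟨
      embed (½ K.* (K.1# K.+ K.1#))        ≈⟨ φ.⟦⟧-cong (proj₁ (proj₂ (K.inverse _ 2≉0))) ⟩
      embed K.1#                           ≈⟨ φ.1#-homo ⟩
      1#                                   ∎

    D⁻¹ : K.Carrier
    D⁻¹ = proj₁ (K.inverse D D≉0)

    w⁻¹ : Carrier
    w⁻¹ = - embed D⁻¹ * w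

    w⁻¹*w : w⁻¹ * w ≈ 1#
    w⁻¹*w = begin
      - embed D⁻¹ * w * w         ≈⟨ *-assoc _ _ _ ⟩
      - embed D⁻¹ * (w * w)       ≈⟨ *-congˡ (trans w² (φ.-‿homo D)) ⟩
      - embed D⁻¹ * - embed D     ≈⟨ solve 2 (λ a b → :- a :* :- b := a :* b) refl (embed D⁻¹) (embed D) ⟩
      embed D⁻¹ * embed D         ≈⟨ φ.*-homo _ _ ⟨
      embed (D⁻¹ K.* D)           ≈⟨ φ.⟦⟧-cong (proj₁ (proj₂ (K.inverse D D≉0))) ⟩
      embed K.1#                  ≈⟨ φ.1#-homo ⟩
      1#                          ∎

    halve : ∀ x → embed ½ * (x + x) ≈ x
    halve x = begin
      embed ½ * (x + x)           ≈⟨ solve 2 (λ h x → h :* (x :+ x) := h :* (con (+ 1) :+ con (+ 1)) :* x) refl (embed ½) x ⟩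
      embed ½ * (1# + 1#) * x     ≈⟨ *-congʳ embed-½ ⟩
      1# * x                      ≈⟨ *-identityˡ x ⟩
      x                           ∎

    -- Coordinates with respect to 1 and w: from f₊ = a + wb and f₋ = a - wb, a is half the sum and
    -- b is half the difference divided by w. The inverse of w is -w/D, because w² = -D.
    real imaginary : (Sign → Carrier) → Carrier
    real f      = embed ½ * (f Sign.+ + f Sign.-)
    imaginary f = w⁻¹ * (embed ½ * (f Sign.+ - f Sign.-))

    recover : ∀ f t → real f + ω t * imaginary f ≈ f t
    recover f t = begin
      real f + ω t * imaginary f
        ≈⟨ solve 6 (λ h p q a w v → h :* (p :+ q) :+ a :* w :* (v :* (h :* (p :- q)))
                                    := h :* (p :+ q) :+ (v :* w) :* (a :* (h :* (p :- q))))
             refl (embed ½) (f Sign.+) (f Sign.-) (sign t) w w⁻¹ ⟩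
      real f + w⁻¹ * w * (sign t * (embed ½ * (f Sign.+ - f Sign.-)))
        ≈⟨ +-congˡ (trans (*-congʳ w⁻¹*w) (*-identityˡ _)) ⟩
      real f + sign t * (embed ½ * (f Sign.+ - f Sign.-))
        ≈⟨ combine t ⟩
      f t ∎
      where
      combine : ∀ t → real f + sign t * (embed ½ * (f Sign.+ - f Sign.-)) ≈ f t
      combine Sign.+ = trans (solve 3 (λ h p q → h :* (p :+ q) :+ con (+ 1) :* (h :* (p :- q)) := h :* (p :+ p))
        refl (embed ½) (f Sign.+) (f Sign.-)) (halve _)
      combine Sign.- = trans (solve 3 (λ h p q → h :* (p :+ q) :+ con -[1+ 0 ] :* (h :* (p :- q)) := h :* (q :+ q))
        refl (embed ½) (f Sign.+) (f Sign.-)) (halve _)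

    real-place : ∀ α → real (λ t → place t α) ≈ embed (proj₁ α)
    real-place (a , b) = trans (*-congˡ (solve 3 (λ a b w → a :+ con (+ 1) :* w :* b :+ (a :+ con -[1+ 0 ] :* w :* b) := a :+ a)
      refl (embed a) (embed b) w)) (halve _)

    imaginary-place : ∀ α → imaginary (λ t → place t α) ≈ embed (proj₂ α)
    imaginary-place (a , b) = begin
      w⁻¹ * (embed ½ * (place Sign.+ (a , b) - place Sign.- (a , b)))
        ≈⟨ *-congˡ (*-congˡ (solve 3 (λ a b w → a :+ con (+ 1) :* w :* b :- (a :+ con -[1+ 0 ] :* w :* b) := w :* b :+ w :* b)
             refl (embed a) (embed b) w)) ⟩
      w⁻¹ * (embed ½ * (w * embed b + w * embed b))
        ≈⟨ *-congˡ (halve _) ⟩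
      w⁻¹ * (w * embed b)
        ≈⟨ trans (sym (*-assoc _ _ _)) (trans (*-congʳ w⁻¹*w) (*-identityˡ _)) ⟩
      embed b ∎

  place-injective : ∀ {α β} → (∀ t → place t α ≈ place t β) → α E.≈ β
  place-injective {α} {β} e =
      embed-injective (trans (sym (real-place α)) (trans (*-congˡ (+-cong (e Sign.+) (e Sign.-))) (real-place β)))
    , embed-injective (trans (sym (imaginary-place α))
        (trans (*-congˡ (*-congˡ (+-cong (e Sign.+) (-‿cong (e Sign.-))))) (imaginary-place β)))

  place-unit : ∀ {α} → IsUnit K[√-D] α → ∀ t → place t α ≉ 0#
  place-unit {α} (α⁻¹ , _ , e) t = unit-≉0
    (trans (sym (place-* t α α⁻¹)) (trans (place-cong t e) (place-1 t)))

  open FixedField classical Ω using (fixed⇒embedded)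

  -- The half sum of f₊ and f₋ is invariant, and f₊ - f₋ changes by the same sign as w, so both
  -- coordinates are fixed and lie in K.
  descend : ∀ f → (∀ g t → ⟦ g ⟧ (f t) ≈ f (ε g *ₛ t)) → ∃[ α ] (∀ t → place t α ≈ f t)
  descend f f-moves = from (fixed⇒embedded (real f) real-fixed) (fixed⇒embedded (imaginary f) imaginary-fixed)
    where
    from : ∃[ a ] embed a ≈ real f → ∃[ b ] embed b ≈ imaginary f → ∃[ α ] (∀ t → place t α ≈ f t)
    from (a , p) (b , q) = (a , b) , λ t → trans (+-cong p (*-congˡ q)) (recover f t)

    sum-fixed : ∀ t → f (t *ₛ Sign.+) + f (t *ₛ Sign.-) ≈ f Sign.+ + f Sign.-
    sum-fixed Sign.+ = refl
    sum-fixed Sign.- = +-comm _ _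

    real-fixed : ∀ g → ⟦ g ⟧ (real f) ≈ real f
    real-fixed g = trans (Aut.*-homo g _ _) (*-cong (Aut.fixes g ½)
      (trans (Aut.+-homo g _ _) (trans (+-cong (f-moves g Sign.+) (f-moves g Sign.-)) (sum-fixed (ε g)))))

    difference-moves : ∀ t → f (t *ₛ Sign.+) - f (t *ₛ Sign.-) ≈ sign t * (f Sign.+ - f Sign.-)
    difference-moves Sign.+ = sym (*-identityˡ _)
    difference-moves Sign.- = solve 2 (λ p q → q :- p := con -[1+ 0 ] :* (p :- q)) refl (f Sign.+) (f Sign.-)

    imaginary-fixed : ∀ g → ⟦ g ⟧ (imaginary f) ≈ imaginary f
    imaginary-fixed g = begin
      ⟦ g ⟧ (- embed D⁻¹ * w * (embed ½ * (f Sign.+ - f Sign.-)))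
        ≈⟨ trans (Aut.*-homo g _ _) (*-cong (trans (Aut.*-homo g _ _)
             (*-cong (trans (Aut.-‿homo g _) (-‿cong (Aut.fixes g D⁻¹))) (ε-moves g)))
           (trans (Aut.*-homo g _ _) (*-cong (Aut.fixes g ½)
             (trans (Aut.+-homo g _ _) (trans (+-cong (f-moves g Sign.+)
               (trans (Aut.-‿homo g _) (-‿cong (f-moves g Sign.-)))) (difference-moves (ε g))))))) ⟩
      - embed D⁻¹ * (sign (ε g) * w) * (embed ½ * (sign (ε g) * (f Sign.+ - f Sign.-)))
        ≈⟨ solve 5 (λ d a w h x → :- d :* (a :* w) :* (h :* (a :* x)) := a :* a :* (:- d :* w :* (h :* x)))
             refl (embed D⁻¹) (sign (ε g)) w (embed ½) (f Sign.+ - f Sign.-) ⟩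
      sign (ε g) * sign (ε g) * imaginary f
        ≈⟨ trans (*-congʳ (sign² (ε g))) (*-identityˡ _) ⟩
      imaginary f ∎

  -- The reciprocals of the two places are permuted in the same way as the places, so they descend
  -- to an inverse.
  descend-unit : ∀ {α} → (∀ t → place t α ≉ 0#) → IsUnit K[√-D] α
  descend-unit {α} α≉0 = from (descend reciprocal reciprocal-moves)
    where
    reciprocal : Sign → Carrier
    reciprocal t = proj₁ (inverse (place t α) (α≉0 t))

    reciprocal-* : ∀ t → place t α * reciprocal t ≈ 1#
    reciprocal-* t = proj₂ (proj₂ (inverse (place t α) (α≉0 t)))

    unique : ∀ {x y z} → x * y ≈ 1# → x * z ≈ 1# → y ≈ z
    unique {x} {y} {z} p q = begin
      y            ≈⟨ *-identityʳ y ⟨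
      y * 1#       ≈⟨ *-congˡ q ⟨
      y * (x * z)  ≈⟨ solve 3 (λ x y z → y :* (x :* z) := x :* y :* z) refl x y z ⟩
      x * y * z    ≈⟨ trans (*-congʳ p) (*-identityˡ z) ⟩
      z            ∎

    reciprocal-moves : ∀ g t → ⟦ g ⟧ (reciprocal t) ≈ reciprocal (ε g *ₛ t)
    reciprocal-moves g t = unique (trans (*-congʳ (sym (place-moves g t α)))
      (trans (sym (Aut.*-homo g _ _)) (trans (Aut.⟦⟧-cong g (reciprocal-* t)) (Aut.1#-homo g))))
      (reciprocal-* (ε g *ₛ t))

    from : ∃[ β ] (∀ t → place t β ≈ reciprocal t) → IsUnit K[√-D] α
    from (β , e) = β , E.trans (E.*-comm β α) αβ , αβ
      where
      αβ : α E.* β E.≈ E.1#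
      αβ = place-injective λ t → trans (place-* t α β)
        (trans (*-congˡ (e t)) (trans (reciprocal-* t) (sym (place-1 t))))

  -- Matching cocycles with norm pairs

  open Cohomology (Twist.twistedℤ/4 em 2≉0 D≉0 Ω √D √D²) using (CrossedHomomorphism)
    renaming (_∼_ to _∼ˢ_)
  open CrossedHomomorphism
  open NormPair using (α; c; α-unit; c-unit; Nα≈c⁴)

  -- σ and P correspond to each other when α = β⁴ and c = N(β) for some
  -- β in Ω[√-D] ≅ Ω × Ω on which Galois acts through i^σ.

  record Resolvent (σ : CrossedHomomorphism) (P : NormPair) : Set (k ⊔ s ⊔ sℓ) where
    field
      β       : Sign → Carrier
      fourth  : ∀ t → β t ^ 4 ≈ place t (α P)
      product : β Sign.+ * β Sign.- ≈ embed (c P)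
      moves   : ∀ g t → ⟦ g ⟧ (β t) ≈ ζ (signed (ε g *ₛ t) (value σ g)) * β (ε g *ₛ t)

    nonzero : ∀ t → β t ≉ 0#
    nonzero t β≈0 = place-unit (α-unit P) t
      (trans (sym (fourth t)) (trans (*-congʳ β≈0) (zeroˡ _)))

  open Resolvent

  *-cancelʳ : ∀ {x y z} → z ≉ 0# → x * z ≈ y * z → x ≈ y
  *-cancelʳ {x} {y} {z} z≉0 e = begin
    x                 ≈⟨ *-identityʳ x ⟨
    x * 1#            ≈⟨ *-congˡ z*z⁻¹ ⟨
    x * (z * z⁻¹)     ≈⟨ *-assoc x z z⁻¹ ⟨
    x * z * z⁻¹       ≈⟨ *-congʳ e ⟩
    y * z * z⁻¹       ≈⟨ *-assoc y z z⁻¹ ⟩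
    y * (z * z⁻¹)     ≈⟨ *-congˡ z*z⁻¹ ⟩
    y * 1#            ≈⟨ *-identityʳ y ⟩
    y                 ∎
    where
    z⁻¹ = proj₁ (inverse z z≉0)
    z*z⁻¹ : z * z⁻¹ ≈ 1#
    z*z⁻¹ = proj₂ (proj₂ (inverse z z≉0))

  ζ-≡ : ∀ {x y} → x ≡ y → ζ x ≈ ζ y
  ζ-≡ e = reflexive (≡.cong ζ e)

  ζζ : ∀ x y z → ζ x * (ζ y * z) ≈ ζ (x +₄ y) * z
  ζζ x y z = trans (sym (*-assoc _ _ _)) (*-congʳ (sym (ζ-+ x y)))

  exponent-unique : ∀ t {x y z} → z ≉ 0# → ζ (signed t x) * z ≈ ζ (signed t y) * z → x ≡ y
  exponent-unique t {x} {y} z≉0 e = signed-injective t x y (ζ-injective _ _ (*-cancelʳ z≉0 e))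

  signed-opposite : ∀ t x → signed t x +₄ signed (t *ₛ Sign.-) x ≡ 0F
  signed-opposite = from-yes (allSign? λ t → all? λ x → (signed t x +₄ signed (t *ₛ Sign.-) x) ≟ᶠ 0F)

  -- The exponents at the two places are opposite. This cancellation is why β₊β₋ is fixed by Galois
  -- and unaffected by twisting β.
  ζ-opposite : ∀ t x → ζ (signed t x) * ζ (signed (t *ₛ Sign.-) x) ≈ 1#
  ζ-opposite t x = trans (sym (ζ-+ _ _)) (trans (ζ-≡ (signed-opposite t x)) ζ0≈1)

  product-at : ∀ (f : Sign → Carrier) t → f t * f (t *ₛ Sign.-) ≈ f Sign.+ * f Sign.-
  product-at f Sign.+ = refl
  product-at f Sign.- = *-comm _ _

  embed-^4 : ∀ x → embed (x K.^ 4) ≈ embed x ^ 4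
  embed-^4 x = step (step (step (step φ.1#-homo)))
    where
    step : ∀ {y z} → embed y ≈ z → embed (x K.* y) ≈ embed x * z
    step e = trans (φ.*-homo _ _) (*-congˡ e)

  -- Adding the coboundary of m to the cocycle multiplies β₊ by i^m and β₋ by i^(-m), which alters
  -- neither the fourth powers nor the product.
  resolvent-∼ˢ : ∀ {σ τ P} → σ ∼ˢ τ → Resolvent τ P → Resolvent σ P
  resolvent-∼ˢ {σ} {τ} {P} (m , σ≡) R = record
    { β       = λ t → ζ (signed t m) * β R t
    ; fourth  = λ t → trans (^-distrib-* _ _ 4) (trans (*-cong (ζ^4 (signed t m)) (fourth R t)) (*-identityˡ _))
    ; product = trans (interchange _ _ _ _) (trans (*-cong (ζ-opposite Sign.+ m) (product R)) (*-identityˡ _))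
    ; moves   = λ g t → begin
        ⟦ g ⟧ (ζ (signed t m) * β R t)
          ≈⟨ trans (Aut.*-homo g _ _) (*-cong (ζ-moves g _) (moves R g t)) ⟩
        ζ (signed (η g) (signed t m)) * (ζ (signed (ε g *ₛ t) (value τ g)) * β R (ε g *ₛ t))
          ≈⟨ ζζ _ _ _ ⟩
        ζ (signed (η g) (signed t m) +₄ signed (ε g *ₛ t) (value τ g)) * β R (ε g *ₛ t)
          ≈⟨ *-congʳ (ζ-≡ (exponent g t)) ⟩
        ζ (signed (ε g *ₛ t) (value σ g) +₄ signed (ε g *ₛ t) m) * β R (ε g *ₛ t)
          ≈⟨ ζζ _ _ _ ⟨
        ζ (signed (ε g *ₛ t) (value σ g)) * (ζ (signed (ε g *ₛ t) m) * β R (ε g *ₛ t)) ∎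
    }
    where
    identity : ∀ e x t m y → signed (e *ₛ x) (signed t m) +₄ signed (e *ₛ t) y
                             ≡ signed (e *ₛ t) (y +₄ (signed x m +₄ (-₄ m))) +₄ signed (e *ₛ t) m
    identity = from-yes (allSign? λ e → allSign? λ x → allSign? λ t → all? λ m → all? λ y →
      (signed (e *ₛ x) (signed t m) +₄ signed (e *ₛ t) y)
      ≟ᶠ (signed (e *ₛ t) (y +₄ (signed x m +₄ (-₄ m))) +₄ signed (e *ₛ t) m))
    exponent : ∀ g t → signed (η g) (signed t m) +₄ signed (ε g *ₛ t) (value τ g)
                       ≡ signed (ε g *ₛ t) (value σ g) +₄ signed (ε g *ₛ t) m
    exponent g t = ≡.trans (≡.cong (λ e → signed e (signed t m) +₄ signed (ε g *ₛ t) (value τ g)) (η≡ε*χ g))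
      (≡.trans (identity (ε g) (χ g) t m (value τ g))
        (≡.cong (λ x → signed (ε g *ₛ t) x +₄ signed (ε g *ₛ t) m) (≡.sym (σ≡ g))))

  -- The images of γ at the two places are permuted by ε without any root of unity, so multiplying β
  -- by them leaves the cocycle alone and changes (α, c) by (γ⁴, N(γ)).
  resolvent-∼ᴾ : ∀ {σ P Q} → P ∼ᴾ Q → Resolvent σ Q → Resolvent σ P
  resolvent-∼ᴾ {σ} {P} {Q} (γ , _ , α≈ , c≈) R = record
    { β       = λ t → place t γ * β R t
    ; fourth  = λ t → begin
        (place t γ * β R t) ^ 4            ≈⟨ ^-distrib-* _ _ 4 ⟩
        place t γ ^ 4 * β R t ^ 4          ≈⟨ *-cong (sym (place-^4 t γ)) (fourth R t) ⟩
        place t (γ E.^ 4) * place t (α Q)  ≈⟨ place-* t (γ E.^ 4) (α Q) ⟨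
        place t (γ E.^ 4 E.* α Q)          ≈⟨ place-cong t α≈ ⟨
        place t (α P)                      ∎
    ; product = begin
        place Sign.+ γ * β R Sign.+ * (place Sign.- γ * β R Sign.-)   ≈⟨ interchange _ _ _ _ ⟩
        place Sign.+ γ * place Sign.- γ * (β R Sign.+ * β R Sign.-)   ≈⟨ *-cong (sym (place-norm γ)) (product R) ⟩
        embed (norm γ) * embed (c Q)                                  ≈⟨ φ.*-homo _ _ ⟨
        embed (norm γ K.* c Q)                                        ≈⟨ φ.⟦⟧-cong c≈ ⟨
        embed (c P)                                                   ∎
    ; moves   = λ g t → trans (Aut.*-homo g _ _)
        (trans (*-cong (place-moves g t γ) (moves R g t)) (x∙yz≈y∙xz _ _ _))
    }

  -- The β are multiplied place by place. `ρ` and `S` are described through their values, which the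
  -- group laws on classes then supply.
  resolvent-* : ∀ {σ τ ρ P Q S} → (∀ g → value ρ g ≡ value σ g +₄ value τ g) →
    (∀ t → place t (α S) ≈ place t (α P) * place t (α Q)) → embed (c S) ≈ embed (c P) * embed (c Q) →
    Resolvent σ P → Resolvent τ Q → Resolvent ρ S
  resolvent-* {σ} {τ} {ρ} value-ρ α-S c-S R T = record
    { β       = λ t → β R t * β T t
    ; fourth  = λ t → trans (^-distrib-* _ _ 4) (trans (*-cong (fourth R t) (fourth T t)) (sym (α-S t)))
    ; product = trans (interchange _ _ _ _) (trans (*-cong (product R) (product T)) (sym c-S))
    ; moves   = λ g t → begin
        ⟦ g ⟧ (β R t * β T t)
          ≈⟨ trans (Aut.*-homo g _ _) (*-cong (moves R g t) (moves T g t)) ⟩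
        ζ (signed (ε g *ₛ t) (value σ g)) * β R (ε g *ₛ t) * (ζ (signed (ε g *ₛ t) (value τ g)) * β T (ε g *ₛ t))
          ≈⟨ interchange _ _ _ _ ⟩
        ζ (signed (ε g *ₛ t) (value σ g)) * ζ (signed (ε g *ₛ t) (value τ g)) * (β R (ε g *ₛ t) * β T (ε g *ₛ t))
          ≈⟨ *-congʳ (trans (sym (ζ-+ _ _)) (ζ-≡ (≡.trans (≡.sym (signed-+₄ (ε g *ₛ t) (value σ g) (value τ g)))
               (≡.cong (signed (ε g *ₛ t)) (≡.sym (value-ρ g)))))) ⟩
        ζ (signed (ε g *ₛ t) (value ρ g)) * (β R (ε g *ₛ t) * β T (ε g *ₛ t)) ∎
    }

  -- In the quotient of two resolvents of one cocycle the roots of unity cancel, so it descends to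
  -- an element γ of K[√-D], which relates the pairs.
  resolvent-uniqueᴾ : ∀ {σ P Q} → Resolvent σ P → Resolvent σ Q → P ∼ᴾ Q
  resolvent-uniqueᴾ {σ} {P} {Q} R T = from (descend quotient quotient-moves)
    where
    β⁻¹ : Sign → Carrier
    β⁻¹ t = proj₁ (inverse (β T t) (nonzero T t))

    β*β⁻¹ : ∀ t → β T t * β⁻¹ t ≈ 1#
    β*β⁻¹ t = proj₂ (proj₂ (inverse (β T t) (nonzero T t)))

    quotient : Sign → Carrier
    quotient t = β R t * β⁻¹ t

    quotient-* : ∀ t → quotient t * β T t ≈ β R t
    quotient-* t = trans (*-assoc _ _ _) (trans (*-congˡ (trans (*-comm _ _) (β*β⁻¹ t))) (*-identityʳ _))

    quotient-moves : ∀ g t → ⟦ g ⟧ (quotient t) ≈ quotient (ε g *ₛ t)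
    quotient-moves g t = *-cancelʳ (*-≉0 (ζ≉0 (signed t′ (value σ g))) (nonzero T t′)) (begin
      ⟦ g ⟧ (quotient t) * (ζ (signed t′ (value σ g)) * β T t′)  ≈⟨ *-congˡ (moves T g t) ⟨
      ⟦ g ⟧ (quotient t) * ⟦ g ⟧ (β T t)                         ≈⟨ Aut.*-homo g _ _ ⟨
      ⟦ g ⟧ (quotient t * β T t)                                 ≈⟨ Aut.⟦⟧-cong g (quotient-* t) ⟩
      ⟦ g ⟧ (β R t)                                              ≈⟨ moves R g t ⟩
      ζ (signed t′ (value σ g)) * β R t′                         ≈⟨ *-congˡ (quotient-* t′) ⟨
      ζ (signed t′ (value σ g)) * (quotient t′ * β T t′)         ≈⟨ x∙yz≈y∙xz _ _ _ ⟩
      quotient t′ * (ζ (signed t′ (value σ g)) * β T t′)         ∎)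
      where t′ = ε g *ₛ t

    from : ∃[ γ ] (∀ t → place t γ ≈ quotient t) → P ∼ᴾ Q
    from (γ , e) = γ , descend-unit (λ t γ≈0 → nonzero R t
        (trans (sym (quotient-* t)) (trans (*-congʳ (trans (sym (e t)) γ≈0)) (zeroˡ _))))
      , place-injective (λ t → begin
          place t (α P)                       ≈⟨ fourth R t ⟨
          β R t ^ 4                           ≈⟨ ^-congˡ 4 (trans (*-congʳ (e t)) (quotient-* t)) ⟨
          (place t γ * β T t) ^ 4             ≈⟨ ^-distrib-* _ _ 4 ⟩
          place t γ ^ 4 * β T t ^ 4           ≈⟨ *-cong (sym (place-^4 t γ)) (fourth T t) ⟩
          place t (γ E.^ 4) * place t (α Q)   ≈⟨ place-* t (γ E.^ 4) (α Q) ⟨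
          place t (γ E.^ 4 E.* α Q)           ∎)
      , embed-injective (begin
          embed (c P)                                                       ≈⟨ product R ⟨
          β R Sign.+ * β R Sign.-                                           ≈⟨ *-cong (quotient-* Sign.+) (quotient-* Sign.-) ⟨
          quotient Sign.+ * β T Sign.+ * (quotient Sign.- * β T Sign.-)     ≈⟨ interchange _ _ _ _ ⟩
          quotient Sign.+ * quotient Sign.- * (β T Sign.+ * β T Sign.-)     ≈⟨ *-cong (*-cong (sym (e Sign.+)) (sym (e Sign.-))) (product T) ⟩
          place Sign.+ γ * place Sign.- γ * embed (c Q)                     ≈⟨ *-congʳ (place-norm γ) ⟨
          embed (norm γ) * embed (c Q)                                      ≈⟨ φ.*-homo _ _ ⟨
          embed (norm γ K.* c Q)                                            ∎)

  -- The two values of β₊ are fourth roots of the same element, so they differ by some i^m.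
  -- Comparing the two expressions for the image of β₊ under g shows that the cocycles differ by the
  -- coboundary of m.
  resolvent-uniqueˢ : ∀ {σ τ P} → Resolvent σ P → Resolvent τ P → σ ∼ˢ τ
  resolvent-uniqueˢ {σ} {τ} {P} R T =
    from (fourth-roots em (trans (fourth R Sign.+) (sym (fourth T Sign.+))))
    where
    from : ∃[ m ] β R Sign.+ ≈ ζ m * β T Sign.+ → σ ∼ˢ τ
    from (m , e) = m , λ g → rearrange (χ g) m (value σ g) (value τ g) (exponent-unique (ε g) (nonzero T (ε g))
      (begin
        ζ (signed (ε g) (value σ g +₄ m)) * β T (ε g)
          ≈⟨ trans (*-congʳ (ζ-≡ (signed-+₄ (ε g) (value σ g) m))) (sym (ζζ _ _ _)) ⟩
        ζ (signed (ε g) (value σ g)) * (ζ (signed (ε g) m) * β T (ε g))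
          ≈⟨ *-congˡ (e-at (ε g)) ⟨
        ζ (signed (ε g) (value σ g)) * β R (ε g)
          ≡⟨ ≡.cong (λ t → ζ (signed t (value σ g)) * β R t) (Sign.*-identityʳ (ε g)) ⟨
        ζ (signed (ε g *ₛ Sign.+) (value σ g)) * β R (ε g *ₛ Sign.+)
          ≈⟨ moves R g Sign.+ ⟨
        ⟦ g ⟧ (β R Sign.+)
          ≈⟨ trans (Aut.⟦⟧-cong g e) (Aut.*-homo g _ _) ⟩
        ⟦ g ⟧ (ζ m) * ⟦ g ⟧ (β T Sign.+)
          ≈⟨ *-cong (ζ-moves g m) (moves T g Sign.+) ⟩
        ζ (signed (η g) m) * (ζ (signed (ε g *ₛ Sign.+) (value τ g)) * β T (ε g *ₛ Sign.+))
          ≡⟨ ≡.cong (λ t → ζ (signed (η g) m) * (ζ (signed t (value τ g)) * β T t)) (Sign.*-identityʳ (ε g)) ⟩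
        ζ (signed (η g) m) * (ζ (signed (ε g) (value τ g)) * β T (ε g))
          ≈⟨ ζζ _ _ _ ⟩
        ζ (signed (η g) m +₄ signed (ε g) (value τ g)) * β T (ε g)
          ≈⟨ *-congʳ (ζ-≡ (≡.trans (≡.cong (λ x → x +₄ signed (ε g) (value τ g))
               (≡.trans (≡.cong (λ t → signed t m) (η≡ε*χ g)) (signed-* (ε g) (χ g) m)))
               (≡.sym (signed-+₄ (ε g) (signed (χ g) m) (value τ g))))) ⟩
        ζ (signed (ε g) (signed (χ g) m +₄ value τ g)) * β T (ε g) ∎))
      where
      e-at : ∀ t → β R t ≈ ζ (signed t m) * β T t
      e-at Sign.+ = e
      -- Both products equal c, so the factor i^m at one place forces i^(-m) at the other.
      e-at Sign.- = *-cancelʳ (nonzero R Sign.+) (begin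
        β R Sign.- * β R Sign.+                                       ≈⟨ *-comm _ _ ⟩
        β R Sign.+ * β R Sign.-                                       ≈⟨ trans (product R) (sym (product T)) ⟩
        β T Sign.+ * β T Sign.-                                       ≈⟨ *-identityˡ _ ⟨
        1# * (β T Sign.+ * β T Sign.-)                                ≈⟨ *-congʳ (ζ-opposite Sign.+ m) ⟨
        ζ m * ζ (-₄ m) * (β T Sign.+ * β T Sign.-)                    ≈⟨ interchange _ _ _ _ ⟩
        ζ m * β T Sign.+ * (ζ (-₄ m) * β T Sign.-)                    ≈⟨ trans (*-comm _ _) (*-congˡ (sym e)) ⟩
        ζ (-₄ m) * β T Sign.- * β R Sign.+                            ∎)

      rearrange : ∀ x m y z → y +₄ m ≡ signed x m +₄ z → y ≡ z +₄ (signed x m +₄ (-₄ m))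
      rearrange x m y z p = ≡.trans (identity₁ m y) (≡.trans (≡.cong (λ u → u +₄ (-₄ m)) p) (identity₂ x m z))
        where
        identity₁ : ∀ m y → y ≡ (y +₄ m) +₄ (-₄ m)
        identity₁ = from-yes (all? λ m → all? λ y → y ≟ᶠ ((y +₄ m) +₄ (-₄ m)))
        identity₂ : ∀ x m z → (signed x m +₄ z) +₄ (-₄ m) ≡ z +₄ (signed x m +₄ (-₄ m))
        identity₂ = from-yes (allSign? λ x → all? λ m → all? λ z →
          ((signed x m +₄ z) +₄ (-₄ m)) ≟ᶠ (z +₄ (signed x m +₄ (-₄ m))))

  private
    ζ-cong : ∀ {x y z} → x ≡ y → ζ x * z ≈ ζ y * z
    ζ-cong e = *-congʳ (reflexive (≡.cong ζ e))

    agree-inverse : ∀ g h {x} → ⟦ g ⟧ x ≈ ⟦ h ⟧ x → x ≈ ⟦ g G.⁻¹ G.∙ h ⟧ x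
    agree-inverse g h e = Aut.injective g (trans e (sym (G.inverseʳ g _)))

    ε-agree : ∀ g h → ⟦ g ⟧ w ≈ ⟦ h ⟧ w → ε g ≡ ε h
    ε-agree g h e = ε-unique g (ε h) (trans e (ε-moves h))

    ⟦⟧-^4 : ∀ g x → ⟦ g ⟧ (x ^ 4) ≈ ⟦ g ⟧ x ^ 4
    ⟦⟧-^4 g x = step (step (step (step (Aut.1#-homo g))))
      where
      step : ∀ {y z} → ⟦ g ⟧ y ≈ z → ⟦ g ⟧ (x * y) ≈ ⟦ g ⟧ x * z
      step e = trans (Aut.*-homo g _ _) (*-congˡ e)

  -- The action on β₊ determines the action on β₋ = c/β₊.

  moves-from-+ : ∀ (β : Sign → Carrier) {d} → (∀ t → β t ≉ 0#) → β Sign.+ * β Sign.- ≈ embed d →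
    ∀ g v → ⟦ g ⟧ (β Sign.+) ≈ ζ (signed (ε g) v) * β (ε g) →
    ∀ t → ⟦ g ⟧ (β t) ≈ ζ (signed (ε g *ₛ t) v) * β (ε g *ₛ t)
  moves-from-+ β β≉0 p g v e Sign.+ = trans e
    (reflexive (≡.cong (λ t → ζ (signed t v) * β t) (≡.sym (Sign.*-identityʳ (ε g)))))
  moves-from-+ β {d} β≉0 p g v e Sign.- = *-cancelʳ (λ f → β≉0 Sign.+ (Aut.injective g (trans f (sym (Aut.0#-homo g))))) (begin
    ⟦ g ⟧ (β Sign.-) * ⟦ g ⟧ (β Sign.+)             ≈⟨ trans (*-comm _ _) (sym (Aut.*-homo g _ _)) ⟩
    ⟦ g ⟧ (β Sign.+ * β Sign.-)                     ≈⟨ Aut.⟦⟧-cong g p ⟩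
    ⟦ g ⟧ (embed d)                                 ≈⟨ Aut.fixes g d ⟩
    embed d                                         ≈⟨ trans (product-at β (ε g)) p ⟨
    β (ε g) * β t′                                  ≈⟨ *-identityˡ _ ⟨
    1# * (β (ε g) * β t′)                           ≈⟨ *-congʳ (ζ-opposite (ε g) v) ⟨
    ζ (signed (ε g) v) * ζ (signed t′ v) * (β (ε g) * β t′)     ≈⟨ interchange _ _ _ _ ⟩
    ζ (signed (ε g) v) * β (ε g) * (ζ (signed t′ v) * β t′)     ≈⟨ trans (*-comm _ _) (*-congˡ (sym e)) ⟩
    ζ (signed t′ v) * β t′ * ⟦ g ⟧ (β Sign.+)       ∎)
    where t′ = ε g *ₛ Sign.-

  fourth-root : ∀ a → a ≉ 0# → ∃[ r ] r ^ 4 ≈ a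
  fourth-root a a≉0 = from (square-root a a≉0)
    where
    from : ∃[ q ] q * q ≈ a → ∃[ r ] r ^ 4 ≈ a
    from (q , e) = from′ (square-root q λ q≈0 → a≉0 (trans (sym e) (trans (*-congʳ q≈0) (zeroˡ q))))
      where
      from′ : ∃[ r ] r * r ≈ q → ∃[ r ] r ^ 4 ≈ a
      from′ (r , f) = r , trans (solve 1 (λ r → r :^ 4 := r :* r :* (r :* r)) refl r) (trans (*-cong f f) e)

  module FromAction (P : NormPair) (b : Sign → Carrier) (b^4 : ∀ t → b t ^ 4 ≈ place t (α P))
    (b-product : b Sign.+ * b Sign.- ≈ embed (c P))
    (v : Automorphism → Fin 4) (v-spec : ∀ g → ⟦ g ⟧ (b Sign.+) ≈ ζ (signed (ε g) (v g)) * b (ε g)) where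

    private
      β₊ = b Sign.+

      b≉0 : ∀ t → b t ≉ 0#
      b≉0 t e = place-unit (α-unit P) t (trans (sym (b^4 t)) (trans (*-congʳ e) (zeroˡ _)))

      v-moves : ∀ g t → ⟦ g ⟧ (b t) ≈ ζ (signed (ε g *ₛ t) (v g)) * b (ε g *ₛ t)
      v-moves g = moves-from-+ b b≉0 b-product g (v g) (v-spec g)

      v-agree : ∀ g h → ⟦ g ⟧ w ≈ ⟦ h ⟧ w → ⟦ g ⟧ β₊ ≈ ⟦ h ⟧ β₊ → v g ≡ v h
      v-agree g h e f = exponent-unique (ε g) (b≉0 (ε g)) (begin
        ζ (signed (ε g) (v g)) * b (ε g)    ≈⟨ v-spec g ⟨
        ⟦ g ⟧ β₊                            ≈⟨ f ⟩
        ⟦ h ⟧ β₊                            ≈⟨ v-spec h ⟩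
        ζ (signed (ε h) (v h)) * b (ε h)    ≡⟨ ≡.cong (λ t → ζ (signed t (v h)) * b t) (ε-agree g h e) ⟨
        ζ (signed (ε g) (v h)) * b (ε g)    ∎)

      -- Expanding the image of β₊ under gh gives a root of unity with exponent η(g)ε(h)v(h) +
      -- ε(gh)v(g). As η = εχ, this is ε(gh)(v(g) + χ(g)v(h)).
      v-crossed : ∀ g h → v (g G.∙ h) ≡ v g +₄ signed (χ g) (v h)
      v-crossed g h = exponent-unique t (b≉0 t) (begin
        ζ (signed t (v (g G.∙ h))) * b t
          ≡⟨ ≡.cong (λ t → ζ (signed t (v (g G.∙ h))) * b t) (ε-homo g h) ⟨
        ζ (signed (ε (g G.∙ h)) (v (g G.∙ h))) * b (ε (g G.∙ h))
          ≈⟨ v-spec (g G.∙ h) ⟨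
        ⟦ g ⟧ (⟦ h ⟧ β₊)
          ≈⟨ trans (Aut.⟦⟧-cong g (v-spec h)) (Aut.*-homo g _ _) ⟩
        ⟦ g ⟧ (ζ (signed (ε h) (v h))) * ⟦ g ⟧ (b (ε h))
          ≈⟨ *-cong (ζ-moves g _) (v-moves g (ε h)) ⟩
        ζ (signed (η g) (signed (ε h) (v h))) * (ζ (signed t (v g)) * b t)
          ≈⟨ ζζ _ _ _ ⟩
        ζ (signed (η g) (signed (ε h) (v h)) +₄ signed t (v g)) * b t
          ≈⟨ ζ-cong (≡.trans (≡.cong (λ e → signed e (signed (ε h) (v h)) +₄ signed t (v g)) (η≡ε*χ g))
               (identity (ε g) (χ g) (ε h) (v g) (v h))) ⟩
        ζ (signed t (v g +₄ signed (χ g) (v h))) * b t ∎)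
        where
        t = ε g *ₛ ε h
        identity : ∀ e x f y z → signed (e *ₛ x) (signed f z) +₄ signed (e *ₛ f) y ≡ signed (e *ₛ f) (y +₄ signed x z)
        identity = from-yes (allSign? λ e → allSign? λ x → allSign? λ f → all? λ y → all? λ z →
          (signed (e *ₛ x) (signed f z) +₄ signed (e *ₛ f) y) ≟ᶠ signed (e *ₛ f) (y +₄ signed x z))

    crossedHomomorphism : CrossedHomomorphism
    crossedHomomorphism = record
      { value      = v
      ; cong       = λ {g} {h} e → v-agree g h (e w) (e β₊)
      ; crossed    = v-crossed
      -- The image of w gives ε(g), and the image of β₊ then determines the exponent.
      ; continuous = λ g → w ∷ β₊ ∷ [] , λ { h (e ∷ f ∷ []) → v-agree g h e f }
      }

    resolvent : Resolvent crossedHomomorphism P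
    resolvent = record { β = b ; fourth = b^4 ; product = b-product ; moves = v-moves }

  module FromRoot (P : NormPair) (β₊ : Carrier) (β₊^4 : β₊ ^ 4 ≈ place Sign.+ (α P)) where

    private
      α≉0 : ∀ t → place t (α P) ≉ 0#
      α≉0 = place-unit (α-unit P)

      β₊≉0 : β₊ ≉ 0#
      β₊≉0 e = α≉0 Sign.+ (trans (sym β₊^4) (trans (*-congʳ e) (zeroˡ _)))

      β₋ : Carrier
      β₋ = embed (c P) * proj₁ (inverse β₊ β₊≉0)

      β₊β₋ : β₊ * β₋ ≈ embed (c P)
      β₊β₋ = trans (x∙yz≈y∙xz _ _ _) (trans (*-congˡ (proj₂ (proj₂ (inverse β₊ β₊≉0)))) (*-identityʳ _))

      -- The norm condition enters here: c⁴ = N(α) is the product of the two places of α, and β₋ =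
      -- c/β₊.
      β₋^4 : β₋ ^ 4 ≈ place Sign.- (α P)
      β₋^4 = *-cancelʳ (α≉0 Sign.+) (begin
        β₋ ^ 4 * place Sign.+ (α P)                  ≈⟨ trans (*-congˡ (sym β₊^4)) (*-comm _ _) ⟩
        β₊ ^ 4 * β₋ ^ 4                              ≈⟨ ^-distrib-* β₊ β₋ 4 ⟨
        (β₊ * β₋) ^ 4                                ≈⟨ ^-congˡ 4 β₊β₋ ⟩
        embed (c P) ^ 4                              ≈⟨ embed-^4 (c P) ⟨
        embed (c P K.^ 4)                            ≈⟨ φ.⟦⟧-cong (Nα≈c⁴ P) ⟨
        embed (norm (α P))                           ≈⟨ place-norm (α P) ⟩
        place Sign.+ (α P) * place Sign.- (α P)      ≈⟨ *-comm _ _ ⟩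
        place Sign.- (α P) * place Sign.+ (α P)      ∎)

      b : Sign → Carrier
      b Sign.+ = β₊
      b Sign.- = β₋

      b^4 : ∀ t → b t ^ 4 ≈ place t (α P)
      b^4 Sign.+ = β₊^4
      b^4 Sign.- = β₋^4

      root : ∀ g → ∃[ x ] ⟦ g ⟧ β₊ ≈ ζ x * b (ε g)
      root g = fourth-roots em (begin
        ⟦ g ⟧ β₊ ^ 4                       ≈⟨ ⟦⟧-^4 g β₊ ⟨
        ⟦ g ⟧ (β₊ ^ 4)                     ≈⟨ Aut.⟦⟧-cong g β₊^4 ⟩
        ⟦ g ⟧ (place Sign.+ (α P))         ≈⟨ place-moves g Sign.+ (α P) ⟩
        place (ε g *ₛ Sign.+) (α P)        ≡⟨ ≡.cong (λ t → place t (α P)) (Sign.*-identityʳ (ε g)) ⟩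
        place (ε g) (α P)                  ≈⟨ b^4 (ε g) ⟨
        b (ε g) ^ 4                        ∎)

      v : Automorphism → Fin 4
      -- The root of unity has exponent ε(g)v(g), and applying the sign again recovers v(g).
      v g = signed (ε g) (proj₁ (root g))

      v-spec : ∀ g → ⟦ g ⟧ β₊ ≈ ζ (signed (ε g) (v g)) * b (ε g)
      v-spec g = trans (proj₂ (root g)) (ζ-cong (signed² (ε g) (proj₁ (root g))))
        where
        signed² : ∀ t x → x ≡ signed t (signed t x)
        signed² = from-yes (allSign? λ t → all? λ x → x ≟ᶠ signed t (signed t x))

    resolved : ∃[ σ ] Resolvent σ P
    resolved = FromAction.crossedHomomorphism P b b^4 β₊β₋ v v-spec , FromAction.resolvent P b b^4 β₊β₋ v v-spec

  exists-cocycle : ∀ P → ∃[ σ ] Resolvent σ P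
  exists-cocycle P = from (fourth-root (place Sign.+ (α P)) (place-unit (α-unit P) Sign.+))
    where
    from : ∃[ r ] r ^ 4 ≈ place Sign.+ (α P) → ∃[ σ ] Resolvent σ P
    from (r , e) = FromRoot.resolved P r e

  -- A norm pair for every cocycle

  module FromCocycle (σ : CrossedHomomorphism) where

    private
      S : List Carrier
      S = w ∷ proj₁ (continuous σ G.ε)

      -- Continuity at the identity is uniform: if g and h agree on S, then g⁻¹h agrees there with
      -- the identity, and σ(h) = σ(g) + gσ(g⁻¹h) = σ(g) + gσ(1) = σ(g).
      value-agree : ∀ g h → AgreeOn S g h → value σ g ≡ value σ h
      value-agree g h (_ ∷ p) = ≡.trans (cong σ {g} {g G.∙ G.ε} λ _ → refl) (≡.trans (crossed σ g G.ε) (≡.trans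
        (≡.cong (λ x → value σ g +₄ signed (χ g) x)
          (proj₂ (continuous σ G.ε) h′ (All.map (agree-inverse g h) p)))
        (≡.trans (≡.sym (crossed σ g h′)) (cong σ {g G.∙ h′} {h} λ x → G.inverseʳ g (⟦ h ⟧ x)))))
        where
        h′ = g G.⁻¹ G.∙ h

      -- The weights i^(-σ(γ)) on the kernel of ε, extended by zero. On that kernel η = χ, so the
      -- cocycle relation yields h(i^(-σ(γ))) = i^σ(h) i^(-σ(hγ)), the form required by `hilbert90`.
      weight : Sign → Fin 4 → Carrier
      weight Sign.+ x = ζ (-₄ x)
      weight Sign.- x = 0#

      coefficients : Automorphism → Carrier
      coefficients g = weight (ε g) (value σ g)

      coefficients-agree : ∀ g h → AgreeOn S g h → coefficients g ≈ coefficients h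
      coefficients-agree g h p@(e ∷ _) = reflexive (≡.cong₂ weight (ε-agree g h e) (value-agree g h p))

      coefficients-≉0 : coefficients G.ε ≉ 0#
      coefficients-≉0 e = ζ≉0 (-₄ value σ G.ε)
        (trans (reflexive (≡.cong (λ t → weight t (value σ G.ε)) (≡.sym ε-identity))) e)

    module Pair (b : Sign → Carrier) (b≉0 : ∀ t → b t ≉ 0#)
      (b-moves : ∀ g t → ⟦ g ⟧ (b t) ≈ ζ (signed (ε g *ₛ t) (value σ g)) * b (ε g *ₛ t)) where

      b^4-moves : ∀ g t → ⟦ g ⟧ (b t ^ 4) ≈ b (ε g *ₛ t) ^ 4
      b^4-moves g t = begin
        ⟦ g ⟧ (b t ^ 4)                                                ≈⟨ ⟦⟧-^4 g (b t) ⟩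
        ⟦ g ⟧ (b t) ^ 4                                                ≈⟨ ^-congˡ 4 (b-moves g t) ⟩
        (ζ (signed (ε g *ₛ t) (value σ g)) * b (ε g *ₛ t)) ^ 4         ≈⟨ ^-distrib-* _ _ 4 ⟩
        ζ (signed (ε g *ₛ t) (value σ g)) ^ 4 * b (ε g *ₛ t) ^ 4       ≈⟨ trans (*-congʳ (ζ^4 _)) (*-identityˡ _) ⟩
        b (ε g *ₛ t) ^ 4                                               ∎

      product-fixed : ∀ g → ⟦ g ⟧ (b Sign.+ * b Sign.-) ≈ b Sign.+ * b Sign.-
      product-fixed g = begin
        ⟦ g ⟧ (b Sign.+ * b Sign.-)
          ≈⟨ trans (Aut.*-homo g _ _) (*-cong (b-moves g Sign.+) (b-moves g Sign.-)) ⟩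
        ζ (signed (ε g *ₛ Sign.+) x) * b (ε g *ₛ Sign.+) * (ζ (signed (ε g *ₛ Sign.-) x) * b (ε g *ₛ Sign.-))
          ≡⟨ ≡.cong (λ t → ζ (signed t x) * b t * (ζ (signed (ε g *ₛ Sign.-) x) * b (ε g *ₛ Sign.-))) (Sign.*-identityʳ (ε g)) ⟩
        ζ (signed (ε g) x) * b (ε g) * (ζ (signed (ε g *ₛ Sign.-) x) * b (ε g *ₛ Sign.-))
          ≈⟨ interchange _ _ _ _ ⟩
        ζ (signed (ε g) x) * ζ (signed (ε g *ₛ Sign.-) x) * (b (ε g) * b (ε g *ₛ Sign.-))
          ≈⟨ trans (*-congʳ (ζ-opposite (ε g) x)) (trans (*-identityˡ _) (product-at b (ε g))) ⟩
        b Sign.+ * b Sign.- ∎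
        where x = value σ g

      build : ∃[ a ] (∀ t → place t a ≈ b t ^ 4) → ∃[ d ] embed d ≈ b Sign.+ * b Sign.- → ∃[ P ] Resolvent σ P
      build (a , p) (d , q) = pair , record
        { β = b ; fourth = λ t → sym (p t) ; product = sym q ; moves = b-moves }
        where
        b^4≉0 : ∀ t → b t ^ 4 ≉ 0#
        b^4≉0 t = *-≉0 (b≉0 t) (*-≉0 (b≉0 t) (*-≉0 (b≉0 t) (*-≉0 (b≉0 t) 1≉0)))
        pair : NormPair
        pair = record
          { α      = a
          ; c      = d
          ; α-unit = descend-unit λ t e → b^4≉0 t (trans (sym (p t)) e)
          ; c-unit = K.inverse d λ d≈0 → *-≉0 (b≉0 Sign.+) (b≉0 Sign.-)
                       (trans (sym q) (trans (φ.⟦⟧-cong d≈0) φ.0#-homo))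
          ; Nα≈c⁴  = embed-injective (begin
              embed (norm a)                        ≈⟨ place-norm a ⟩
              place Sign.+ a * place Sign.- a       ≈⟨ *-cong (p Sign.+) (p Sign.-) ⟩
              b Sign.+ ^ 4 * b Sign.- ^ 4           ≈⟨ ^-distrib-* _ _ 4 ⟨
              (b Sign.+ * b Sign.-) ^ 4             ≈⟨ ^-congˡ 4 q ⟨
              embed d ^ 4                           ≈⟨ embed-^4 d ⟨
              embed (d K.^ 4)                       ∎)
          }

      exists : ∃[ P ] Resolvent σ P
      exists = build (descend (λ t → b t ^ 4) b^4-moves)
        (FixedField.fixed⇒embedded classical Ω (b Sign.+ * b Sign.-) product-fixed)

    record Solution : Set (k ⊔ s ⊔ sℓ) where
      constructor solution
      field
        b       : Sign → Carrier
        b≉0     : ∀ t → b t ≉ 0#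
        b-moves : ∀ g t → ⟦ g ⟧ (b t) ≈ ζ (signed (ε g *ₛ t) (value σ g)) * b (ε g *ₛ t)

    Equivariant : Carrier → Set (k ⊔ s ⊔ sℓ)
    Equivariant t = ∀ h a → (∀ γ → ⟦ h ⟧ (coefficients γ) ≈ a * coefficients (h G.∙ γ)) → ⟦ h ⟧ t ≈ a * t

    semi-invariant : ∃[ t ] t ≉ 0# × Equivariant t
    semi-invariant = Hilbert90.hilbert90 classical Ω S coefficients coefficients-agree coefficients-≉0

    module Solve (θ : Carrier) (θ≉0 : θ ≉ 0#) (equivariant : Equivariant θ) where

      θ-moves : ∀ h → ε h ≡ Sign.+ → ⟦ h ⟧ θ ≈ ζ (value σ h) * θ
      θ-moves h εh = equivariant h (ζ (value σ h)) λ γ →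
        trans (weight-moves (ε γ) (value σ γ))
          (*-congˡ (reflexive (≡.cong₂ weight (≡.sym (ε-∙ γ)) (≡.sym (crossed σ h γ)))))
        where
        ε-∙ : ∀ γ → ε (h G.∙ γ) ≡ ε γ
        ε-∙ γ = ≡.trans (ε-homo h γ) (≡.cong (_*ₛ ε γ) εh)
        η≡χ : η h ≡ χ h
        η≡χ = ≡.trans (η≡ε*χ h) (≡.cong (_*ₛ χ h) εh)
        identity : ∀ x y z → signed x (-₄ z) ≡ y +₄ (-₄ (y +₄ signed x z))
        identity = from-yes (allSign? λ x → all? λ y → all? λ z → signed x (-₄ z) ≟ᶠ (y +₄ (-₄ (y +₄ signed x z))))
        weight-moves : ∀ t x → ⟦ h ⟧ (weight t x) ≈ ζ (value σ h) * weight t (value σ h +₄ signed (χ h) x)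
        weight-moves Sign.- x = trans (Aut.0#-homo h) (sym (zeroʳ _))
        weight-moves Sign.+ x = trans (ζ-moves h (-₄ x)) (trans (reflexive (≡.cong ζ
          (≡.trans (≡.cong (λ e → signed e (-₄ x)) η≡χ) (identity (χ h) (value σ h) x)))) (ζ-+ (value σ h) _))

      -- Transporting θ along δ gives the same value for all δ with a given sign ε.

      transported : Automorphism → Carrier
      transported δ = ζ (signed (ε δ) (-₄ value σ δ)) * ⟦ δ ⟧ θ

      -- The element h = δ⁻¹δ′ lies in the kernel of ε, where θ is multiplied by i^σ(h); the cocycle
      -- relation for δ′ = δh cancels this factor.
      transported-agree : ∀ δ δ′ → ε δ ≡ ε δ′ → transported δ ≈ transported δ′
      transported-agree δ δ′ e = sym (begin
        ζ (signed (ε δ′) (-₄ value σ δ′)) * ⟦ δ′ ⟧ θ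
          ≡⟨ ≡.cong₂ (λ t x → ζ (signed t (-₄ x)) * ⟦ δ′ ⟧ θ) (≡.sym e)
               (≡.trans (cong σ {δ′} {δ G.∙ h} λ x → sym (δh x)) (crossed σ δ h)) ⟩
        ζ (signed (ε δ) (-₄ (value σ δ +₄ signed (χ δ) (value σ h)))) * ⟦ δ′ ⟧ θ
          ≈⟨ *-congˡ (trans (sym (δh θ)) (trans (Aut.⟦⟧-cong δ (θ-moves h εh)) (Aut.*-homo δ _ _))) ⟩
        ζ (signed (ε δ) (-₄ (value σ δ +₄ signed (χ δ) (value σ h)))) * (⟦ δ ⟧ (ζ (value σ h)) * ⟦ δ ⟧ θ)
          ≈⟨ *-congˡ (*-congʳ (ζ-moves δ (value σ h))) ⟩
        ζ (signed (ε δ) (-₄ (value σ δ +₄ signed (χ δ) (value σ h)))) * (ζ (signed (η δ) (value σ h)) * ⟦ δ ⟧ θ)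
          ≈⟨ ζζ _ _ _ ⟩
        ζ (signed (ε δ) (-₄ (value σ δ +₄ signed (χ δ) (value σ h))) +₄ signed (η δ) (value σ h)) * ⟦ δ ⟧ θ
          ≈⟨ ζ-cong (≡.trans (≡.cong (λ t → signed (ε δ) (-₄ (value σ δ +₄ signed (χ δ) (value σ h))) +₄ signed t (value σ h))
               (η≡ε*χ δ)) (identity (ε δ) (χ δ) (value σ δ) (value σ h))) ⟩
        transported δ ∎)
        where
        h = δ G.⁻¹ G.∙ δ′
        δh : ∀ x → ⟦ δ ⟧ (⟦ h ⟧ x) ≈ ⟦ δ′ ⟧ x
        δh x = G.inverseʳ δ (⟦ δ′ ⟧ x)
        εh : ε h ≡ Sign.+
        εh = ε-unique h Sign.+ (trans (sym (agree-inverse δ δ′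
          (trans (ε-moves δ) (trans (*-congʳ (reflexive (≡.cong sign e))) (sym (ε-moves δ′)))))) (sym (*-identityˡ w)))
        identity : ∀ e x y z → signed e (-₄ (y +₄ signed x z)) +₄ signed (e *ₛ x) z ≡ signed e (-₄ y)
        identity = from-yes (allSign? λ e → allSign? λ x → all? λ y → all? λ z →
          (signed e (-₄ (y +₄ signed x z)) +₄ signed (e *ₛ x) z) ≟ᶠ signed e (-₄ y))

      transported-moves : ∀ g δ → ⟦ g ⟧ (transported δ) ≈ ζ (signed (ε g *ₛ ε δ) (value σ g)) * transported (g G.∙ δ)
      transported-moves g δ = begin
        ⟦ g ⟧ (ζ (signed (ε δ) (-₄ value σ δ)) * ⟦ δ ⟧ θ)
          ≈⟨ trans (Aut.*-homo g _ _) (*-congʳ (ζ-moves g _)) ⟩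
        ζ (signed (η g) (signed (ε δ) (-₄ value σ δ))) * ⟦ g G.∙ δ ⟧ θ
          ≈⟨ ζ-cong (≡.trans (≡.cong (λ t → signed t (signed (ε δ) (-₄ value σ δ))) (η≡ε*χ g))
               (identity (ε g) (χ g) (ε δ) (value σ g) (value σ δ))) ⟩
        ζ (signed t′ (value σ g) +₄ signed t′ (-₄ (value σ g +₄ signed (χ g) (value σ δ)))) * ⟦ g G.∙ δ ⟧ θ
          ≡⟨ ≡.cong₂ (λ t x → ζ (signed t′ (value σ g) +₄ signed t (-₄ x)) * ⟦ g G.∙ δ ⟧ θ)
               (ε-homo g δ) (crossed σ g δ) ⟨
        ζ (signed t′ (value σ g) +₄ signed (ε (g G.∙ δ)) (-₄ value σ (g G.∙ δ))) * ⟦ g G.∙ δ ⟧ θ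
          ≈⟨ ζζ _ _ _ ⟨
        ζ (signed t′ (value σ g)) * transported (g G.∙ δ) ∎
        where
        t′ = ε g *ₛ ε δ
        identity : ∀ e x f y z → signed (e *ₛ x) (signed f (-₄ z))
                                 ≡ signed (e *ₛ f) y +₄ signed (e *ₛ f) (-₄ (y +₄ signed x z))
        identity = from-yes (allSign? λ e → allSign? λ x → allSign? λ f → all? λ y → all? λ z →
          signed (e *ₛ x) (signed f (-₄ z)) ≟ᶠ (signed (e *ₛ f) y +₄ signed (e *ₛ f) (-₄ (y +₄ signed x z))))

      from-section : (δ : Sign → Automorphism) → (∀ t → ε (δ t) ≡ t) → Solution
      from-section δ ε-δ = solution (λ t → transported (δ t))
        (λ t e → *-≉0 (ζ≉0 _) (λ f → θ≉0 (Aut.injective (δ t) (trans f (sym (Aut.0#-homo (δ t)))))) e)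
        λ g t → trans (transported-moves g (δ t)) (trans
            (reflexive (≡.cong (λ u → ζ (signed (ε g *ₛ u) (value σ g)) * transported (g G.∙ δ t)) (ε-δ t)))
            (*-congˡ (transported-agree (g G.∙ δ t) (δ (ε g *ₛ t))
              (≡.trans (ε-homo g (δ t)) (≡.trans (≡.cong (ε g *ₛ_) (ε-δ t)) (≡.sym (ε-δ (ε g *ₛ t))))))))

      θ⁻¹ : Carrier
      θ⁻¹ = proj₁ (inverse θ θ≉0)

      θ*θ⁻¹ : θ * θ⁻¹ ≈ 1#
      θ*θ⁻¹ = proj₂ (proj₂ (inverse θ θ≉0))

      -- No automorphism links the two places here, so β₋ must be supplied separately. The inverse
      -- of θ transforms by i^(-σ(g)), as required, and makes the product β₊β₋ equal to 1.
      trivial-sign : (∀ g → ε g ≡ Sign.+) → Solution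
      trivial-sign ε≡+ = solution b b≉0 λ g → moves-from-+ b {K.1#} b≉0 (trans θ*θ⁻¹ (sym φ.1#-homo)) g (value σ g)
        (trans (θ-moves g (ε≡+ g)) (reflexive (≡.cong (λ t → ζ (signed t (value σ g)) * b t) (≡.sym (ε≡+ g)))))
        where
        b : Sign → Carrier
        b Sign.+ = θ
        b Sign.- = θ⁻¹
        b≉0 : ∀ t → b t ≉ 0#
        b≉0 Sign.+ = θ≉0
        b≉0 Sign.- = unit-≉0 (trans (*-comm _ _) θ*θ⁻¹)

      solve-cocycle : Solution
      solve-cocycle = from em
        where
        positive : ∀ t → ¬ t ≡ Sign.- → t ≡ Sign.+
        positive Sign.+ _ = ≡.refl
        positive Sign.- n = ⊥-elim (n ≡.refl)
        -- The two cases are those of K[√-D] being a field or, when -D is a square in K, a product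
        -- of two copies of K.
        from : Dec (∃[ τ ] ε τ ≡ Sign.-) → Solution
        from (yes (τ , ετ)) = from-section (λ { Sign.+ → G.ε ; Sign.- → τ }) (λ { Sign.+ → ε-identity ; Sign.- → ετ })
        from (no none)      = trivial-sign λ g → positive (ε g) λ e → none (g , e)

    exists-pair : ∃[ P ] Resolvent σ P
    exists-pair = from (from-θ semi-invariant)
      where
      from-θ : ∃[ t ] t ≉ 0# × Equivariant t → Solution
      from-θ (t , t≉0 , e) = Solve.solve-cocycle t t≉0 e
      from : Solution → ∃[ P ] Resolvent σ P
      from (solution b b≉0 b-moves) = Pair.exists b b≉0 b-moves

-- The quartic algebra and its coordinates

module _ {a aℓ b bℓ} (A : CommutativeRing a aℓ) (B : CommutativeRing b bℓ) where

  private
    module A = CommutativeRing A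
    module B = CommutativeRing B
  open B using (_≈_; _+_; _*_)
  open IntegerCoefficients B using (solve; _:+_; _:*_; _:=_)

  adjoin√-hom : ∀ {j} → IsRingHomomorphism A.rawRing B.rawRing j → ∀ r ρ → ρ * ρ ≈ j r →
    IsRingHomomorphism (CommutativeRing.rawRing (Adjoin.commutativeRing√ A r)) B.rawRing
      (λ x → j (proj₁ x) + ρ * j (proj₂ x))
  adjoin√-hom {j} j-hom r ρ ρ² = isRingHomomorphism
    (CommutativeRing.ring (Adjoin.commutativeRing√ A r)) B.ring _
    (λ (p , q) → B.+-cong (⟦⟧-cong p) (B.*-congˡ (⟦⟧-cong q)))
    (λ (x , y) (x′ , y′) → B.trans (B.+-cong (+-homo x x′) (B.*-congˡ (+-homo y y′)))
      (solve 5 (λ x y x′ y′ ρ → x :+ x′ :+ ρ :* (y :+ y′) := x :+ ρ :* y :+ (x′ :+ ρ :* y′))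
        B.refl (j x) (j y) (j x′) (j y′) ρ))
    (λ (x , y) (x′ , y′) → B.trans
      (B.+-cong (B.trans (+-homo _ _) (B.+-cong (*-homo x x′)
          (B.trans (*-homo r _) (B.*-cong (B.sym ρ²) (*-homo y y′)))))
        (B.*-congˡ (B.trans (+-homo _ _) (B.+-cong (*-homo x y′) (*-homo y x′)))))
      (solve 5 (λ x y x′ y′ ρ → x :* x′ :+ ρ :* ρ :* (y :* y′) :+ ρ :* (x :* y′ :+ y :* x′)
                                := (x :+ ρ :* y) :* (x′ :+ ρ :* y′))
        B.refl (j x) (j y) (j x′) (j y′) ρ))
    (B.trans (B.+-cong 1#-homo (B.trans (B.*-congˡ 0#-homo) (B.zeroʳ ρ))) (B.+-identityʳ _))
    where open IsRingHomomorphism j-hom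

constant-* : ∀ {c ℓ} (R : CommutativeRing c ℓ) r (let open CommutativeRing R) (let open Adjoin R r) t x y →
  CommutativeRing._≈_ commutativeRing√ (constant t *√ (x , y)) (t * x , t * y)
constant-* R r t x y =
    trans (+-congˡ (trans (*-congˡ (zeroˡ y)) (zeroʳ r))) (+-identityʳ _)
  , trans (+-congˡ (zeroˡ x)) (+-identityʳ _)
  where open CommutativeRing R

root² : ∀ {c ℓ} (R : CommutativeRing c ℓ) r (let open CommutativeRing R) (let open Adjoin R r) →
  CommutativeRing._≈_ commutativeRing√ (root *√ root) (constant r)
root² R r =
    trans (+-cong (zeroˡ 0#) (trans (*-congˡ (*-identityˡ 1#)) (*-identityʳ r))) (+-identityˡ r)
  , trans (+-cong (zeroˡ 1#) (zeroʳ 1#)) (+-identityˡ 0#)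
  where open CommutativeRing R

module QuarticBasis {k kℓ} (K : CommutativeRing k kℓ) (a c : CommutativeRing.Carrier K) where

  open CommutativeRing K
  private
    d = (1# + 1#) * a + (1# + 1#) * (c * c)
    module L = Algebra (quarticAlgebra K a c)
    module K[u] = CommutativeRing (Adjoin.commutativeRing√ K d)
  open IntegerCoefficients K using (solve; con; _:+_; _:*_; _:=_)

  basis : Fin 4 → L.Carrier
  basis 0F = (1# , 0#) , (0# , 0#)
  basis 1F = (0# , 1#) , (0# , 0#)
  basis 2F = (0# , 0#) , (1# , 0#)
  basis 3F = (0# , 0#) , (0# , 1#)

  embed-* : ∀ t x y z w → L.embed t L.* ((x , y) , (z , w)) L.≈ ((t * x , t * y) , (t * z , t * w))
  embed-* t x y z w = L.trans
    {L.embed t L.* ((x , y) , (z , w))}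
    {Adjoin.constant K d t K[u].* (x , y) , Adjoin.constant K d t K[u].* (z , w)}
    {(t * x , t * y) , (t * z , t * w)}
    (constant-* (Adjoin.commutativeRing√ K d) _ (Adjoin.constant K d t) (x , y) (z , w))
    (constant-* K d t x y , constant-* K d t z w)

  coordinates : L.Carrier → Fin 4 → Carrier
  coordinates ((x , y) , (z , w)) 0F = x
  coordinates ((x , y) , (z , w)) 1F = y
  coordinates ((x , y) , (z , w)) 2F = z
  coordinates ((x , y) , (z , w)) 3F = w

  -- The left side is written as `sum` over `Fin 4` unfolds, nested to the right and ending in zero,
  -- so that it is the combination occurring in `HasDegree`.
  expand : ∀ (t : Fin 4 → Carrier) →
    (L.embed (t 0F) L.* basis 0F) L.+ ((L.embed (t 1F) L.* basis 1F) L.+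
      ((L.embed (t 2F) L.* basis 2F) L.+ ((L.embed (t 3F) L.* basis 3F) L.+ L.0#)))
    L.≈ ((t 0F , t 1F) , (t 2F , t 3F))
  expand t = L.trans {_} {_} {_}
    (L.+-cong {_} {_} {_} {_} (embed-* (t 0F) _ _ _ _) (L.+-cong {_} {_} {_} {_} (embed-* (t 1F) _ _ _ _)
      (L.+-cong {_} {_} {_} {_} (embed-* (t 2F) _ _ _ _) (L.+-cong {_} {_} {_} {_} (embed-* (t 3F) _ _ _ _) (L.refl {L.0#})))))
    ( ( solve 4 (λ x y z w → x :* con (+ 1) :+ (y :* con (+ 0) :+ (z :* con (+ 0) :+ (w :* con (+ 0) :+ con (+ 0)))) := x)
          refl (t 0F) (t 1F) (t 2F) (t 3F)
      , solve 4 (λ x y z w → x :* con (+ 0) :+ (y :* con (+ 1) :+ (z :* con (+ 0) :+ (w :* con (+ 0) :+ con (+ 0)))) := y)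
          refl (t 0F) (t 1F) (t 2F) (t 3F))
    , ( solve 4 (λ x y z w → x :* con (+ 0) :+ (y :* con (+ 0) :+ (z :* con (+ 1) :+ (w :* con (+ 0) :+ con (+ 0)))) := z)
          refl (t 0F) (t 1F) (t 2F) (t 3F)
      , solve 4 (λ x y z w → x :* con (+ 0) :+ (y :* con (+ 0) :+ (z :* con (+ 0) :+ (w :* con (+ 1) :+ con (+ 0)))) := w)
          refl (t 0F) (t 1F) (t 2F) (t 3F)))

  quartic-degree : HasDegree 4 (quarticAlgebra K a c)
  quartic-degree = basis
    , (λ x → coordinates x , L.sym {_} {_} (expand (coordinates x)))
    , λ t e → independent t (L.trans {_} {_} {_} (L.sym {_} {_} (expand t)) e)
    where
    independent : ∀ t → ((t 0F , t 1F) , (t 2F , t 3F)) L.≈ L.0# → ∀ i → t i ≈ 0#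
    independent t ((p , q) , (r , s)) 0F = p
    independent t ((p , q) , (r , s)) 1F = q
    independent t ((p , q) , (r , s)) 2F = r
    independent t ((p , q) , (r , s)) 3F = s

module Quartic (classical : Classical) {k kℓ s sℓ} {K : Field k kℓ} (2≉0 : CharacteristicNot2 K)
  {D : Field.Carrier K} (D≉0 : Field._≉_ K D (Field.0# K))
  (Ω : SeparableClosure K s sℓ) (√D : SeparableClosure.Carrier Ω)
  (√D² : SeparableClosure._≈_ Ω (SeparableClosure._*_ Ω √D √D) (SeparableClosure.embed Ω D))
  (i : SeparableClosure.Carrier Ω)
  (i² : SeparableClosure._≈_ Ω (SeparableClosure._*_ Ω i i) (SeparableClosure.-_ Ω (SeparableClosure.1# Ω))) where

  open Classical classical
  open SeparableClosure Ω hiding (zero)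
  open Galois Ω
  open Automorphism using (⟦_⟧)
  open RingProperties ring using (x∙y⁻¹≈ε⇒x≈y; -1*x≈-x; -‿involutive; +-inverseˡ-unique)
  open FieldProperties closure
  open CommutativeSemigroupProperties *-commutativeSemigroup using (interchange)
  open Exp commutativeSemiring using (_^_; ^-distrib-*)
  open IntegerCoefficients commutativeRing using (solve; con; :-_; _:+_; _:*_; _:-_; _:=_; _:^_)
  open SetoidReasoning setoid
  open Setting classical 2≉0 D≉0 Ω √D √D² i i²
  open NormPairs K D using (NormPair)
  open Cohomology (Twist.twistedℤ/4 em 2≉0 D≉0 Ω √D √D²) using (CrossedHomomorphism; CorrespondsTo)
  open CrossedHomomorphism using (value)
  open NormPair using (α; c)
  private
    module K = Field K
    module Aut = Automorphism
    module φ = IsRingHomomorphism embed-isRingHomomorphism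

  module _ (a c : K.Carrier) where

    private
      2# = K.1# K.+ K.1#
      d = 2# K.* a K.+ 2# K.* (c K.* c)
      module K[u] = Adjoin (Field.commutativeRing K) d
      module L = Algebra (quarticAlgebra (Field.commutativeRing K) a c)
      Kᵤ = K[u].commutativeRing√
      module Kᵤ = CommutativeRing Kᵤ
      e = K[u].constant (2# K.* c) Kᵤ.+ K[u].root

    u v : L.Carrier
    u = K[u].root , Kᵤ.0#
    v = Kᵤ.0# , Kᵤ.1#

    coordinate : Carrier → Carrier → L.Carrier → Carrier
    coordinate U V ((p , q) , (r , s)) = embed p + U * embed q + V * (embed r + U * embed s)

    coordinate-u : ∀ U V → coordinate U V u ≈ U
    coordinate-u U V = trans (+-cong (+-cong φ.0#-homo (*-congˡ φ.1#-homo)) (*-congˡ (+-cong φ.0#-homo (*-congˡ φ.0#-homo))))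
      (solve 2 (λ U V → con (+ 0) :+ U :* con (+ 1) :+ V :* (con (+ 0) :+ U :* con (+ 0)) := U) refl U V)

    coordinate-v : ∀ U V → coordinate U V v ≈ V
    coordinate-v U V = trans (+-cong (+-cong φ.0#-homo (*-congˡ φ.0#-homo)) (*-congˡ (+-cong φ.1#-homo (*-congˡ φ.0#-homo))))
      (solve 2 (λ U V → con (+ 0) :+ U :* con (+ 0) :+ V :* (con (+ 1) :+ U :* con (+ 0)) := V) refl U V)

    coordinate-cong : ∀ {U U′ V V′} → U ≈ U′ → V ≈ V′ → ∀ z → coordinate U V z ≈ coordinate U′ V′ z
    coordinate-cong e f ((p , q) , (r , s)) = +-cong (+-congˡ (*-congʳ e)) (*-cong f (+-congˡ (*-congʳ e)))

    IsRoots : Carrier → Carrier → Set sℓ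
    IsRoots U V = (U * U ≈ embed d) × (V * V ≈ embed (2# K.* c) + U)

    coordinateHom : ∀ U V → IsRoots U V → AlgebraHom (quarticAlgebra (Field.commutativeRing K) a c) algebra
    coordinateHom U V (U² , V²) = record
      { homomorphism = record { ⟦_⟧ = coordinate U V ; isRingHomomorphism = outer }
      ; commutes = λ x → trans (+-cong (+-congˡ (*-congˡ φ.0#-homo)) (*-congˡ (+-cong φ.0#-homo (*-congˡ φ.0#-homo))))
          (solve 3 (λ x U V → x :+ U :* con (+ 0) :+ V :* (con (+ 0) :+ U :* con (+ 0)) := x) refl (embed x) U V)
      }
      where
      inner : IsRingHomomorphism Kᵤ.rawRing rawRing (λ x → embed (proj₁ x) + U * embed (proj₂ x))
      inner = adjoin√-hom (Field.commutativeRing K) commutativeRing embed-isRingHomomorphism d U U²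
      outer : IsRingHomomorphism L.rawRing rawRing (coordinate U V)
      outer = adjoin√-hom Kᵤ commutativeRing inner e V (trans V² (sym (trans
        (+-cong (trans (φ.+-homo _ _) (trans (+-congˡ φ.0#-homo) (+-identityʳ _)))
          (*-congˡ (trans (φ.+-homo _ _) (+-cong φ.0#-homo φ.1#-homo))))
        (solve 2 (λ x U → x :+ U :* (con (+ 0) :+ con (+ 1)) := x :+ U) refl _ U))))

    module _ (f : AlgebraHom (quarticAlgebra (Field.commutativeRing K) a c) algebra) where

      private module f = AlgebraHom f

      -- 1, u, v and uv form a basis, so a coordinate is determined by its values at u and v.
      hom-determined : ∀ z → coordinate (f.⟦_⟧ u) (f.⟦_⟧ v) z ≈ f.⟦_⟧ z
      hom-determined z@((p , q) , (r , s)) = begin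
        embed p + U * embed q + V * (embed r + U * embed s)
          ≈⟨ solve 6 (λ p q r s U V → p :+ U :* q :+ V :* (r :+ U :* s)
               := p :* con (+ 1) :+ (q :* U :+ (r :* V :+ (s :* (U :* V) :+ con (+ 0)))))
               refl (embed p) (embed q) (embed r) (embed s) U V ⟩
        embed p * 1# + (embed q * U + (embed r * V + (embed s * (U * V) + 0#)))
          ≈⟨ +-cong (*-congˡ f.1#-homo) (+-congˡ (+-congˡ (+-congʳ (*-congˡ UV)))) ⟨
        embed p * f.⟦_⟧ (B.basis 0F) + (embed q * U + (embed r * V + (embed s * f.⟦_⟧ (B.basis 3F) + 0#)))
          ≈⟨ plus (times p 0F) (plus (times q 1F) (plus (times r 2F) (plus (times s 3F) f.0#-homo))) ⟨
        f.⟦_⟧ ((L.embed p L.* B.basis 0F) L.+ ((L.embed q L.* B.basis 1F) L.+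
          ((L.embed r L.* B.basis 2F) L.+ ((L.embed s L.* B.basis 3F) L.+ L.0#))))
          ≈⟨ f.⟦⟧-cong (B.expand (B.coordinates z)) ⟩
        f.⟦_⟧ z ∎
        where
        module B = QuarticBasis (Field.commutativeRing K) a c
        U = f.⟦_⟧ u
        V = f.⟦_⟧ v
        UV : f.⟦_⟧ (B.basis 3F) ≈ U * V
        UV = trans (f.⟦⟧-cong (L.sym {_} {_} (L.trans {_} {_} {_} (constant-* Kᵤ e K[u].root Kᵤ.0# Kᵤ.1#)
          (Kᵤ.zeroʳ K[u].root , Kᵤ.*-identityʳ K[u].root)))) (f.*-homo u v)
        plus : ∀ {x y x′ y′} → f.⟦_⟧ x ≈ x′ → f.⟦_⟧ y ≈ y′ → f.⟦_⟧ (x L.+ y) ≈ x′ + y′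
        plus e e′ = trans (f.+-homo _ _) (+-cong e e′)
        times : ∀ t n → f.⟦_⟧ (L.embed t L.* B.basis n) ≈ embed t * f.⟦_⟧ (B.basis n)
        times t n = trans (f.*-homo _ _) (*-congʳ (f.commutes t))

      hom-roots : IsRoots (f.⟦_⟧ u) (f.⟦_⟧ v)
      hom-roots = (begin
          f.⟦_⟧ u * f.⟦_⟧ u                          ≈⟨ f.*-homo u u ⟨
          f.⟦_⟧ (u L.* u)                            ≈⟨ f.⟦⟧-cong u² ⟩
          f.⟦_⟧ (L.embed d)                          ≈⟨ f.commutes d ⟩
          embed d                                    ∎) , (begin
          f.⟦_⟧ v * f.⟦_⟧ v                          ≈⟨ f.*-homo v v ⟨
          f.⟦_⟧ (v L.* v)                            ≈⟨ f.⟦⟧-cong v² ⟩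
          f.⟦_⟧ (L.embed (2# K.* c) L.+ u)           ≈⟨ f.+-homo _ _ ⟩
          f.⟦_⟧ (L.embed (2# K.* c)) + f.⟦_⟧ u       ≈⟨ +-congʳ (f.commutes _) ⟩
          embed (2# K.* c) + f.⟦_⟧ u                 ∎)
        where
        u² : (u L.* u) L.≈ L.embed d
        u² = L.trans {_} {_} {_}
          (L.sym {_} {_} (IsRingHomomorphism.*-homo (Adjoin.constant-isRingHomomorphism Kᵤ e) K[u].root K[u].root))
          (root² (Field.commutativeRing K) d , Kᵤ.refl {Kᵤ.0#})
        v² : (v L.* v) L.≈ (L.embed (2# K.* c) L.+ u)
        v² = L.trans {_} {_} {_} (root² Kᵤ e) (Kᵤ.refl {e} , Kᵤ.sym {_} {_} (Kᵤ.+-identityˡ Kᵤ.0#))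

  -- Coordinates of the algebra are the same as solutions (U, V) of its two defining equations, so a
  -- labelling of the coordinates amounts to an equivariant enumeration of these solutions by M.
  module FourCoordinates (σ : CrossedHomomorphism) (a c : K.Carrier) (U V : Fin 4 → Carrier)
    (roots : ∀ x → IsRoots a c (U x) (V x))
    (separated : ∀ x y → U x ≈ U y → V x ≈ V y → x ≡ y)
    (exhausted : ∀ U′ V′ → IsRoots a c U′ V′ → ∃[ x ] U x ≈ U′ × V x ≈ V′)
    (U-moves : ∀ g x → ⟦ g ⟧ (U x) ≈ U (signed (χ g) x +₄ value σ g))
    (V-moves : ∀ g x → ⟦ g ⟧ (V x) ≈ V (signed (χ g) x +₄ value σ g)) where

    private
      ι : Fin 4 → AlgebraHom (quarticAlgebra (Field.commutativeRing K) a c) algebra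
      ι x = coordinateHom a c (U x) (V x) (roots x)

      module _ (x y : Fin 4) (e : ∀ z → coordinate a c (U x) (V x) z ≈ coordinate a c (U y) (V y) z) where

        U-equal : U x ≈ U y
        U-equal = trans (sym (coordinate-u a c (U x) (V x))) (trans (e (u a c)) (coordinate-u a c (U y) (V y)))

        V-equal : V x ≈ V y
        V-equal = trans (sym (coordinate-v a c (U x) (V x))) (trans (e (v a c)) (coordinate-v a c (U y) (V y)))

      injective : ∀ x y → (∀ z → coordinate a c (U x) (V x) z ≈ coordinate a c (U y) (V y) z) → x ≡ y
      injective x y e = separated x y (U-equal x y e) (V-equal x y e)

      surjective : ∀ (f : AlgebraHom (quarticAlgebra (Field.commutativeRing K) a c) algebra) →
        ∃[ x ] (∀ {y} → y ≡ x → ∀ z → coordinate a c (U y) (V y) z ≈ AlgebraHom.⟦_⟧ f z)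
      surjective f = from (exhausted _ _ (hom-roots a c f))
        where
        from : ∃[ x ] U x ≈ AlgebraHom.⟦_⟧ f (u a c) × V x ≈ AlgebraHom.⟦_⟧ f (v a c) →
               ∃[ x ] (∀ {y} → y ≡ x → ∀ z → coordinate a c (U y) (V y) z ≈ AlgebraHom.⟦_⟧ f z)
        from (x , e , e′) = x , λ { ≡.refl z → trans (coordinate-cong a c e e′ z) (hom-determined a c f z) }

      coordinate-moves : ∀ g U V z → ⟦ g ⟧ (coordinate a c U V z) ≈ coordinate a c (⟦ g ⟧ U) (⟦ g ⟧ V) z
      coordinate-moves g U V ((p , q) , (r , s)) =
        trans (Aut.+-homo g _ _) (+-cong (linear p q) (trans (Aut.*-homo g _ _) (*-congˡ (linear r s))))
        where
        linear : ∀ p q → ⟦ g ⟧ (embed p + U * embed q) ≈ embed p + ⟦ g ⟧ U * embed q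
        linear p q = trans (Aut.+-homo g _ _) (+-cong (Aut.fixes g p)
          (trans (Aut.*-homo g _ _) (*-congˡ (Aut.fixes g q))))

      equivariant : ∀ g x z → ⟦ g ⟧ (coordinate a c (U x) (V x) z) ≈
        coordinate a c (U (signed (χ g) x +₄ value σ g)) (V (signed (χ g) x +₄ value σ g)) z
      equivariant g x z = trans (coordinate-moves g (U x) (V x) z)
          (coordinate-cong a c (U-moves g x) (V-moves g x) z)

    corresponds : CorrespondsTo σ (quarticAlgebra (Field.commutativeRing K) a c)
    corresponds = record
      { degree      = QuarticBasis.quartic-degree (Field.commutativeRing K) a c
      ; ι           = ι
      ; ι-cong      = λ { ≡.refl z → refl }
      ; ι-bijective = (λ {x} {y} → injective x y) , surjective
      ; equivariant = equivariant
      }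

  module Correspondence (σ : CrossedHomomorphism) (P : NormPair)
    (R : Resolvent σ P) (b≉0 : proj₂ (α P) K.≉ K.0#) where

    open Resolvent R
    private
      2# = K.1# K.+ K.1#

    -- The resolvent of the cocycle g ↦ σ(g) + (g − 1)x, obtained from β by a fourth
    -- root of unity; its coordinates have product c and fourth powers a ± b√-D.

    W : Fin 4 → Sign → Carrier
    W x t = ζ (signed t x) * β t

    U V : Fin 4 → Carrier
    U x = W x Sign.+ * W x Sign.+ + W x Sign.- * W x Sign.-
    V x = W x Sign.+ + W x Sign.-

    private
      W-product : ∀ x → W x Sign.+ * W x Sign.- ≈ embed (c P)
      W-product x = trans (interchange _ _ _ _) (trans (*-cong (ζ-opposite Sign.+ x) product) (*-identityˡ _))

      W-fourth : ∀ x t → W x t ^ 4 ≈ place t (α P)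
      W-fourth x t = trans (^-distrib-* _ _ 4) (trans (*-cong (ζ^4 (signed t x)) (fourth t)) (*-identityˡ _))

      W-+ : ∀ x y t → W (x +₄ y) t ≈ ζ (signed t y) * W x t
      W-+ x y t = trans (*-congʳ (trans (ζ-≡ (signed-+₄ t x y)) (trans (ζ-+ (signed t x) (signed t y)) (*-comm _ _)))) (*-assoc _ _ _)

      -- With η = εχ, the exponent becomes the sign ε(g)t applied to χ(g)x + σ(g). The label thus
      -- moves by the affine action of g on M, while the places are permuted by ε; symmetric
      -- expressions in the two places see only the label.
      W-moves : ∀ g x t → ⟦ g ⟧ (W x t) ≈ W (signed (χ g) x +₄ value σ g) (ε g *ₛ t)
      W-moves g x t = begin
        ⟦ g ⟧ (ζ (signed t x) * β t)
          ≈⟨ trans (Aut.*-homo g _ _) (*-cong (ζ-moves g _) (moves g t)) ⟩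
        ζ (signed (η g) (signed t x)) * (ζ (signed (ε g *ₛ t) (value σ g)) * β (ε g *ₛ t))
          ≈⟨ ζζ _ _ _ ⟩
        ζ (signed (η g) (signed t x) +₄ signed (ε g *ₛ t) (value σ g)) * β (ε g *ₛ t)
          ≈⟨ *-congʳ (ζ-≡ (≡.trans (≡.cong (λ e → signed e (signed t x) +₄ signed (ε g *ₛ t) (value σ g)) (η≡ε*χ g))
               (identity (ε g) (χ g) t x (value σ g)))) ⟩
        W (signed (χ g) x +₄ value σ g) (ε g *ₛ t) ∎
        where
        identity : ∀ e f t x y → signed (e *ₛ f) (signed t x) +₄ signed (e *ₛ t) y ≡ signed (e *ₛ t) (signed f x +₄ y)
        identity = from-yes (allSign? λ e → allSign? λ f → allSign? λ t → all? λ x → all? λ y →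
          (signed (e *ₛ f) (signed t x) +₄ signed (e *ₛ t) y) ≟ᶠ signed (e *ₛ t) (signed f x +₄ y))

      sum-permuted : ∀ (f : Sign → Carrier) t → f (t *ₛ Sign.+) + f (t *ₛ Sign.-) ≈ f Sign.+ + f Sign.-
      sum-permuted f Sign.+ = refl
      sum-permuted f Sign.- = +-comm _ _

      V-moves : ∀ g x → ⟦ g ⟧ (V x) ≈ V (signed (χ g) x +₄ value σ g)
      V-moves g x = trans (Aut.+-homo g _ _) (trans (+-cong (W-moves g x Sign.+) (W-moves g x Sign.-))
        (sum-permuted (W (signed (χ g) x +₄ value σ g)) (ε g)))

      U-moves : ∀ g x → ⟦ g ⟧ (U x) ≈ U (signed (χ g) x +₄ value σ g)
      U-moves g x = trans (Aut.+-homo g _ _) (trans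
        (+-cong (trans (Aut.*-homo g _ _) (*-cong (W-moves g x Sign.+) (W-moves g x Sign.+)))
                (trans (Aut.*-homo g _ _) (*-cong (W-moves g x Sign.-) (W-moves g x Sign.-))))
        (sum-permuted (λ t → W (signed (χ g) x +₄ value σ g) t * W (signed (χ g) x +₄ value σ g) t) (ε g)))

      embed-2 : ∀ x → embed (2# K.* x) ≈ embed x + embed x
      embed-2 x = trans (φ.*-homo _ _) (trans (*-congʳ (trans (φ.+-homo _ _) (+-cong φ.1#-homo φ.1#-homo)))
        (solve 1 (λ x → (con (+ 1) :+ con (+ 1)) :* x := x :+ x) refl (embed x)))

      -- The origin of the nested radical: with p and q the two entries of `W x`, pq = c and p⁴ + q⁴
      -- = 2a give (p² + q²)² = 2a + 2c² and (p + q)² = 2c + (p² + q²).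
      roots : ∀ x → IsRoots (proj₁ (α P)) (c P) (U x) (V x)
      roots x = (begin
          (p * p + q * q) * (p * p + q * q)
            ≈⟨ solve 2 (λ p q → (p :* p :+ q :* q) :* (p :* p :+ q :* q)
                 := p :^ 4 :+ q :^ 4 :+ (p :* q :* (p :* q) :+ p :* q :* (p :* q))) refl p q ⟩
          p ^ 4 + q ^ 4 + (p * q * (p * q) + p * q * (p * q))
            ≈⟨ +-cong (+-cong (W-fourth x Sign.+) (W-fourth x Sign.-)) (+-cong c² c²) ⟩
          place Sign.+ (α P) + place Sign.- (α P) + (embed (c P K.* c P) + embed (c P K.* c P))
            ≈⟨ +-congʳ (solve 3 (λ a b w → a :+ con (+ 1) :* w :* b :+ (a :+ con -[1+ 0 ] :* w :* b) := a :+ a)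
                 refl (embed (proj₁ (α P))) (embed (proj₂ (α P))) w) ⟩
          embed (proj₁ (α P)) + embed (proj₁ (α P)) + (embed (c P K.* c P) + embed (c P K.* c P))
            ≈⟨ trans (φ.+-homo _ _) (+-cong (embed-2 (proj₁ (α P))) (embed-2 (c P K.* c P))) ⟨
          embed (2# K.* proj₁ (α P) K.+ 2# K.* (c P K.* c P)) ∎) , (begin
          (p + q) * (p + q)
            ≈⟨ solve 2 (λ p q → (p :+ q) :* (p :+ q) := p :* q :+ p :* q :+ (p :* p :+ q :* q)) refl p q ⟩
          p * q + p * q + U x
            ≈⟨ +-congʳ (trans (+-cong (W-product x) (W-product x)) (sym (embed-2 (c P)))) ⟩
          embed (2# K.* c P) + U x ∎)
        where
        p = W x Sign.+
        q = W x Sign.-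
        c² : p * q * (p * q) ≈ embed (c P K.* c P)
        c² = trans (*-cong (W-product x) (W-product x)) (sym (φ.*-homo (c P) (c P)))

      w≉0 : w ≉ 0#
      w≉0 e = embed-≉0 D≉0 (begin
        embed D              ≈⟨ -‿involutive _ ⟨
        - - embed D          ≈⟨ -‿cong (φ.-‿homo D) ⟨
        - embed (K.- D)      ≈⟨ -‿cong w² ⟨
        - (w * w)            ≈⟨ -‿cong (trans (*-congʳ e) (zeroˡ w)) ⟩
        - 0#                 ≈⟨ solve 0 (:- con (+ 0) := con (+ 0)) refl ⟩
        0#                   ∎)

      Ω2≉0 : 1# + 1# ≉ 0#
      Ω2≉0 e = embed-≉0 2≉0 (trans (φ.+-homo _ _) (trans (+-cong φ.1#-homo φ.1#-homo) e))

      -- The difference is 2wb, a product of nonzero factors.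
      places-distinct : place Sign.+ (α P) ≉ place Sign.- (α P)
      places-distinct e = *-≉0 Ω2≉0 (*-≉0 w≉0 (embed-≉0 b≉0)) (begin
        (1# + 1#) * (w * embed (proj₂ (α P)))
          ≈⟨ solve 3 (λ a b w → (con (+ 1) :+ con (+ 1)) :* (w :* b)
               := (a :+ con (+ 1) :* w :* b) :- (a :+ con -[1+ 0 ] :* w :* b)) refl (embed (proj₁ (α P))) (embed (proj₂ (α P))) w ⟩
        place Sign.+ (α P) - place Sign.- (α P)
          ≈⟨ trans (+-congʳ e) (-‿inverseʳ _) ⟩
        0# ∎)

      -- p² + q² divides p⁴ - q⁴, the difference of the two distinct places of α; so does p + q,
      -- used next.
      U≉0 : ∀ x → U x ≉ 0#
      U≉0 x e = places-distinct (begin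
        place Sign.+ (α P)          ≈⟨ W-fourth x Sign.+ ⟨
        p ^ 4                         ≈⟨ solve 2 (λ p q → p :^ 4 := (p :* p :+ q :* q) :* (p :* p :- q :* q) :+ q :^ 4) refl p q ⟩
        U x * (p * p - q * q) + q ^ 4 ≈⟨ +-cong (trans (*-congʳ e) (zeroˡ _)) (W-fourth x Sign.-) ⟩
        0# + place Sign.- (α P)     ≈⟨ +-identityˡ _ ⟩
        place Sign.- (α P)          ∎)
        where
        p = W x Sign.+
        q = W x Sign.-

      V≉0 : ∀ x → V x ≉ 0#
      V≉0 x e = places-distinct (begin
        place Sign.+ (α P)          ≈⟨ W-fourth x Sign.+ ⟨
        p ^ 4                         ≈⟨ solve 2 (λ p q → p :^ 4 := (p :+ q) :* ((p :- q) :* (p :* p :+ q :* q)) :+ q :^ 4) refl p q ⟩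
        V x * ((p - q) * U x) + q ^ 4 ≈⟨ +-cong (trans (*-congʳ e) (zeroˡ _)) (W-fourth x Sign.-) ⟩
        0# + place Sign.- (α P)     ≈⟨ +-identityˡ _ ⟩
        place Sign.- (α P)          ∎)
        where
        p = W x Sign.+
        q = W x Sign.-

      x≈-x⇒x≈0 : ∀ {x} → x ≈ - x → x ≈ 0#
      x≈-x⇒x≈0 {x} e = *-cancel-≉0 Ω2≉0 (trans (solve 1 (λ x → (con (+ 1) :+ con (+ 1)) :* x := x :- :- x) refl x)
        (trans (+-congʳ e) (-‿inverseʳ _)))

      V-+2 : ∀ x → V (x +₄ 2F) ≈ - V x
      V-+2 x = trans (+-cong (negated Sign.+) (negated Sign.-))
        (solve 2 (λ p q → :- p :+ :- q := :- (p :+ q)) refl (W x Sign.+) (W x Sign.-))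
        where
        ζ2 : ∀ t → ζ (signed t 2F) ≈ - 1#
        ζ2 Sign.+ = ζ2≈-1
        ζ2 Sign.- = ζ2≈-1
        negated : ∀ t → W (x +₄ 2F) t ≈ - W x t
        negated t = trans (W-+ x 2F t) (trans (*-congʳ (ζ2 t)) (-1*x≈-x _))

      -- For odd y both i^y and i^(-y) have square -1, so the squares of both entries of `W` change
      -- sign. The condition y + y = 2 singles out the odd elements of ℤ/4.
      U-+odd : ∀ x y → y +₄ y ≡ 2F → U (x +₄ y) ≈ - U x
      U-+odd x y y+y≡2 = trans (+-cong (negated Sign.+) (negated Sign.-))
        (solve 2 (λ p q → :- (p :* p) :+ :- (q :* q) := :- (p :* p :+ q :* q)) refl (W x Sign.+) (W x Sign.-))
        where
        identity : ∀ t y → y +₄ y ≡ 2F → signed t y +₄ signed t y ≡ 2F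
        identity t y e = ≡.trans (≡.sym (signed-+₄ t y y)) (≡.trans (≡.cong (signed t) e) (signed-2 t))
          where
          signed-2 : ∀ t → signed t 2F ≡ 2F
          signed-2 Sign.+ = ≡.refl
          signed-2 Sign.- = ≡.refl
        negated : ∀ t → W (x +₄ y) t * W (x +₄ y) t ≈ - (W x t * W x t)
        negated t = begin
          W (x +₄ y) t * W (x +₄ y) t                            ≈⟨ *-cong (W-+ x y t) (W-+ x y t) ⟩
          ζ (signed t y) * W x t * (ζ (signed t y) * W x t)      ≈⟨ interchange _ _ _ _ ⟩
          ζ (signed t y) * ζ (signed t y) * (W x t * W x t)      ≈⟨ *-congʳ (trans (sym (ζ-+ (signed t y) (signed t y)))
                                                                     (trans (ζ-≡ (identity t y y+y≡2)) ζ2≈-1)) ⟩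
          - 1# * (W x t * W x t)                                 ≈⟨ -1*x≈-x _ ⟩
          - (W x t * W x t)                                      ∎

      -- An odd difference of labels negates U and the difference 2 negates V; neither vanishes and
      -- 2 is invertible, so only the difference 0 is left.
      separated : ∀ x y → U x ≈ U y → V x ≈ V y → x ≡ y
      separated x y e f = ≡.trans (from δ ≡.refl) (difference x y)
        where
        δ = y +₄ (-₄ x)
        difference : ∀ x y → x +₄ (y +₄ (-₄ x)) ≡ y
        difference = from-yes (all? λ x → all? λ y → (x +₄ (y +₄ (-₄ x))) ≟ᶠ y)
        identityʳ : ∀ x → x ≡ x +₄ 0F
        identityʳ = from-yes (all? λ x → x ≟ᶠ (x +₄ 0F))
        e′ : U x ≈ U (x +₄ δ)
        e′ = trans e (reflexive (≡.cong U (≡.sym (difference x y))))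
        f′ : V x ≈ V (x +₄ δ)
        f′ = trans f (reflexive (≡.cong V (≡.sym (difference x y))))
        odd : ∀ n → n +₄ n ≡ 2F → U x ≈ U (x +₄ n) → ⊥
        odd n n+n≡2 e = U≉0 x (x≈-x⇒x≈0 (trans e (U-+odd x n n+n≡2)))
        from : ∀ n → n ≡ δ → x ≡ x +₄ δ
        from 0F p = ≡.trans (identityʳ x) (≡.cong (x +₄_) p)
        from 1F p = ⊥-elim (odd δ (≡.subst (λ n → n +₄ n ≡ 2F) p ≡.refl) e′)
        from 2F p = ⊥-elim (V≉0 x (x≈-x⇒x≈0 (trans f′ (trans (reflexive (≡.cong (λ n → V (x +₄ n)) (≡.sym p))) (V-+2 x)))))
        from 3F p = ⊥-elim (odd δ (≡.subst (λ n → n +₄ n ≡ 2F) p ≡.refl) e′)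

      equal-squares : ∀ {x y} → x * x ≈ y * y → x ≈ y ⊎ x ≈ - y
      equal-squares {x} {y} e = from em
        where
        from : Dec (x ≈ y) → x ≈ y ⊎ x ≈ - y
        from (yes p) = inj₁ p
        from (no ¬p) = inj₂ (+-inverseˡ-unique x y (*-cancel-≉0 (λ q → ¬p (x∙y⁻¹≈ε⇒x≈y x y q))
          (trans (solve 2 (λ x y → (x :- y) :* (x :+ y) := x :* x :- y :* y) refl x y)
            (trans (+-congʳ e) (-‿inverseʳ _)))))

      -- Each equation leaves only a choice of sign. Labels 0 and 2 share one value of U, labels 1
      -- and 3 share its negative, and within each pair V takes both signs.
      exhausted : ∀ U′ V′ → IsRoots (proj₁ (α P)) (c P) U′ V′ → ∃[ x ] U x ≈ U′ × V x ≈ V′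
      exhausted U′ V′ (U′² , V′²) = from (equal-squares (trans U′² (sym (proj₁ (roots 0F)))))
        where
        from-V : ∀ x → U x ≈ U′ → U (x +₄ 2F) ≈ U′ → ∃[ x ] U x ≈ U′ × V x ≈ V′
        from-V x e e′ = choose (equal-squares (trans V′² (trans (+-congˡ (sym e)) (sym (proj₂ (roots x))))))
          where
          choose : V′ ≈ V x ⊎ V′ ≈ - V x → ∃[ x ] U x ≈ U′ × V x ≈ V′
          choose (inj₁ f) = x , e , sym f
          choose (inj₂ f) = x +₄ 2F , e′ , trans (V-+2 x) (sym f)
        U1 : U 1F ≈ - U 0F
        U1 = U-+odd 0F 1F ≡.refl
        from : U′ ≈ U 0F ⊎ U′ ≈ - U 0F → ∃[ x ] U x ≈ U′ × V x ≈ V′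
        from (inj₁ e) = from-V 0F (sym e) (trans (U-+odd 1F 1F ≡.refl)
          (trans (-‿cong U1) (trans (-‿involutive _) (sym e))))
        from (inj₂ e) = from-V 1F (trans U1 (sym e)) (trans (U-+odd 0F 3F ≡.refl) (sym e))

    corresponds : CorrespondsTo σ (quarticAlgebra (Field.commutativeRing K) (proj₁ (α P)) (c P))
    corresponds = FourCoordinates.corresponds σ (proj₁ (α P)) (c P) U V roots separated exhausted U-moves V-moves

-- The isomorphism

module _ {a aℓ b bℓ} (A : Group a aℓ) (B : Group b bℓ) where

  private
    module A = Group A
    module B = Group B
    module B-properties = GroupProperties B

  isGroupIsomorphism : (f : A.Carrier → B.Carrier) →
    (∀ {x y} → x A.≈ y → f x B.≈ f y) →
    (∀ x y → f (x A.∙ y) B.≈ f x B.∙ f y) →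
    (∀ x y → f x B.≈ f y → x A.≈ y) →
    (∀ y → ∃[ x ] f x B.≈ y) →
    IsGroupIsomorphism A.rawGroup B.rawGroup f
  isGroupIsomorphism f cong homo injective surjective = record
    { isGroupMonomorphism = record
      { isGroupHomomorphism = record
        { isMonoidHomomorphism = record
          { isMagmaHomomorphism = record { isRelHomomorphism = record { cong = cong } ; homo = homo }
          ; ε-homo = ε-homo
          }
        ; ⁻¹-homo = λ x → B-properties.inverseˡ-unique _ _
            (B.trans (B.sym (homo (x A.⁻¹) x)) (B.trans (cong (A.inverseˡ x)) ε-homo))
        }
      ; injective = λ {x} {y} → injective x y
      }
    ; surjective = λ y → proj₁ (surjective y) , λ e → B.trans (cong e) (proj₂ (surjective y))
    }
    where
    ε-homo : f A.ε B.≈ B.ε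
    ε-homo = B-properties.identityˡ-unique _ _ (B.trans (B.sym (homo A.ε A.ε)) (cong (A.identityˡ A.ε)))

module Isomorphism (classical : Classical) {k kℓ s sℓ} {K : Field k kℓ} (2≉0 : CharacteristicNot2 K)
  {D : Field.Carrier K} (D≉0 : Field._≉_ K D (Field.0# K))
  (Ω : SeparableClosure K s sℓ) (√D : SeparableClosure.Carrier Ω)
  (√D² : SeparableClosure._≈_ Ω (SeparableClosure._*_ Ω √D √D) (SeparableClosure.embed Ω D))
  (i : SeparableClosure.Carrier Ω)
  (i² : SeparableClosure._≈_ Ω (SeparableClosure._*_ Ω i i) (SeparableClosure.-_ Ω (SeparableClosure.1# Ω))) where

  open SeparableClosure Ω hiding (zero)
  open Galois Ω
  open Setting classical 2≉0 D≉0 Ω √D √D² i i²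
  open Quartic classical 2≉0 D≉0 Ω √D √D² i i² using (module Correspondence)
  open NormPairs using (NormPair; normPairGroup)
  private
    module φ = IsRingHomomorphism embed-isRingHomomorphism
    module H¹ = AbelianGroup (Galois.Cohomology.H¹ Ω (Twist.twistedℤ/4 (Classical.em classical) 2≉0 D≉0 Ω √D √D²))
    module T = AbelianGroup (normPairGroup K D)

  classify : Galois.Cohomology.CrossedHomomorphism Ω (Twist.twistedℤ/4 (Classical.em classical) 2≉0 D≉0 Ω √D √D²) →
             NormPair K D
  classify σ = proj₁ (FromCocycle.exists-pair σ)

  classify-resolvent : ∀ σ → Resolvent σ (classify σ)
  classify-resolvent σ = proj₂ (FromCocycle.exists-pair σ)

  module _ (f : Galois.Cohomology.CrossedHomomorphism Ω (Twist.twistedℤ/4 (Classical.em classical) 2≉0 D≉0 Ω √D √D²) →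
                NormPair K D)
    (f-resolvent : ∀ σ → Resolvent σ (f σ)) where

    private
      f-unique : ∀ σ P → Resolvent σ P → NormPairs._∼_ K D (f σ) P
      f-unique σ P R = resolvent-uniqueᴾ {σ} {f σ} {P} (f-resolvent σ) R

      f-characterised : ∀ σ P → NormPairs._∼_ K D (f σ) P → Resolvent σ P
      f-characterised σ P e = resolvent-∼ᴾ {σ} {P} {f σ} (T.sym {f σ} {P} e) (f-resolvent σ)

    -- Any choice of a matched pair for each cocycle works: matching respects both equivalences, is
    -- multiplicative, and determines each class from the other. Independence of the chosen pair is
    -- `resolvent-uniqueᴾ`, injectivity is `resolvent-uniqueˢ`, and surjectivity is the extraction
    -- of a fourth root of α.
    f-isomorphism : IsGroupIsomorphism
      (AbelianGroup.rawGroup (Galois.Cohomology.H¹ Ω (Twist.twistedℤ/4 (Classical.em classical) 2≉0 D≉0 Ω √D √D²)))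
      (AbelianGroup.rawGroup (normPairGroup K D)) f
    f-isomorphism = isGroupIsomorphism
      (AbelianGroup.group (Galois.Cohomology.H¹ Ω (Twist.twistedℤ/4 (Classical.em classical) 2≉0 D≉0 Ω √D √D²)))
      (AbelianGroup.group (normPairGroup K D)) f
      (λ {σ} {τ} e → f-unique σ (f τ) (resolvent-∼ˢ {σ} {τ} {f τ} e (f-resolvent τ)))
      (λ σ τ → f-unique (σ H¹.∙ τ) (f σ T.∙ f τ)
        (resolvent-* {σ} {τ} {σ H¹.∙ τ} {f σ} {f τ} {f σ T.∙ f τ} (λ _ → ≡.refl)
          (λ t → place-* t (NormPair.α (f σ)) (NormPair.α (f τ))) (φ.*-homo _ _) (f-resolvent σ) (f-resolvent τ)))
      (λ σ τ e → resolvent-uniqueˢ {σ} {τ} {f τ} (f-characterised σ (f τ) e) (f-resolvent τ))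
      (λ P → surjective P (exists-cocycle P))
      where
      surjective : ∀ P → ∃[ σ ] Resolvent σ P → ∃[ σ ] NormPairs._∼_ K D (f σ) P
      surjective P (σ , R) = σ , f-unique σ P R

    f-corresponds : ∀ σ P → NormPairs._∼_ K D (f σ) P → Field._≉_ K (proj₂ (NormPair.α P)) (Field.0# K) →
      Galois.Cohomology.CorrespondsTo Ω (Twist.twistedℤ/4 (Classical.em classical) 2≉0 D≉0 Ω √D √D²) σ
        (quarticAlgebra (Field.commutativeRing K) (proj₁ (NormPair.α P)) (NormPair.c P))
    f-corresponds σ P e b≉0 = Correspondence.corresponds σ P (f-characterised σ P e) b≉0

imaginary-unit : ∀ {k kℓ s sℓ} (K : Field k kℓ) → CharacteristicNot2 K → (Ω : SeparableClosure K s sℓ)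
  (let module Ω = SeparableClosure Ω) → ∃[ i ] i Ω.* i Ω.≈ Ω.- Ω.1#
imaginary-unit K 2≉0 Ω = SquareRoots.square-root closure Ω2≉0 closed (- 1#) -1≉0
  where
  open SeparableClosure Ω
  open RingProperties ring using (-‿involutive; -0#≈0#)
  module φ = IsRingHomomorphism embed-isRingHomomorphism
  Ω2≉0 : 1# + 1# ≉ 0#
  Ω2≉0 e = FieldHomomorphism.preserves-≉0 K closure embed-isRingHomomorphism 2≉0
    (trans (φ.+-homo _ _) (trans (+-cong φ.1#-homo φ.1#-homo) e))
  -1≉0 : - 1# ≉ 0#
  -1≉0 e = 1≉0 (trans (sym (-‿involutive 1#)) (trans (-‿cong e) -0#≈0#))

theorem5p5 :
  (classical : Classical) →
  ∀ {k kℓ s sℓ} (K : Field k kℓ) (let module K = Field K) →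
  (2≉0 : CharacteristicNot2 K) →
  (D : K.Carrier) (D≉0 : D K.≉ K.0#) →
  (Ω : SeparableClosure K s sℓ) (let module Ω = SeparableClosure Ω) →
  (√D : Ω.Carrier) (√D² : √D Ω.* √D Ω.≈ Ω.embed D) →
  let M = Twist.twistedℤ/4 (Classical.em classical) 2≉0 D≉0 Ω √D √D²
      open Galois.Cohomology Ω M
      open NormPairs K D
      module H¹ = AbelianGroup H¹
      module T = AbelianGroup normPairGroup
  in
  ∃[ φ ] IsGroupIsomorphism H¹.rawGroup T.rawGroup φ ×
         (∀ (σ : CrossedHomomorphism) (P : NormPair) →
            let a = proj₁ (NormPair.α P)
                b = proj₂ (NormPair.α P)
                c = NormPair.c P
            in
            φ σ T.≈ P →
            b K.≉ K.0# →
            CorrespondsTo σ (quarticAlgebra K.commutativeRing a c))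
theorem5p5 classical K 2≉0 D D≉0 Ω √D √D² =
  I.classify , I.f-isomorphism I.classify I.classify-resolvent , I.f-corresponds I.classify I.classify-resolvent
  where
  module I = Isomorphism classical 2≉0 D≉0 Ω √D √D² (proj₁ (imaginary-unit K 2≉0 Ω)) (proj₂ (imaginary-unit K 2≉0 Ω))
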